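{- The epi-recursors $r_1,\ldots,r_9$ defined in the context compare as follows with respect to their expressiveness: $r_6\geq r_5\geq r_4\geq r_2\geq r_1\equiv r_3$, and $r_9\geq r_8$, and $r_9\geq r_7$.
   Context: **Epi-recursors and strength.** An epi-recursor is a tuple $r=(\underline{\mathcal B},T,\underline{\mathcal C},I,R)$ where $\underline{\mathcal B}$ is a category (the base category), $T$ is an object of $\underline{\mathcal B}$ (the base object), $\underline{\mathcal C}$ is a category (the extended category), $I$ is an initial object of $\underline{\mathcal C}$, and $R:\underline{\mathcal C}\to\underline{\mathcal B}$ is a functor with $R\,I=T$. Write $!_{I,C}:I\to C$ for the unique morphism. A morphism $g:T\to B$ in $\underline{\mathcal B}$ is definable by $r$ if $g=R\,!_{I,C}$ for some object $C$ of $\underline{\mathcal C}$ with $R\,C=B$. For epi-recursors $r,r'$ with the same base category and base object, $r'\geq r$ means that every morphism $g:T\to B$ of $\underline{\mathcal B}$ (for every object $B$) that is definable by $r$ is definable by $r'$; $r\equiv r'$ means $r\geq r'$ and $r'\geq r$. **Terms.** $\mathsf{Var}$ is a countably infinite set of variables. $\mathsf{Tr}$ is the set of $\lambda$-terms over $\mathsf{Var}$, i.e. $\alpha$-equivalence classes of the preterms freely generated by the grammar $p::=\mathsf{PVr}\,x\mid\mathsf{PAp}\,p_1\,p_2\mid\mathsf{PLm}\,x\,p$ (where $\mathsf{PLm}\,x\,p$ binds $x$ in $p$), with induced constructors $\mathsf{Vr}:\mathsf{Var}\to\mathsf{Tr}$, $\mathsf{Ap}:\mathsf{Tr}\to\mathsf{Tr}\to\mathsf{Tr}$,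 $\mathsf{Lm}:\mathsf{Var}\to\mathsf{Tr}\to\mathsf{Tr}$. $\mathsf{Perm}$ is the set of bijections $\sigma:\mathsf{Var}\to\mathsf{Var}$ with $\mathsf{supp}\,\sigma=\{x\mid\sigma\,x\neq x\}$ finite; $\mathsf{id}$ is the identity; $x\leftrightarrow y$ is the transposition of $x$ and $y$. For variables, $x[z_1\wedge z_2]=(z_1\leftrightarrow z_2)(x)$, and $x[y/z]$ is $y$ if $x=z$ and $x$ otherwise. The standard operators on terms are: permutation $t[\sigma]$ (apply $\sigma$ to all variables of $t$, free, bound and binding), swapping $t[x\wedge y]=t[x\leftrightarrow y]$, capture-avoiding substitution $t[s/x]$ of the term $s$ for the variable $x$ in $t$, renaming $t[y/x]=t[(\mathsf{Vr}\,y)/x]$, the free-variable operator $\mathsf{FV}\,t$, and freshness $x\,\#\,t$ iff $x\notin\mathsf{FV}\,t$. **Signatures and models.** The symbols are $\mathsf{vr},\mathsf{ap},\mathsf{lm},\mathsf{pm},\mathsf{sw},\mathsf{sb},\mathsf{ren},\mathsf{fv},\mathsf{fr}$; a signature is a set of symbols. $\Sigma_{\mathsf{ctor}}=\{\mathsf{vr},\mathsf{ap},\mathsf{lm}\}$. A $\Sigma$-model $\mathcal M$ consists of a carrier set $M$ and, for each symbol in $\Sigma$, an operation/relation: $\mathsf{vr}$: $\mathsf{Vr}^{\mathcal M}:\mathsf{Var}\to M$; $\mathsf{ap}$: $\mathsf{Ap}^{\mathcal M}:M\to M\to M$; $\mathsf{lm}$: $\mathsf{Lm}^{\mathcal M}:\mathsf{Var}\to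 M\to M$; $\mathsf{pm}$: $\_[\_]^{\mathcal M}:M\to\mathsf{Perm}\to M$; $\mathsf{sw}$: $\_[\_\wedge\_]^{\mathcal M}:M\to\mathsf{Var}\to\mathsf{Var}\to M$; $\mathsf{sb}$: $\_[\_/\_]^{\mathcal M}:M\to M\to\mathsf{Var}\to M$; $\mathsf{ren}$: $\_[\_/\_]^{\mathcal M}:M\to\mathsf{Var}\to\mathsf{Var}\to M$; $\mathsf{fv}$: $\mathsf{FV}^{\mathcal M}:M\to\mathcal P(\mathsf{Var})$; $\mathsf{fr}$: $\#^{\mathcal M}:\mathsf{Var}\to M\to\mathsf{Bool}$. A morphism $g:\mathcal M\to\mathcal M'$ of $\Sigma$-models is a function $g:M\to M'$ commuting with all the operations for symbols in $\Sigma\cap\{\mathsf{vr},\mathsf{ap},\mathsf{lm},\mathsf{pm},\mathsf{sw},\mathsf{sb},\mathsf{ren}\}$ (e.g. $g(\mathsf{Lm}^{\mathcal M}x\,m)=\mathsf{Lm}^{\mathcal M'}x\,(g\,m)$, $g(m[n/x]^{\mathcal M})=(g\,m)[(g\,n)/x]^{\mathcal M'}$), and such that $x\,\#^{\mathcal M}\,m$ implies $x\,\#^{\mathcal M'}(g\,m)$ if $\mathsf{fr}\in\Sigma$, and $\mathsf{FV}^{\mathcal M'}(g\,m)\subseteq\mathsf{FV}^{\mathcal M}m$ if $\mathsf{fv}\in\Sigma$. $\mathcal{T}r(\Sigma)$ is the $\Sigma$-model with carrier $\mathsf{Tr}$ and the standard operators on terms. **Properties** (interpreted in a model $\mathcal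 M$, superscripts omitted; $m,m_1,m_2,n$ range over $M$; $x,x',x_i,y,y_i,z,z_i$ over $\mathsf{Var}$; $\sigma,\tau$ over $\mathsf{Perm}$; all universally quantified unless said otherwise). Swapping: SwVr: $(\mathsf{Vr}\,x)[z_1\wedge z_2]=\mathsf{Vr}(x[z_1\wedge z_2])$. SwAp: $(\mathsf{Ap}\,m_1\,m_2)[z_1\wedge z_2]=\mathsf{Ap}(m_1[z_1\wedge z_2])(m_2[z_1\wedge z_2])$. SwLm: $(\mathsf{Lm}\,x\,m)[z_1\wedge z_2]=\mathsf{Lm}(x[z_1\wedge z_2])(m[z_1\wedge z_2])$. SwId: $m[z\wedge z]=m$. SwIv: $m[x\wedge y][x\wedge y]=m$. SwCp: $m[x\wedge y][z_1\wedge z_2]=(m[z_1\wedge z_2])[(x[z_1\wedge z_2])\wedge(y[z_1\wedge z_2])]$. SwFv: if $x,y\notin\mathsf{FV}\,m$ then $m[x\wedge y]=m$. SwCg: if $z\notin\{x_1,x_2\}$, $z\,\#\,m_1$, $z\,\#\,m_2$ and $m_1[z\wedge x_1]=m_2[z\wedge x_2]$ then $\mathsf{Lm}\,x_1\,m_1=\mathsf{Lm}\,x_2\,m_2$. SwBvr: if $x'\neq x$ and $x'\,\#\,m$ then $\mathsf{Lm}\,x\,m=\mathsf{Lm}\,x'(m[x'\wedge x])$. Permutation: PmVr: $(\mathsf{Vr}\,x)[\sigma]=\mathsf{Vr}(\sigma\,x)$. PmAp: $(\mathsf{Ap}\,m_1\,m_2)[\sigma]=\mathsf{Ap}(m_1[\sigma])(m_2[\sigma])$.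 PmLm: $(\mathsf{Lm}\,x\,m)[\sigma]=\mathsf{Lm}(\sigma\,x)(m[\sigma])$. PmId: $m[\mathsf{id}]=m$. PmCp: $m[\sigma][\tau]=m[\tau\circ\sigma]$. PmFv: if $\mathsf{supp}\,\sigma\cap\mathsf{FV}\,m=\emptyset$ then $m[\sigma]=m$. Substitution: SbVr: $(\mathsf{Vr}\,x)[n/z]=$ (if $x=z$ then $n$ else $\mathsf{Vr}\,x$). SbAp: $(\mathsf{Ap}\,m_1\,m_2)[n/z]=\mathsf{Ap}(m_1[n/z])(m_2[n/z])$. SbLm: if $x\neq z$ and $x\,\#\,n$ then $(\mathsf{Lm}\,x\,m)[n/z]=\mathsf{Lm}\,x(m[n/z])$. SbBvr: if $x'\neq x$ and $x'\,\#\,m$ then $\mathsf{Lm}\,x\,m=\mathsf{Lm}\,x'(m[(\mathsf{Vr}\,x')/x])$. Renaming: RnVr: $(\mathsf{Vr}\,x)[y/z]=\mathsf{Vr}(x[y/z])$. RnAp: $(\mathsf{Ap}\,m_1\,m_2)[y/z]=\mathsf{Ap}(m_1[y/z])(m_2[y/z])$. RnLm$_1$: if $x\notin\{y,z\}$ then $(\mathsf{Lm}\,x\,m)[y/z]=\mathsf{Lm}\,x(m[y/z])$. RnLm$_2$: $(\mathsf{Lm}\,x\,m)[z/x]=\mathsf{Lm}\,x\,m$. RnBvr: if $x'\neq x$ and $x'\,\#\,m$ then $\mathsf{Lm}\,x\,m=\mathsf{Lm}\,x'(m[x'/x])$. RnBvr$_2$: if $y\neq x'$ then $\mathsf{Lm}\,x(m[y/x'])=\mathsf{Lm}\,x'(m[y/x'][x'/x])$.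 RnId: $m[z/z]=m$. RnIm: if $x_1\neq y$ then $m[x_1/y][x_2/y]=m[x_1/y]$. RnCh: if $y\neq x_2$ then $m[y/x_2][x_2/x_1][x_3/x_2]=m[y/x_2][x_3/x_1]$. RnCm: if $x_2\neq y_1\neq x_1\neq y_2$ then $m[x_2/x_1][y_2/y_1]=m[y_2/y_1][x_2/x_1]$. Freshness/freeness: FrVr: if $z\neq x$ then $z\,\#\,\mathsf{Vr}\,x$. FrAp: if $z\,\#\,m_1$ and $z\,\#\,m_2$ then $z\,\#\,\mathsf{Ap}\,m_1\,m_2$. FrLm: if $z=x$ or $z\,\#\,m$ then $z\,\#\,\mathsf{Lm}\,x\,m$. FvVr: $\mathsf{FV}(\mathsf{Vr}\,x)\subseteq\{x\}$. FvAp: $\mathsf{FV}(\mathsf{Ap}\,m_1\,m_2)\subseteq\mathsf{FV}\,m_1\cup\mathsf{FV}\,m_2$. FvLm: $\mathsf{FV}(\mathsf{Lm}\,x\,m)\subseteq\mathsf{FV}\,m\setminus\{x\}$. FvDPm: $\mathsf{FV}\,m=\{x\mid\{y\mid m[x\leftrightarrow y]\neq m\}\text{ is infinite}\}$. FvDSw: $\mathsf{FV}\,m=\{x\mid\{y\mid m[x\wedge y]\neq m\}\text{ is infinite}\}$. FCB: there exists $x\in\mathsf{Var}$ such that $x\notin\mathsf{FV}(\mathsf{Lm}\,x\,m)$ for all $m\in M$. A $(\Sigma,\mathsf{Props})$-model is a $\Sigma$-model satisfying all properties in $\mathsf{Props}$. **The sets $\mathsf{Props}_i$.** $\mathsf{Props}_1$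 (perm/free): PmVr, PmAp, PmLm, PmId, PmCp, FvDPm, FCB. $\mathsf{Props}_2$ (perm/free variant): PmVr, PmAp, PmLm, PmId, PmCp, PmFv, FvVr, FvAp, FvLm. $\mathsf{Props}_3$ (swap/free variant): SwVr, SwAp, SwLm, SwId, SwIv, SwCp, FvDSw, FCB. $\mathsf{Props}_4$ (swap/free): SwVr, SwAp, SwLm, SwFv, FvVr, FvAp, FvLm. $\mathsf{Props}_5$ (swap/fresh variant): SwVr, SwAp, SwLm, SwBvr, FrVr, FrAp, FrLm. $\mathsf{Props}_6$ (swap/fresh): SwVr, SwAp, SwLm, SwCg, FrVr, FrAp, FrLm. $\mathsf{Props}_7$ (subst/fresh): SbVr, SbAp, SbLm, SbBvr, FrVr, FrAp, FrLm. $\mathsf{Props}_8$ (renaming): RnVr, RnAp, RnLm$_1$, RnLm$_2$, RnBvr$_2$, RnId, RnIm, RnCh, RnCm. $\mathsf{Props}_9$ (renaming/fresh variant): RnVr, RnAp, RnLm$_1$, RnBvr, FrVr, FrAp, FrLm. **The epi-recursors.** For $i\in\{1,\ldots,9\}$, $r_i=(\underline{\mathcal B},T,\underline{\mathcal C}_i,I_i,R_i)$, where $\Sigma_i$ consists of all symbols occurring in $\mathsf{Props}_i$, $\underline{\mathcal B}$ is the category of $\Sigma_{\mathsf{ctor}}$-models, $T=\mathcal{T}r(\Sigma_{\mathsf{ctor}})$, $\underline{\mathcal C}_i$ is the category of $(\Sigma_i,\mathsf{Props}_i)$-models and $\Sigma_i$-model morphisms, $I_i=\mathcal{T}r(\Sigma_i)$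 (which is initial in $\underline{\mathcal C}_i$), and $R_i:\underline{\mathcal C}_i\to\underline{\mathcal B}$ is the forgetful functor to underlying $\Sigma_{\mathsf{ctor}}$-models. -}

module Defs where

open import Axiom.ExcludedMiddle using (ExcludedMiddle)
open import Data.Bool using (Bool; true; false; T; not; if_then_else_)
open import Data.Bool.ListAction using (any)
open import Data.Bool.Properties using (T-∨)
open import Data.Empty using (⊥-elim)
open import Data.List using (List; []; _∷_; _++_; map; concatMap; filter)
open import Data.List.Extrema.Nat using (max; xs≤max)
open import Data.List.Membership.Propositional using (_∈_; _∉_; lose)
open import Data.List.Membership.Propositional.Properties
  using (∈-++⁺ˡ; ∈-++⁺ʳ; ∈-++⁻; ∈-map⁺; ∈-map⁻; ∈-filter⁺; ∈-filter⁻; ∈-concatMap⁺)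
import Data.List.Relation.Unary.All as All
open import Data.List.Relation.Unary.Any using (here; there)
import Data.List.Relation.Unary.Any as Any
open import Data.Nat using (ℕ; zero; suc; _+_; _≤_; s≤s; z≤n; _≡ᵇ_)
import Data.Nat.Properties as ℕₚ
open import Data.Product using (Σ-syntax; ∃-syntax; _×_; _,_; proj₁; proj₂)
open import Data.Sum using (_⊎_; inj₁; inj₂)
open import Data.Unit using (tt)
open import Data.Unit.Polymorphic using (⊤)
open import Function using (_∘_; id; case_of_; _↔_; Inverse; Func; Equivalence)
import Function.Construct.Composition as Compose
import Function.Construct.Identity as Identity
open import Function.Bundles using (mk↔ₛ′)
open import Function.Properties.Inverse using (↔⇒↣)
open import Level using (Level; 0ℓ; _⊔_) renaming (suc to lsuc)
open import Relation.Binary using (Setoid; IsEquivalence; DecidableEquality)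
open import Relation.Binary.PropositionalEquality
  using (_≡_; _≢_; refl; sym; trans; cong; cong₂; subst; subst₂; _≗_)
import Relation.Binary.Reasoning.Setoid as SetoidReasoning
open import Relation.Nullary using (¬_; Dec; yes; no; does; contradiction; ¬?)
open import Relation.Nullary.Decidable using (via-injection; decidable-stable)
import Relation.Unary as Pred
open import Relation.Unary using (Pred; ｛_｝; _≐_)

record Category (o ℓ e : Level) : Set (lsuc (o ⊔ ℓ ⊔ e)) where
  infix  4 _≈_
  infixr 9 _∙_
  field
    Obj       : Set o
    Hom       : Obj → Obj → Set ℓ
    _≈_       : ∀ {A B} → Hom A B → Hom A B → Set e
    idn       : ∀ {A} → Hom A A
    _∙_       : ∀ {A B C} → Hom B C → Hom A B → Hom A C
    equiv     : ∀ {A B} → IsEquivalence (_≈_ {A} {B})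
    ∙-cong    : ∀ {A B C} {f f′ : Hom B C} {g g′ : Hom A B} →
                f ≈ f′ → g ≈ g′ → f ∙ g ≈ f′ ∙ g′
    identityˡ : ∀ {A B} {f : Hom A B} → idn ∙ f ≈ f
    identityʳ : ∀ {A B} {f : Hom A B} → f ∙ idn ≈ f
    assoc     : ∀ {A B C D} {f : Hom C D} {g : Hom B C} {h : Hom A B} →
                (f ∙ g) ∙ h ≈ f ∙ (g ∙ h)

record Functor {o ℓ e o′ ℓ′ e′ : Level} (C : Category o ℓ e) (D : Category o′ ℓ′ e′)
  : Set (o ⊔ ℓ ⊔ e ⊔ o′ ⊔ ℓ′ ⊔ e′) where
  private
    module C = Category C
    module D = Category D
  field
    F₀     : C.Obj → D.Obj
    F₁     : ∀ {A B} → C.Hom A B → D.Hom (F₀ A) (F₀ B)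
    F-cong : ∀ {A B} {f g : C.Hom A B} → f C.≈ g → F₁ f D.≈ F₁ g
    F-idn  : ∀ {A} → F₁ (C.idn {A}) D.≈ D.idn
    F-∙    : ∀ {A B E} {f : C.Hom B E} {g : C.Hom A B} → F₁ (f C.∙ g) D.≈ F₁ f D.∙ F₁ g

record IsInitial {o ℓ e : Level} (C : Category o ℓ e) (I : Category.Obj C) : Set (o ⊔ ℓ ⊔ e) where
  open Category C
  field
    !        : ∀ A → Hom I A
    !-unique : ∀ {A} (f : Hom I A) → f ≈ ! A

record EpiRecursor {o ℓ e : Level} (B : Category o ℓ e) (T : Category.Obj B)
  (o′ ℓ′ e′ : Level) : Set (o ⊔ ℓ ⊔ e ⊔ lsuc (o′ ⊔ ℓ′ ⊔ e′)) where
  field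
    C         : Category o′ ℓ′ e′
    I         : Category.Obj C
    I-initial : IsInitial C I
    R         : Functor C B
    R-I       : Functor.F₀ R I ≡ T

  open Category C public using () renaming (Obj to Extended)
  open IsInitial I-initial public
  open Functor R public

module _ {o ℓ e : Level} {B : Category o ℓ e} {T : Category.Obj B} where
  open Category B

  -- The equations R I ≡ T and R C ≡ X between objects are used to read
  -- R !, which lives in Hom (R I) (R C), as a morphism T → X.
  Definable : ∀ {o′ ℓ′ e′} → EpiRecursor B T o′ ℓ′ e′ → ∀ {X} → Hom T X → Set (o ⊔ e ⊔ o′)
  Definable r {X} g =
    Σ[ C ∈ r.Extended ] Σ[ RC≡X ∈ r.F₀ C ≡ X ] g ≈ subst₂ Hom r.R-I RC≡X (r.F₁ (r.! C))
    where module r = EpiRecursor r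

  infix 4 _≥_ _≡ᵣ_

  _≥_ : ∀ {o₁ ℓ₁ e₁ o₂ ℓ₂ e₂} → EpiRecursor B T o₁ ℓ₁ e₁ → EpiRecursor B T o₂ ℓ₂ e₂ →
        Set (o ⊔ ℓ ⊔ e ⊔ o₁ ⊔ o₂)
  r′ ≥ r = ∀ {X} (g : Hom T X) → Definable r g → Definable r′ g

  _≡ᵣ_ : ∀ {o₁ ℓ₁ e₁ o₂ ℓ₂ e₂} → EpiRecursor B T o₁ ℓ₁ e₁ → EpiRecursor B T o₂ ℓ₂ e₂ →
         Set (o ⊔ ℓ ⊔ e ⊔ o₁ ⊔ o₂)
  r ≡ᵣ r′ = (r ≥ r′) × (r′ ≥ r)

Finite : ∀ {a p} {A : Set a} → Pred A p → Set (a ⊔ p)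
Finite {A = A} P = Σ[ xs ∈ List A ] (∀ {x} → P x → x ∈ xs)

Infinite : ∀ {a p} {A : Set a} → Pred A p → Set (a ⊔ p)
Infinite P = ¬ Finite P

data Symbol : Set where
  vr ap lm pm sw sb ren fv fr : Symbol

code : Symbol → ℕ
code vr  = 0
code ap  = 1
code lm  = 2
code pm  = 3
code sw  = 4
code sb  = 5
code ren = 6
code fv  = 7
code fr  = 8

Signature : Set
Signature = Symbol → Bool

⟨_⟩ : List Symbol → Signature
⟨ ss ⟩ s = any (λ s′ → code s ≡ᵇ code s′) ss

infix 4 _⊑_

_⊑_ : Signature → Signature → Set
Σ₁ ⊑ Σ₂ = ∀ s → T (Σ₁ s) → T (Σ₂ s)

Σctor : Signature
Σctor = ⟨ vr ∷ ap ∷ lm ∷ [] ⟩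

-- `When (Σ s) X` is the type of a component X that a Σ-model has exactly
-- when s belongs to Σ.
When : ∀ {a} → Bool → Set a → Set a
When true  X = X
When false X = ⊤

module _ {a : Level} {X : Set a} where

  present : ∀ b → T b → When b X → X
  present true _ x = x

  given : ∀ b → X → When b X
  given true  x = x
  given false x = _

  restrict : ∀ b b′ → (T b → T b′) → When b′ X → When b X
  restrict true  true  _    x = x
  restrict true  false b⇒b′ _ = ⊥-elim (b⇒b′ tt)
  restrict false _     _    _ = _

When₂ : ∀ {a b r} {X : Set a} {Y : Set b} (c : Bool) → (X → Y → Set r) → When c X → When c Y → Set r
When₂ true  R x y = R x y
When₂ false R _ _ = ⊤

data Property : Set where
  SwVr SwAp SwLm SwId SwIv SwCp SwFv SwCg SwBvr                    : Property
  PmVr PmAp PmLm PmId PmCp PmFv                                    : Property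
  SbVr SbAp SbLm SbBvr                                             : Property
  RnVr RnAp RnLm₁ RnLm₂ RnBvr RnBvr₂ RnId RnIm RnCh RnCm           : Property
  FrVr FrAp FrLm FvVr FvAp FvLm FvDPm FvDSw FCB                    : Property

symbols : Property → List Symbol
symbols SwVr   = vr ∷ sw ∷ []
symbols SwAp   = ap ∷ sw ∷ []
symbols SwLm   = lm ∷ sw ∷ []
symbols SwId   = sw ∷ []
symbols SwIv   = sw ∷ []
symbols SwCp   = sw ∷ []
symbols SwFv   = sw ∷ fv ∷ []
symbols SwCg   = lm ∷ sw ∷ fr ∷ []
symbols SwBvr  = lm ∷ sw ∷ fr ∷ []
symbols PmVr   = vr ∷ pm ∷ []
symbols PmAp   = ap ∷ pm ∷ []
symbols PmLm   = lm ∷ pm ∷ []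
symbols PmId   = pm ∷ []
symbols PmCp   = pm ∷ []
symbols PmFv   = pm ∷ fv ∷ []
symbols SbVr   = vr ∷ sb ∷ []
symbols SbAp   = ap ∷ sb ∷ []
symbols SbLm   = lm ∷ sb ∷ fr ∷ []
symbols SbBvr  = vr ∷ lm ∷ sb ∷ fr ∷ []
symbols RnVr   = vr ∷ ren ∷ []
symbols RnAp   = ap ∷ ren ∷ []
symbols RnLm₁  = lm ∷ ren ∷ []
symbols RnLm₂  = lm ∷ ren ∷ []
symbols RnBvr  = lm ∷ ren ∷ fr ∷ []
symbols RnBvr₂ = lm ∷ ren ∷ []
symbols RnId   = ren ∷ []
symbols RnIm   = ren ∷ []
symbols RnCh   = ren ∷ []
symbols RnCm   = ren ∷ []
symbols FrVr   = vr ∷ fr ∷ []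
symbols FrAp   = ap ∷ fr ∷ []
symbols FrLm   = lm ∷ fr ∷ []
symbols FvVr   = vr ∷ fv ∷ []
symbols FvAp   = ap ∷ fv ∷ []
symbols FvLm   = lm ∷ fv ∷ []
symbols FvDPm  = pm ∷ fv ∷ []
symbols FvDSw  = sw ∷ fv ∷ []
symbols FCB    = lm ∷ fv ∷ []

signature : List Property → Signature
signature Ps s = any (λ P → ⟨ symbols P ⟩ s) Ps

Props₁ Props₂ Props₃ Props₄ Props₅ Props₆ Props₇ Props₈ Props₉ : List Property
Props₁ = PmVr ∷ PmAp ∷ PmLm ∷ PmId ∷ PmCp ∷ FvDPm ∷ FCB ∷ []
Props₂ = PmVr ∷ PmAp ∷ PmLm ∷ PmId ∷ PmCp ∷ PmFv ∷ FvVr ∷ FvAp ∷ FvLm ∷ []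
Props₃ = SwVr ∷ SwAp ∷ SwLm ∷ SwId ∷ SwIv ∷ SwCp ∷ FvDSw ∷ FCB ∷ []
Props₄ = SwVr ∷ SwAp ∷ SwLm ∷ SwFv ∷ FvVr ∷ FvAp ∷ FvLm ∷ []
Props₅ = SwVr ∷ SwAp ∷ SwLm ∷ SwBvr ∷ FrVr ∷ FrAp ∷ FrLm ∷ []
Props₆ = SwVr ∷ SwAp ∷ SwLm ∷ SwCg ∷ FrVr ∷ FrAp ∷ FrLm ∷ []
Props₇ = SbVr ∷ SbAp ∷ SbLm ∷ SbBvr ∷ FrVr ∷ FrAp ∷ FrLm ∷ []
Props₈ = RnVr ∷ RnAp ∷ RnLm₁ ∷ RnLm₂ ∷ RnBvr₂ ∷ RnId ∷ RnIm ∷ RnCh ∷ RnCm ∷ []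
Props₉ = RnVr ∷ RnAp ∷ RnLm₁ ∷ RnBvr ∷ FrVr ∷ FrAp ∷ FrLm ∷ []

signature-⊑ : ∀ {P} Ps → P ∈ Ps → ⟨ symbols P ⟩ ⊑ signature Ps
signature-⊑ (Q ∷ Ps) (here refl) s t = Equivalence.from T-∨ (inj₁ t)
signature-⊑ (Q ∷ Ps) (there P∈)  s t =
  Equivalence.from (T-∨ {⟨ symbols Q ⟩ s}) (inj₂ (signature-⊑ Ps P∈ s t))

module Nominal (Var : Set) (enum : Var ↔ ℕ) where

  infix 4 _≟_

  opaque
    _≟_ : DecidableEquality Var
    _≟_ = via-injection (↔⇒↣ enum) ℕₚ._≟_

  opaque
    fresh : List Var → Var
    fresh xs = Inverse.from enum (suc (max 0 (map (Inverse.to enum) xs)))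

    fresh-∉ : ∀ xs → fresh xs ∉ xs
    fresh-∉ xs fresh∈ = ℕₚ.<-irrefl refl
      (subst (_≤ max 0 (map to xs)) (Inverse.strictlyInverseˡ enum _)
        (All.lookup (xs≤max 0 (map to xs)) (∈-map⁺ to fresh∈)))
      where open Inverse enum using (to)

  record Perm : Set where
    field
      bijection : Var ↔ Var
    open Inverse bijection public using (to; from; strictlyInverseˡ; strictlyInverseʳ)
    supp : Pred Var 0ℓ
    supp x = to x ≢ x
    field
      finite : Finite supp

  open Perm public using (supp)

  infixr 8 _·_
  _·_ : Perm → Var → Var
  σ · x = Perm.to σ x

  swap : Var → Var → Var → Var
  swap a b x = if does (x ≟ a) then b else if does (x ≟ b) then a else x

  swap-l : ∀ a b → swap a b a ≡ b
  swap-l a b with a ≟ a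
  ... | yes _ = refl
  ... | no ¬p = contradiction refl ¬p

  swap-r : ∀ a b → swap a b b ≡ a
  swap-r a b with b ≟ a
  ... | yes p = p
  ... | no _ with b ≟ b
  ...   | yes _ = refl
  ...   | no ¬p = contradiction refl ¬p

  swap-o : ∀ {a b x} → x ≢ a → x ≢ b → swap a b x ≡ x
  swap-o {a} {b} {x} x≢a x≢b with x ≟ a
  ... | yes p = contradiction p x≢a
  ... | no _ with x ≟ b
  ...   | yes p = contradiction p x≢b
  ...   | no _ = refl

  swap-invol : ∀ a b x → swap a b (swap a b x) ≡ x
  swap-invol a b x with x ≟ a
  ... | yes refl = swap-r a b
  ... | no x≢a with x ≟ b
  ...   | yes refl = swap-l a b
  ...   | no x≢b = swap-o x≢a x≢b

  idₚ : Perm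
  idₚ = record { bijection = Identity.↔-id Var ; finite = [] , λ x≢x → contradiction refl x≢x }

  infix 10 _↔ₚ_
  _↔ₚ_ : Var → Var → Perm
  x ↔ₚ y = record
    { bijection = mk↔ₛ′ (swap x y) (swap x y) (swap-invol x y) (swap-invol x y)
    ; finite    = x ∷ y ∷ [] , supp⊆
    }
    where
    supp⊆ : ∀ {z} → swap x y z ≢ z → z ∈ x ∷ y ∷ []
    supp⊆ {z} moved with z ≟ x
    ... | yes z≡x = here z≡x
    ... | no _ with z ≟ y
    ...   | yes z≡y = there (here z≡y)
    ...   | no _ = contradiction refl moved

  infixr 9 _∘ₚ_
  _∘ₚ_ : Perm → Perm → Perm
  τ ∘ₚ σ = record
    { bijection = Compose.inverse (Perm.bijection σ) (Perm.bijection τ)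
    ; finite    = proj₁ (Perm.finite σ) ++ proj₁ (Perm.finite τ) , supp⊆
    }
    where
    supp⊆ : ∀ {x} → τ · σ · x ≢ x → x ∈ proj₁ (Perm.finite σ) ++ proj₁ (Perm.finite τ)
    supp⊆ {x} moved with σ · x ≟ x
    ... | no σx≢x = ∈-++⁺ˡ (proj₂ (Perm.finite σ) σx≢x)
    ... | yes σx≡x = ∈-++⁺ʳ (proj₁ (Perm.finite σ))
            (proj₂ (Perm.finite τ) (λ τx≡x → moved (trans (cong (τ ·_) σx≡x) τx≡x)))

  infix 4 _≈ₚ_
  _≈ₚ_ : Perm → Perm → Set
  σ ≈ₚ τ = ∀ x → σ · x ≡ τ · x

  renameVar : Var → Var → Var → Var
  renameVar x y z = if does (x ≟ z) then y else x

  data Preterm : Set where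
    PVr : Var → Preterm
    PAp : Preterm → Preterm → Preterm
    PLm : Var → Preterm → Preterm

  mapVars : (Var → Var) → Preterm → Preterm
  mapVars f (PVr x)   = PVr (f x)
  mapVars f (PAp p q) = PAp (mapVars f p) (mapVars f q)
  mapVars f (PLm x p) = PLm (f x) (mapVars f p)

  infix 4 _≈α_

  data _≈α_ : Preterm → Preterm → Set where
    ≈vr : ∀ {x} → PVr x ≈α PVr x
    ≈ap : ∀ {p p′ q q′} → p ≈α p′ → q ≈α q′ → PAp p q ≈α PAp p′ q′
    -- The bodies agree once the bound variables are swapped with z, for
    -- all but finitely many z.
    ≈lm : ∀ {x y p q} (L : List Var) →
          (∀ z → z ∉ L → mapVars (swap z x) p ≈α mapVars (swap z y) q) →
          PLm x p ≈α PLm y q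

  freeVars : Preterm → List Var
  freeVars (PVr x)   = x ∷ []
  freeVars (PAp p q) = freeVars p ++ freeVars q
  freeVars (PLm x p) = filter (λ y → ¬? (y ≟ x)) (freeVars p)

  infix 8 _[_↦_]
  _[_↦_] : (Var → Preterm) → Var → Preterm → Var → Preterm
  (ρ [ x ↦ s ]) y = if does (y ≟ x) then s else ρ y

  freshFor : (Var → Preterm) → Preterm → Var
  freshFor ρ p = fresh (concatMap (freeVars ∘ ρ) (freeVars p))

  -- Capture-avoiding simultaneous substitution.  Renaming every bound
  -- variable to one that is fresh for the substituted free variables
  -- keeps the recursion structural.
  substitute : (Var → Preterm) → Preterm → Preterm
  substitute ρ (PVr x)   = ρ x
  substitute ρ (PAp p q) = PAp (substitute ρ p) (substitute ρ q)
  substitute ρ (PLm x p) = PLm z (substitute (ρ [ x ↦ PVr z ]) p)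
    where z = freshFor ρ (PLm x p)

  infixl 8 _⟦_/_⟧
  _⟦_/_⟧ : Preterm → Preterm → Var → Preterm
  p ⟦ s / x ⟧ = substitute (PVr [ x ↦ s ]) p

  infix 4 _∈?_
  _∈?_ : (x : Var) (xs : List Var) → Dec (x ∈ xs)
  x ∈? xs = Any.any? (x ≟_) xs

  -- Sets are setoids: terms are preterms up to α-equivalence, carriers of
  -- models are arbitrary setoids, and all operations and relations respect
  -- the equality of the carrier (and equality of permutations as functions).
  module _ (A : Setoid 0ℓ 0ℓ) where
    open Setoid A renaming (Carrier to M)

    record VrOp : Set₁ where
      field
        Vr : Var → M

    record ApOp : Set₁ where
      field
        Ap      : M → M → M
        Ap-cong : ∀ {m m′ n n′} → m ≈ m′ → n ≈ n′ → Ap m n ≈ Ap m′ n′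

    record LmOp : Set₁ where
      field
        Lm      : Var → M → M
        Lm-cong : ∀ {x m m′} → m ≈ m′ → Lm x m ≈ Lm x m′

    record PmOp : Set₁ where
      infixl 8 _[_]ᵖ
      field
        _[_]ᵖ   : M → Perm → M
        pm-cong : ∀ {m m′ σ σ′} → m ≈ m′ → σ ≈ₚ σ′ → m [ σ ]ᵖ ≈ m′ [ σ′ ]ᵖ

    record SwOp : Set₁ where
      infixl 8 _[_∧_]
      field
        _[_∧_]  : M → Var → Var → M
        sw-cong : ∀ {m m′ x y} → m ≈ m′ → m [ x ∧ y ] ≈ m′ [ x ∧ y ]

    record SbOp : Set₁ where
      infixl 8 _[_/_]
      field
        _[_/_]  : M → M → Var → M
        sb-cong : ∀ {m m′ n n′ x} → m ≈ m′ → n ≈ n′ → m [ n / x ] ≈ m′ [ n′ / x ]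

    record RenOp : Set₁ where
      infixl 8 _[_/_]ʳ
      field
        _[_/_]ʳ  : M → Var → Var → M
        ren-cong : ∀ {m m′ y x} → m ≈ m′ → m [ y / x ]ʳ ≈ m′ [ y / x ]ʳ

    record FvOp : Set₁ where
      field
        FV      : M → Pred Var 0ℓ
        FV-cong : ∀ {m m′} → m ≈ m′ → FV m Pred.⊆ FV m′

    record FrOp : Set₁ where
      field
        isFresh : Var → M → Bool
        fr-cong : ∀ {x m m′} → m ≈ m′ → isFresh x m ≡ isFresh x m′

      infix 4 _#_
      _#_ : Var → M → Set
      x # m = T (isFresh x m)

  Op : Symbol → Setoid 0ℓ 0ℓ → Set₁
  Op vr  = VrOp
  Op ap  = ApOp
  Op lm  = LmOp
  Op pm  = PmOp
  Op sw  = SwOp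
  Op sb  = SbOp
  Op ren = RenOp
  Op fv  = FvOp
  Op fr  = FrOp

  record Model (Σ : Signature) : Set₁ where
    field
      carrier : Setoid 0ℓ 0ℓ
      vrᵒ     : When (Σ vr)  (Op vr carrier)
      apᵒ     : When (Σ ap)  (Op ap carrier)
      lmᵒ     : When (Σ lm)  (Op lm carrier)
      pmᵒ     : When (Σ pm)  (Op pm carrier)
      swᵒ     : When (Σ sw)  (Op sw carrier)
      sbᵒ     : When (Σ sb)  (Op sb carrier)
      renᵒ    : When (Σ ren) (Op ren carrier)
      fvᵒ     : When (Σ fv)  (Op fv carrier)
      frᵒ     : When (Σ fr)  (Op fr carrier)

    op : ∀ s → When (Σ s) (Op s carrier)
    op vr  = vrᵒ
    op ap  = apᵒ
    op lm  = lmᵒ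
    op pm  = pmᵒ
    op sw  = swᵒ
    op sb  = sbᵒ
    op ren = renᵒ
    op fv  = fvᵒ
    op fr  = frᵒ

  model : ∀ {Σ} (A : Setoid 0ℓ 0ℓ) → (∀ s → When (Σ s) (Op s A)) → Model Σ
  model A o = record
    { carrier = A
    ; vrᵒ = o vr ; apᵒ = o ap ; lmᵒ = o lm ; pmᵒ = o pm ; swᵒ = o sw
    ; sbᵒ = o sb ; renᵒ = o ren ; fvᵒ = o fv ; frᵒ = o fr
    }

  reduct : ∀ {Σ Σ′} → Σ ⊑ Σ′ → Model Σ′ → Model Σ
  reduct {Σ} {Σ′} Σ⊑Σ′ M =
    model (Model.carrier M) (λ s → restrict (Σ s) (Σ′ s) (Σ⊑Σ′ s) (Model.op M s))

  -- The implicit arguments, which say that the symbol is in the signature,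
  -- are found by computation when the signature is concrete.
  module Operations {Σ : Signature} (M : Model Σ) where
    open Model M
    open Setoid carrier public using (_≈_) renaming (Carrier to Carr)

    private
      get : ∀ s → T (Σ s) → Op s carrier
      get s s∈Σ = present (Σ s) s∈Σ (op s)

    infixl 8 _[_]ᵖ _[_∧_] _[_/_] _[_/_]ʳ
    infix 4 _#_

    Vr : {_ : T (Σ vr)} → Var → Carr
    Vr {s∈Σ} = VrOp.Vr (get vr s∈Σ)

    Ap : {_ : T (Σ ap)} → Carr → Carr → Carr
    Ap {s∈Σ} = ApOp.Ap (get ap s∈Σ)

    Lm : {_ : T (Σ lm)} → Var → Carr → Carr
    Lm {s∈Σ} = LmOp.Lm (get lm s∈Σ)

    _[_]ᵖ : {_ : T (Σ pm)} → Carr → Perm → Carr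
    _[_]ᵖ {s∈Σ} = PmOp._[_]ᵖ (get pm s∈Σ)

    _[_∧_] : {_ : T (Σ sw)} → Carr → Var → Var → Carr
    _[_∧_] {s∈Σ} = SwOp._[_∧_] (get sw s∈Σ)

    _[_/_] : {_ : T (Σ sb)} → Carr → Carr → Var → Carr
    _[_/_] {s∈Σ} = SbOp._[_/_] (get sb s∈Σ)

    _[_/_]ʳ : {_ : T (Σ ren)} → Carr → Var → Var → Carr
    _[_/_]ʳ {s∈Σ} = RenOp._[_/_]ʳ (get ren s∈Σ)

    FV : {_ : T (Σ fv)} → Carr → Pred Var 0ℓ
    FV {s∈Σ} = FvOp.FV (get fv s∈Σ)

    _#_ : {_ : T (Σ fr)} → Var → Carr → Set
    _#_ {s∈Σ} = FrOp._#_ (get fr s∈Σ)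

  Holds : (P : Property) → Model ⟨ symbols P ⟩ → Set

  Holds SwVr M = ∀ x z₁ z₂ → Vr x [ z₁ ∧ z₂ ] ≈ Vr (swap z₁ z₂ x)
    where open Operations M
  Holds SwAp M = ∀ m₁ m₂ z₁ z₂ → Ap m₁ m₂ [ z₁ ∧ z₂ ] ≈ Ap (m₁ [ z₁ ∧ z₂ ]) (m₂ [ z₁ ∧ z₂ ])
    where open Operations M
  Holds SwLm M = ∀ x m z₁ z₂ → Lm x m [ z₁ ∧ z₂ ] ≈ Lm (swap z₁ z₂ x) (m [ z₁ ∧ z₂ ])
    where open Operations M
  Holds SwId M = ∀ m z → m [ z ∧ z ] ≈ m
    where open Operations M
  Holds SwIv M = ∀ m x y → m [ x ∧ y ] [ x ∧ y ] ≈ m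
    where open Operations M
  Holds SwCp M = ∀ m x y z₁ z₂ →
    m [ x ∧ y ] [ z₁ ∧ z₂ ] ≈ m [ z₁ ∧ z₂ ] [ swap z₁ z₂ x ∧ swap z₁ z₂ y ]
    where open Operations M
  Holds SwFv M = ∀ m x y → ¬ FV m x → ¬ FV m y → m [ x ∧ y ] ≈ m
    where open Operations M
  Holds SwCg M = ∀ m₁ m₂ x₁ x₂ z → z ≢ x₁ → z ≢ x₂ → z # m₁ → z # m₂ →
    m₁ [ z ∧ x₁ ] ≈ m₂ [ z ∧ x₂ ] → Lm x₁ m₁ ≈ Lm x₂ m₂
    where open Operations M
  Holds SwBvr M = ∀ m x x′ → x′ ≢ x → x′ # m → Lm x m ≈ Lm x′ (m [ x′ ∧ x ])
    where open Operations M

  Holds PmVr M = ∀ x σ → Vr x [ σ ]ᵖ ≈ Vr (σ · x)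
    where open Operations M
  Holds PmAp M = ∀ m₁ m₂ σ → Ap m₁ m₂ [ σ ]ᵖ ≈ Ap (m₁ [ σ ]ᵖ) (m₂ [ σ ]ᵖ)
    where open Operations M
  Holds PmLm M = ∀ x m σ → Lm x m [ σ ]ᵖ ≈ Lm (σ · x) (m [ σ ]ᵖ)
    where open Operations M
  Holds PmId M = ∀ m → m [ idₚ ]ᵖ ≈ m
    where open Operations M
  Holds PmCp M = ∀ m σ τ → m [ σ ]ᵖ [ τ ]ᵖ ≈ m [ τ ∘ₚ σ ]ᵖ
    where open Operations M
  Holds PmFv M = ∀ m σ → Pred.Empty (supp σ Pred.∩ FV m) → m [ σ ]ᵖ ≈ m
    where open Operations M

  Holds SbVr M = ∀ x n z → Vr x [ n / z ] ≈ (if does (x ≟ z) then n else Vr x)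
    where open Operations M
  Holds SbAp M = ∀ m₁ m₂ n z → Ap m₁ m₂ [ n / z ] ≈ Ap (m₁ [ n / z ]) (m₂ [ n / z ])
    where open Operations M
  Holds SbLm M = ∀ x m n z → x ≢ z → x # n → Lm x m [ n / z ] ≈ Lm x (m [ n / z ])
    where open Operations M
  Holds SbBvr M = ∀ m x x′ → x′ ≢ x → x′ # m → Lm x m ≈ Lm x′ (m [ Vr x′ / x ])
    where open Operations M

  Holds RnVr M = ∀ x y z → Vr x [ y / z ]ʳ ≈ Vr (renameVar x y z)
    where open Operations M
  Holds RnAp M = ∀ m₁ m₂ y z → Ap m₁ m₂ [ y / z ]ʳ ≈ Ap (m₁ [ y / z ]ʳ) (m₂ [ y / z ]ʳ)
    where open Operations M
  Holds RnLm₁ M = ∀ x m y z → x ≢ y → x ≢ z → Lm x m [ y / z ]ʳ ≈ Lm x (m [ y / z ]ʳ)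
    where open Operations M
  Holds RnLm₂ M = ∀ x m z → Lm x m [ z / x ]ʳ ≈ Lm x m
    where open Operations M
  Holds RnBvr M = ∀ m x x′ → x′ ≢ x → x′ # m → Lm x m ≈ Lm x′ (m [ x′ / x ]ʳ)
    where open Operations M
  Holds RnBvr₂ M = ∀ m x x′ y → y ≢ x′ →
    Lm x (m [ y / x′ ]ʳ) ≈ Lm x′ (m [ y / x′ ]ʳ [ x′ / x ]ʳ)
    where open Operations M
  Holds RnId M = ∀ m z → m [ z / z ]ʳ ≈ m
    where open Operations M
  Holds RnIm M = ∀ m x₁ x₂ y → x₁ ≢ y → m [ x₁ / y ]ʳ [ x₂ / y ]ʳ ≈ m [ x₁ / y ]ʳ
    where open Operations M
  Holds RnCh M = ∀ m x₁ x₂ x₃ y → y ≢ x₂ →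
    m [ y / x₂ ]ʳ [ x₂ / x₁ ]ʳ [ x₃ / x₂ ]ʳ ≈ m [ y / x₂ ]ʳ [ x₃ / x₁ ]ʳ
    where open Operations M
  Holds RnCm M = ∀ m x₁ x₂ y₁ y₂ → x₂ ≢ y₁ → y₁ ≢ x₁ → x₁ ≢ y₂ →
    m [ x₂ / x₁ ]ʳ [ y₂ / y₁ ]ʳ ≈ m [ y₂ / y₁ ]ʳ [ x₂ / x₁ ]ʳ
    where open Operations M

  Holds FrVr M = ∀ x z → z ≢ x → z # Vr x
    where open Operations M
  Holds FrAp M = ∀ m₁ m₂ z → z # m₁ → z # m₂ → z # Ap m₁ m₂
    where open Operations M
  Holds FrLm M = ∀ x m z → z ≡ x ⊎ z # m → z # Lm x m
    where open Operations M
  Holds FvVr M = ∀ x → FV (Vr x) Pred.⊆ ｛ x ｝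
    where open Operations M
  Holds FvAp M = ∀ m₁ m₂ → FV (Ap m₁ m₂) Pred.⊆ FV m₁ Pred.∪ FV m₂
    where open Operations M
  Holds FvLm M = ∀ x m → FV (Lm x m) Pred.⊆ FV m Pred.∖ ｛ x ｝
    where open Operations M
  Holds FvDPm M = ∀ m → FV m ≐ (λ x → Infinite (λ y → ¬ (m [ x ↔ₚ y ]ᵖ ≈ m)))
    where open Operations M
  Holds FvDSw M = ∀ m → FV m ≐ (λ x → Infinite (λ y → ¬ (m [ x ∧ y ] ≈ m)))
    where open Operations M
  Holds FCB M = ∃[ x ] (∀ m → ¬ FV (Lm x m) x)
    where open Operations M

  Preserves : ∀ s (A B : Setoid 0ℓ 0ℓ) → (Setoid.Carrier A → Setoid.Carrier B) →
              Op s A → Op s B → Set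
  Preserves vr A B f o o′ = ∀ x → f (Vr o x) ≈ Vr o′ x
    where
    open VrOp
    open Setoid B using (_≈_)
  Preserves ap A B f o o′ = ∀ m n → f (Ap o m n) ≈ Ap o′ (f m) (f n)
    where
    open ApOp
    open Setoid B using (_≈_)
  Preserves lm A B f o o′ = ∀ x m → f (Lm o x m) ≈ Lm o′ x (f m)
    where
    open LmOp
    open Setoid B using (_≈_)
  Preserves pm A B f o o′ = ∀ m σ → f (m O.[ σ ]ᵖ) ≈ f m O′.[ σ ]ᵖ
    where
    module O = PmOp o
    module O′ = PmOp o′
    open Setoid B using (_≈_)
  Preserves sw A B f o o′ = ∀ m x y → f (m O.[ x ∧ y ]) ≈ f m O′.[ x ∧ y ]
    where
    module O = SwOp o
    module O′ = SwOp o′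
    open Setoid B using (_≈_)
  Preserves sb A B f o o′ = ∀ m n x → f (m O.[ n / x ]) ≈ f m O′.[ f n / x ]
    where
    module O = SbOp o
    module O′ = SbOp o′
    open Setoid B using (_≈_)
  Preserves ren A B f o o′ = ∀ m y x → f (m O.[ y / x ]ʳ) ≈ f m O′.[ y / x ]ʳ
    where
    module O = RenOp o
    module O′ = RenOp o′
    open Setoid B using (_≈_)
  Preserves fv A B f o o′ = ∀ m → FV o′ (f m) Pred.⊆ FV o m
    where
    open FvOp
  Preserves fr A B f o o′ = ∀ x m → x O.# m → x O′.# f m
    where
    module O = FrOp o
    module O′ = FrOp o′

  record ModelHom {Σ : Signature} (M N : Model Σ) : Set where
    open Model
    field
      func      : Func (carrier M) (carrier N)
    open Func func public renaming (to to fun; cong to fun-cong) using ()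
    field
      preserves : ∀ s → When₂ (Σ s) (Preserves s (carrier M) (carrier N) fun) (op M s) (op N s)

  infix 4 _≈ₕ_
  _≈ₕ_ : ∀ {Σ} {M N : Model Σ} → ModelHom M N → ModelHom M N → Set
  _≈ₕ_ {M = M} {N} f g = ∀ m → ModelHom.fun f m ≈ ModelHom.fun g m
    where open Setoid (Model.carrier N)

  module _ {Σ : Signature} where
    open Model
    open ModelHom

    idₕ : {M : Model Σ} → ModelHom M M
    idₕ {M} = record
      { func      = record { to = id ; cong = id }
      ; preserves = λ s → lift s (Σ s) (op M s)
      }
      where
      A = carrier M
      pres : ∀ s (o : Op s A) → Preserves s A A id o o
      pres vr  o x     = Setoid.refl A
      pres ap  o m n   = Setoid.refl A
      pres lm  o x m   = Setoid.refl A
      pres pm  o m σ   = Setoid.refl A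
      pres sw  o m x y = Setoid.refl A
      pres sb  o m n x = Setoid.refl A
      pres ren o m y x = Setoid.refl A
      pres fv  o m     = id
      pres fr  o x m   = id
      lift : ∀ s b (o : When b (Op s A)) → When₂ b (Preserves s A A id) o o
      lift s true  o = pres s o
      lift s false o = _

    infixr 9 _∘ₕ_
    _∘ₕ_ : {M N P : Model Σ} → ModelHom N P → ModelHom M N → ModelHom M P
    _∘ₕ_ {M} {N} {P} g f = record
      { func      = record { to = fun g ∘ fun f ; cong = fun-cong g ∘ fun-cong f }
      ; preserves = λ s → lift s (Σ s) (op M s) (op N s) (op P s) (preserves f s) (preserves g s)
      }
      where
      A = carrier M
      B = carrier N
      C = carrier P
      pres : ∀ s (o : Op s A) (o′ : Op s B) (o″ : Op s C) →
             Preserves s A B (fun f) o o′ → Preserves s B C (fun g) o′ o″ →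
             Preserves s A C (fun g ∘ fun f) o o″
      pres vr  o o′ o″ φ γ x     = Setoid.trans C (fun-cong g (φ x)) (γ x)
      pres ap  o o′ o″ φ γ m n   = Setoid.trans C (fun-cong g (φ m n)) (γ _ _)
      pres lm  o o′ o″ φ γ x m   = Setoid.trans C (fun-cong g (φ x m)) (γ _ _)
      pres pm  o o′ o″ φ γ m σ   = Setoid.trans C (fun-cong g (φ m σ)) (γ _ _)
      pres sw  o o′ o″ φ γ m x y = Setoid.trans C (fun-cong g (φ m x y)) (γ _ _ _)
      pres sb  o o′ o″ φ γ m n x = Setoid.trans C (fun-cong g (φ m n x)) (γ _ _ _)
      pres ren o o′ o″ φ γ m y x = Setoid.trans C (fun-cong g (φ m y x)) (γ _ _ _)
      pres fv  o o′ o″ φ γ m     = φ m ∘ γ (fun f m)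
      pres fr  o o′ o″ φ γ x m   = γ x (fun f m) ∘ φ x m
      lift : ∀ s b (o : When b (Op s A)) (o′ : When b (Op s B)) (o″ : When b (Op s C)) →
             When₂ b (Preserves s A B (fun f)) o o′ → When₂ b (Preserves s B C (fun g)) o′ o″ →
             When₂ b (Preserves s A C (fun g ∘ fun f)) o o″
      lift s true  = pres s
      lift s false = _

    ≈ₕ-isEquivalence : {M N : Model Σ} → IsEquivalence (_≈ₕ_ {M = M} {N})
    ≈ₕ-isEquivalence {N = N} = record
      { refl  = λ m → N.refl
      ; sym   = λ f≈g m → N.sym (f≈g m)
      ; trans = λ f≈g g≈h m → N.trans (f≈g m) (g≈h m)
      }
      where module N = Setoid (carrier N)

  Models : Signature → Category (lsuc 0ℓ) 0ℓ 0ℓ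
  Models Σ = record
    { Obj       = Model Σ
    ; Hom       = ModelHom
    ; _≈_       = _≈ₕ_
    ; idn       = idₕ
    ; _∙_       = _∘ₕ_
    ; equiv     = ≈ₕ-isEquivalence
    ; ∙-cong    = λ {_} {_} {P} {f} f≈f′ g≈g′ m →
                    Setoid.trans (Model.carrier P) (ModelHom.fun-cong f (g≈g′ m)) (f≈f′ _)
    ; identityˡ = λ {_} {N} m → Setoid.refl (Model.carrier N)
    ; identityʳ = λ {_} {N} m → Setoid.refl (Model.carrier N)
    ; assoc     = λ {_} {_} {_} {Q} m → Setoid.refl (Model.carrier Q)
    }

  record PropsModel (Ps : List Property) : Set₁ where
    field
      underlying : Model (signature Ps)
      satisfies  : ∀ {P} (P∈Ps : P ∈ Ps) → Holds P (reduct (signature-⊑ Ps P∈Ps) underlying)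

  open PropsModel using (underlying)

  PropsModels : List Property → Category (lsuc 0ℓ) 0ℓ 0ℓ
  PropsModels Ps = record
    { Obj       = PropsModel Ps
    ; Hom       = λ M N → ModelHom (underlying M) (underlying N)
    ; _≈_       = _≈ₕ_
    ; idn       = idₕ
    ; _∙_       = _∘ₕ_
    ; equiv     = ≈ₕ-isEquivalence
    ; ∙-cong    = λ {_} {_} {_} {f} {f′} {g} {g′} → M.∙-cong {f = f} {f′} {g} {g′}
    ; identityˡ = λ {_} {_} {f} → M.identityˡ {f = f}
    ; identityʳ = λ {_} {_} {f} → M.identityʳ {f = f}
    ; assoc     = λ {_} {_} {_} {_} {f} {g} {h} → M.assoc {f = f} {g} {h}
    }
    where module M = Category (Models (signature Ps))

  reductₕ : ∀ {Σ Σ′} (Σ⊑Σ′ : Σ ⊑ Σ′) {M N : Model Σ′} → ModelHom M N →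
            ModelHom (reduct Σ⊑Σ′ M) (reduct Σ⊑Σ′ N)
  reductₕ {Σ} {Σ′} Σ⊑Σ′ {M} {N} f = record
    { func      = ModelHom.func f
    ; preserves = λ where
        vr  → pres vr
        ap  → pres ap
        lm  → pres lm
        pm  → pres pm
        sw  → pres sw
        sb  → pres sb
        ren → pres ren
        fv  → pres fv
        fr  → pres fr
    }
    where
    open Model
    lift : ∀ {X Y : Set₁} (R : X → Y → Set) b b′ (b⇒b′ : T b → T b′) x y → When₂ b′ R x y →
           When₂ b R (restrict b b′ b⇒b′ x) (restrict b b′ b⇒b′ y)
    lift R true  true  b⇒b′ x y r = r
    lift R true  false b⇒b′ x y r = ⊥-elim (b⇒b′ tt)
    lift R false b′    b⇒b′ x y r = _
    pres : ∀ s → When₂ (Σ s) (Preserves s (carrier M) (carrier N) (ModelHom.fun f))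
                   (restrict (Σ s) (Σ′ s) (Σ⊑Σ′ s) (op M s)) (restrict (Σ s) (Σ′ s) (Σ⊑Σ′ s) (op N s))
    pres s = lift _ (Σ s) (Σ′ s) (Σ⊑Σ′ s) (op M s) (op N s) (ModelHom.preserves f s)

  forget : ∀ Ps → Σctor ⊑ signature Ps → Functor (PropsModels Ps) (Models Σctor)
  forget Ps Σctor⊑ = record
    { F₀     = λ M → reduct Σctor⊑ (underlying M)
    ; F₁     = reductₕ Σctor⊑
    ; F-cong = λ f≈g → f≈g
    ; F-idn  = λ {M} m → Setoid.refl (Model.carrier (underlying M))
    ; F-∙    = λ {_} {_} {P} m → Setoid.refl (Model.carrier (underlying P))
    }
  ∈-concat : ∀ {A : Set} (f : A → List Var) {xs x y} → x ∈ xs → y ∈ f x → y ∈ concatMap f xs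
  ∈-concat f x∈ y∈ = ∈-concatMap⁺ f (lose x∈ y∈)

  ·-injective : ∀ σ {x y} → σ · x ≡ σ · y → x ≡ y
  ·-injective σ {x} {y} eq =
    trans (sym (Perm.strictlyInverseʳ σ x)) (trans (cong (Perm.from σ) eq) (Perm.strictlyInverseʳ σ y))

  mapVars-∘ : ∀ f g p → mapVars f (mapVars g p) ≡ mapVars (f ∘ g) p
  mapVars-∘ f g (PVr x)   = refl
  mapVars-∘ f g (PAp p q) = cong₂ PAp (mapVars-∘ f g p) (mapVars-∘ f g q)
  mapVars-∘ f g (PLm x p) = cong (PLm _) (mapVars-∘ f g p)

  mapVars-≗ : ∀ {f g} → f ≗ g → ∀ p → mapVars f p ≡ mapVars g p
  mapVars-≗ f≗g (PVr x)   = cong PVr (f≗g x)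
  mapVars-≗ f≗g (PAp p q) = cong₂ PAp (mapVars-≗ f≗g p) (mapVars-≗ f≗g q)
  mapVars-≗ f≗g (PLm x p) = cong₂ PLm (f≗g x) (mapVars-≗ f≗g p)

  mapVars-id : ∀ p → mapVars id p ≡ p
  mapVars-id (PVr x)   = refl
  mapVars-id (PAp p q) = cong₂ PAp (mapVars-id p) (mapVars-id q)
  mapVars-id (PLm x p) = cong (PLm x) (mapVars-id p)

  swap-equivariant : ∀ σ a b x → swap (σ · a) (σ · b) (σ · x) ≡ σ · swap a b x
  swap-equivariant σ a b x with x ≟ a
  ... | yes refl = swap-l (σ · a) (σ · b)
  ... | no x≢a with x ≟ b
  ...   | yes refl = swap-r (σ · a) (σ · b)
  ...   | no x≢b = swap-o (x≢a ∘ ·-injective σ) (x≢b ∘ ·-injective σ)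

  mapVars-swap : ∀ σ a b p →
    mapVars (swap (σ · a) (σ · b)) (mapVars (σ ·_) p) ≡ mapVars (σ ·_) (mapVars (swap a b) p)
  mapVars-swap σ a b p = trans (mapVars-∘ _ _ p)
    (trans (mapVars-≗ (swap-equivariant σ a b) p) (sym (mapVars-∘ _ _ p)))

  ≈α-map : ∀ σ {p q} → p ≈α q → mapVars (σ ·_) p ≈α mapVars (σ ·_) q
  ≈α-map σ ≈vr = ≈vr
  ≈α-map σ (≈ap p≈ q≈) = ≈ap (≈α-map σ p≈) (≈α-map σ q≈)
  ≈α-map σ (≈lm {x} {y} {p} {q} L h) = ≈lm (map (σ ·_) L) λ z z∉ →
    let z₀ = Perm.from σ z
        σz₀≡z = Perm.strictlyInverseˡ σ z
        z₀∉ : z₀ ∉ L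
        z₀∉ z₀∈ = z∉ (subst (_∈ map (σ ·_) L) σz₀≡z (∈-map⁺ (σ ·_) z₀∈))
    in subst (λ z → mapVars (swap z (σ · x)) (mapVars (σ ·_) p) ≈α
                    mapVars (swap z (σ · y)) (mapVars (σ ·_) q)) σz₀≡z
         (subst₂ _≈α_ (sym (mapVars-swap σ z₀ x p)) (sym (mapVars-swap σ z₀ y q))
           (≈α-map σ (h z₀ z₀∉)))

  ∈-PLm⁺ : ∀ x p {y} → y ∈ freeVars p → y ≢ x → y ∈ freeVars (PLm x p)
  ∈-PLm⁺ x p y∈ y≢x = ∈-filter⁺ (λ y → ¬? (y ≟ x)) y∈ y≢x

  ∈-PLm⁻ : ∀ x p {y} → y ∈ freeVars (PLm x p) → y ∈ freeVars p × y ≢ x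
  ∈-PLm⁻ x p y∈ = ∈-filter⁻ (λ y → ¬? (y ≟ x)) y∈

  freeVars-map⁺ : ∀ σ p {x} → x ∈ freeVars p → σ · x ∈ freeVars (mapVars (σ ·_) p)
  freeVars-map⁺ σ (PVr y) (here refl) = here refl
  freeVars-map⁺ σ (PAp p q) x∈ with ∈-++⁻ (freeVars p) x∈
  ... | inj₁ x∈p = ∈-++⁺ˡ (freeVars-map⁺ σ p x∈p)
  ... | inj₂ x∈q = ∈-++⁺ʳ (freeVars (mapVars (σ ·_) p)) (freeVars-map⁺ σ q x∈q)
  freeVars-map⁺ σ (PLm y p) x∈ =
    let x∈p , x≢y = ∈-PLm⁻ y p x∈
    in ∈-PLm⁺ (σ · y) (mapVars (σ ·_) p) (freeVars-map⁺ σ p x∈p) (x≢y ∘ ·-injective σ)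

  freeVars-map⁻ : ∀ f p {x} → x ∈ freeVars (mapVars f p) → Σ[ y ∈ Var ] y ∈ freeVars p × x ≡ f y
  freeVars-map⁻ f (PVr y) (here refl) = y , here refl , refl
  freeVars-map⁻ f (PAp p q) x∈ with ∈-++⁻ (freeVars (mapVars f p)) x∈
  ... | inj₁ x∈p = let y , y∈ , eq = freeVars-map⁻ f p x∈p in y , ∈-++⁺ˡ y∈ , eq
  ... | inj₂ x∈q = let y , y∈ , eq = freeVars-map⁻ f q x∈q in y , ∈-++⁺ʳ (freeVars p) y∈ , eq
  freeVars-map⁻ f (PLm z p) x∈ =
    let x∈p , x≢ = ∈-PLm⁻ (f z) (mapVars f p) x∈
        y , y∈ , eq = freeVars-map⁻ f p x∈p
    in y , ∈-PLm⁺ z p y∈ (λ y≡z → x≢ (trans eq (cong f y≡z))) , eq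

  freeVars-≈ : ∀ {p q} → p ≈α q → ∀ {x} → x ∈ freeVars p → x ∈ freeVars q
  freeVars-≈ ≈vr x∈ = x∈
  freeVars-≈ (≈ap {p} {p′} p≈ q≈) x∈ with ∈-++⁻ (freeVars p) x∈
  ... | inj₁ x∈p = ∈-++⁺ˡ (freeVars-≈ p≈ x∈p)
  ... | inj₂ x∈q = ∈-++⁺ʳ (freeVars p′) (freeVars-≈ q≈ x∈q)
  freeVars-≈ (≈lm {x} {y} {p} {q} L h) {v} v∈ =
    let v∈p , v≢x = ∈-PLm⁻ x p v∈
        z = fresh (v ∷ freeVars q ++ L)
        z∉ = fresh-∉ (v ∷ freeVars q ++ L)
        v≢z : v ≢ z
        v≢z v≡z = z∉ (here (sym v≡z))
        v∈′ : v ∈ freeVars (mapVars (swap z x) p)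
        v∈′ = subst (_∈ freeVars (mapVars (swap z x) p)) (swap-o v≢z v≢x)
                (freeVars-map⁺ (z ↔ₚ x) p v∈p)
        u , u∈ , v≡ = freeVars-map⁻ (swap z y) q
          (freeVars-≈ (h z (λ z∈ → z∉ (there (∈-++⁺ʳ (freeVars q) z∈)))) v∈′)
        u≢z : u ≢ z
        u≢z u≡z = z∉ (there (∈-++⁺ˡ (subst (_∈ freeVars q) u≡z u∈)))
        u≢y : u ≢ y
        u≢y u≡y = v≢z (trans v≡ (trans (cong (swap z y) u≡y) (swap-r z y)))
        u≡v = sym (trans v≡ (swap-o u≢z u≢y))
    in subst (_∈ freeVars (PLm y q)) u≡v (∈-PLm⁺ y q u∈ u≢y)

  map-agree : ∀ p (σ τ : Perm) → (∀ {x} → x ∈ freeVars p → σ · x ≡ τ · x) →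
              mapVars (σ ·_) p ≈α mapVars (τ ·_) p
  map-agree (PVr x) σ τ eq = subst (λ y → PVr (σ · x) ≈α PVr y) (eq (here refl)) ≈vr
  map-agree (PAp p q) σ τ eq =
    ≈ap (map-agree p σ τ (eq ∘ ∈-++⁺ˡ)) (map-agree q σ τ (eq ∘ ∈-++⁺ʳ (freeVars p)))
  map-agree (PLm x p) σ τ eq = ≈lm (map (σ ·_) (freeVars p)) λ z z∉ →
    subst₂ _≈α_ (sym (mapVars-∘ (swap z (σ · x)) (σ ·_) p)) (sym (mapVars-∘ (swap z (τ · x)) (τ ·_) p))
      (map-agree p (z ↔ₚ (σ · x) ∘ₚ σ) (z ↔ₚ (τ · x) ∘ₚ τ) (λ {v} → agree z z∉ {v}))
    where
    agree : ∀ z → z ∉ map (σ ·_) (freeVars p) → ∀ {v} → v ∈ freeVars p →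
            swap z (σ · x) (σ · v) ≡ swap z (τ · x) (τ · v)
    agree z z∉ {v} v∈ with v ≟ x
    ... | yes refl = trans (swap-r z (σ · v)) (sym (swap-r z (τ · v)))
    ... | no v≢x =
      let σv≡τv = eq (∈-PLm⁺ x p v∈ v≢x)
          σv≢z : σ · v ≢ z
          σv≢z σv≡z = z∉ (subst (_∈ map (σ ·_) (freeVars p)) σv≡z (∈-map⁺ (σ ·_) v∈))
      in trans (swap-o σv≢z (v≢x ∘ ·-injective σ))
           (trans σv≡τv (sym (swap-o (σv≢z ∘ trans σv≡τv) (v≢x ∘ ·-injective τ))))

  α-refl : ∀ {p} → p ≈α p
  α-refl {p} = subst₂ _≈α_ (mapVars-id p) (mapVars-id p) (map-agree p idₚ idₚ (λ _ → refl))

  α-reflexive : ∀ {p q} → p ≡ q → p ≈α q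
  α-reflexive refl = α-refl

  α-sym : ∀ {p q} → p ≈α q → q ≈α p
  α-sym ≈vr          = ≈vr
  α-sym (≈ap p≈ q≈)  = ≈ap (α-sym p≈) (α-sym q≈)
  α-sym (≈lm L h)    = ≈lm L (λ z z∉ → α-sym (h z z∉))

  α-trans : ∀ {p q r} → p ≈α q → q ≈α r → p ≈α r
  α-trans ≈vr         ≈vr           = ≈vr
  α-trans (≈ap p≈ q≈) (≈ap p≈′ q≈′) = ≈ap (α-trans p≈ p≈′) (α-trans q≈ q≈′)
  α-trans (≈lm L h)   (≈lm L′ h′)   = ≈lm (L ++ L′) λ z z∉ →
    α-trans (h z (z∉ ∘ ∈-++⁺ˡ)) (h′ z (z∉ ∘ ∈-++⁺ʳ L))

  Terms : Setoid 0ℓ 0ℓ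
  Terms = record
    { Carrier       = Preterm
    ; _≈_           = _≈α_
    ; isEquivalence = record { refl = α-refl ; sym = α-sym ; trans = α-trans }
    }

  private module ≈α-Reasoning = SetoidReasoning Terms

  map-fix : ∀ p σ → (∀ {x} → x ∈ freeVars p → σ · x ≡ x) → mapVars (σ ·_) p ≈α p
  map-fix p σ fix = subst (mapVars (σ ·_) p ≈α_) (mapVars-id p) (map-agree p σ idₚ fix)

  PLm-cong : ∀ {x p q} → p ≈α q → PLm x p ≈α PLm x q
  PLm-cong {x} p≈q = ≈lm [] (λ z _ → ≈α-map (z ↔ₚ x) p≈q)

  PLm-swap : ∀ x p z → z ∉ freeVars (PLm x p) → PLm x p ≈α PLm z (mapVars (swap z x) p)
  PLm-swap x p z z∉ = ≈lm (freeVars p) λ w w∉ →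
    subst (mapVars (swap w x) p ≈α_) (sym (mapVars-∘ (swap w z) (swap z x) p))
      (map-agree p (w ↔ₚ x) (w ↔ₚ z ∘ₚ z ↔ₚ x) (λ {v} → agree w w∉ {v}))
    where
    agree : ∀ w → w ∉ freeVars p → ∀ {v} → v ∈ freeVars p → swap w x v ≡ swap w z (swap z x v)
    agree w w∉ {v} v∈ = case v ≟ x of λ where
     (yes refl) → trans (swap-r w v) (sym (trans (cong (swap w z) (swap-r z v)) (swap-r w z)))
     (no v≢x) →
      let v≢z : v ≢ z
          v≢z v≡z = z∉ (subst (_∈ freeVars (PLm x p)) v≡z (∈-PLm⁺ x p v∈ v≢x))
          v≢w : v ≢ w
          v≢w v≡w = w∉ (subst (_∈ freeVars p) v≡w v∈)
      in trans (swap-o v≢w v≢x)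
           (sym (trans (cong (swap w z) (swap-o v≢z v≢x)) (swap-o v≢w v≢z)))

  PLm-intro : ∀ {x y p q} z → z ∉ freeVars (PLm x p) → z ∉ freeVars (PLm y q) →
              mapVars (swap z x) p ≈α mapVars (swap z y) q → PLm x p ≈α PLm y q
  PLm-intro {x} {y} {p} {q} z z∉p z∉q h =
    α-trans (PLm-swap x p z z∉p) (α-trans (PLm-cong h) (α-sym (PLm-swap y q z z∉q)))

  map-fresh₂ : ∀ p x y → x ∉ freeVars p → y ∉ freeVars p → mapVars (swap x y) p ≈α p
  map-fresh₂ p x y x∉ y∉ = map-fix p (x ↔ₚ y) λ v∈ →
    swap-o (λ { refl → x∉ v∈ }) (λ { refl → y∉ v∈ })

  freeVars-PLm-≈ : ∀ {z p q x} → p ≈α q → x ∉ freeVars (PLm z q) → x ∉ freeVars (PLm z p)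
  freeVars-PLm-≈ p≈q x∉ = x∉ ∘ freeVars-≈ (PLm-cong p≈q)

  [↦]-≡ : ∀ ρ {x y s} → y ≡ x → (ρ [ x ↦ s ]) y ≡ s
  [↦]-≡ ρ {x} {y} y≡x with y ≟ x
  ... | yes _ = refl
  ... | no y≢x = contradiction y≡x y≢x

  [↦]-≢ : ∀ ρ {x y s} → y ≢ x → (ρ [ x ↦ s ]) y ≡ ρ y
  [↦]-≢ ρ {x} {y} y≢x with y ≟ x
  ... | yes y≡x = contradiction y≡x y≢x
  ... | no _ = refl

  freshFor-∉ : ∀ ρ p {v} → v ∈ freeVars p → freshFor ρ p ∉ freeVars (ρ v)
  freshFor-∉ ρ p v∈ z∈ = fresh-∉ _ (∈-concat (freeVars ∘ ρ) v∈ z∈)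

  freshFor-≢ : ∀ ρ p {v u} → v ∈ freeVars p → u ∈ freeVars (ρ v) → u ≢ freshFor ρ p
  freshFor-≢ ρ p v∈ u∈ refl = freshFor-∉ ρ p v∈ u∈

  -- Substitution commutes with permutations of its input (τ) and of its
  -- output (σ), and is determined by its values on the free variables.
  substitute-map : ∀ p (τ τ′ σ σ′ : Perm) ρ ρ′ →
    (∀ {v} → v ∈ freeVars p → mapVars (σ ·_) (ρ (τ · v)) ≈α mapVars (σ′ ·_) (ρ′ (τ′ · v))) →
    mapVars (σ ·_) (substitute ρ (mapVars (τ ·_) p)) ≈α
    mapVars (σ′ ·_) (substitute ρ′ (mapVars (τ′ ·_) p))
  substitute-map (PVr x) τ τ′ σ σ′ ρ ρ′ h = h (here refl)
  substitute-map (PAp p q) τ τ′ σ σ′ ρ ρ′ h =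
    ≈ap (substitute-map p τ τ′ σ σ′ ρ ρ′ (h ∘ ∈-++⁺ˡ))
        (substitute-map q τ τ′ σ σ′ ρ ρ′ (h ∘ ∈-++⁺ʳ (freeVars p)))
  substitute-map (PLm x p) τ τ′ σ σ′ ρ ρ′ h =
    PLm-intro w (w∉ ∘ there ∘ there ∘ ∈-++⁺ˡ)
      (w∉ ∘ there ∘ there ∘ ∈-++⁺ʳ (freeVars lhs) ∘ ∈-++⁺ˡ)
      (subst₂ _≈α_ (sym (mapVars-∘ _ (σ ·_) (substitute _ (mapVars (τ ·_) p))))
                   (sym (mapVars-∘ _ (σ′ ·_) (substitute _ (mapVars (τ′ ·_) p))))
        (substitute-map p τ τ′ (w ↔ₚ (σ · z) ∘ₚ σ) (w ↔ₚ (σ′ · z′) ∘ₚ σ′) _ _ (λ {v} → agree {v})))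
    where
    z z′ w : Var
    lhs rhs : Preterm
    out out′ L : List Var
    z    = freshFor ρ (mapVars (τ ·_) (PLm x p))
    z′   = freshFor ρ′ (mapVars (τ′ ·_) (PLm x p))
    lhs  = mapVars (σ ·_) (substitute ρ (mapVars (τ ·_) (PLm x p)))
    rhs  = mapVars (σ′ ·_) (substitute ρ′ (mapVars (τ′ ·_) (PLm x p)))
    out  = concatMap (λ v → freeVars (mapVars (σ ·_) (ρ (τ · v)))) (freeVars p)
    out′ = concatMap (λ v → freeVars (mapVars (σ′ ·_) (ρ′ (τ′ · v)))) (freeVars p)
    L    = x ∷ x ∷ freeVars lhs ++ freeVars rhs ++ out ++ out′
    w    = fresh L
    w∉ : w ∉ L
    w∉ = fresh-∉ L
    w∉out : w ∉ out
    w∉out = w∉ ∘ there ∘ there ∘ ∈-++⁺ʳ (freeVars lhs) ∘ ∈-++⁺ʳ (freeVars rhs) ∘ ∈-++⁺ˡ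
    w∉out′ : w ∉ out′
    w∉out′ = w∉ ∘ there ∘ there ∘ ∈-++⁺ʳ (freeVars lhs) ∘ ∈-++⁺ʳ (freeVars rhs) ∘ ∈-++⁺ʳ out

    bound : ∀ (τ σ : Perm) ρ → let z = freshFor ρ (mapVars (τ ·_) (PLm x p)) in
            mapVars (swap w (σ · z) ∘ (σ ·_)) ((ρ [ τ · x ↦ PVr z ]) (τ · x)) ≈α PVr w
    bound τ σ ρ rewrite [↦]-≡ ρ {τ · x} {s = PVr (freshFor ρ (mapVars (τ ·_) (PLm x p)))} refl =
      α-reflexive (cong PVr (swap-r w _))

    free : ∀ (τ σ : Perm) ρ → let z = freshFor ρ (mapVars (τ ·_) (PLm x p)) in
           w ∉ concatMap (λ v → freeVars (mapVars (σ ·_) (ρ (τ · v)))) (freeVars p) →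
           ∀ {v} → v ∈ freeVars p → v ≢ x →
           mapVars (swap w (σ · z) ∘ (σ ·_)) ((ρ [ τ · x ↦ PVr z ]) (τ · v)) ≈α
           mapVars (σ ·_) (ρ (τ · v))
    free τ σ ρ w∉o {v} v∈ v≢x
      rewrite [↦]-≢ ρ {s = PVr (freshFor ρ (mapVars (τ ·_) (PLm x p)))} (v≢x ∘ ·-injective τ) =
      map-agree (ρ (τ · v)) (w ↔ₚ (σ · zz) ∘ₚ σ) σ λ {u} u∈ →
        swap-o (λ σu≡w → w∉o (∈-concat (λ v → freeVars (mapVars (σ ·_) (ρ (τ · v)))) v∈
                  (subst (_∈ freeVars (mapVars (σ ·_) (ρ (τ · v)))) σu≡w
                    (freeVars-map⁺ σ (ρ (τ · v)) u∈))))
               (freshFor-≢ ρ (mapVars (τ ·_) (PLm x p))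
                 (freeVars-map⁺ τ (PLm x p) (∈-PLm⁺ x p v∈ v≢x)) u∈ ∘ ·-injective σ)
      where zz = freshFor ρ (mapVars (τ ·_) (PLm x p))

    agree : ∀ {v} → v ∈ freeVars p →
      mapVars (swap w (σ · z) ∘ (σ ·_)) ((ρ [ τ · x ↦ PVr z ]) (τ · v)) ≈α
      mapVars (swap w (σ′ · z′) ∘ (σ′ ·_)) ((ρ′ [ τ′ · x ↦ PVr z′ ]) (τ′ · v))
    agree {v} v∈ with v ≟ x
    ... | yes refl = α-trans (bound τ σ ρ) (α-sym (bound τ′ σ′ ρ′))
    ... | no v≢x = α-trans (free τ σ ρ w∉out v∈ v≢x)
                     (α-trans (h (∈-PLm⁺ x p v∈ v≢x)) (α-sym (free τ′ σ′ ρ′ w∉out′ v∈ v≢x)))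

  substitute-agree : ∀ p {ρ ρ′} → (∀ {v} → v ∈ freeVars p → ρ v ≈α ρ′ v) →
                     substitute ρ p ≈α substitute ρ′ p
  substitute-agree p {ρ} {ρ′} h =
    subst₂ _≈α_ (unfold ρ) (unfold ρ′)
      (substitute-map p idₚ idₚ idₚ idₚ ρ ρ′
        (λ {v} v∈ → subst₂ _≈α_ (sym (mapVars-id (ρ v))) (sym (mapVars-id (ρ′ v))) (h v∈)))
    where
    unfold : ∀ ρ → mapVars id (substitute ρ (mapVars id p)) ≡ substitute ρ p
    unfold ρ = trans (mapVars-id _) (cong (substitute ρ) (mapVars-id p))

  substitute-output : ∀ p σ ρ →
    mapVars (σ ·_) (substitute ρ p) ≈α substitute (mapVars (σ ·_) ∘ ρ) p
  substitute-output p σ ρ =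
    subst₂ _≈α_ (cong (mapVars (σ ·_) ∘ substitute ρ) (mapVars-id p))
                (trans (mapVars-id _) (cong (substitute _) (mapVars-id p)))
      (substitute-map p idₚ idₚ σ idₚ ρ (mapVars (σ ·_) ∘ ρ)
        (λ {v} _ → α-reflexive (sym (mapVars-id (mapVars (σ ·_) (ρ v))))))

  substitute-input : ∀ p τ ρ → substitute ρ (mapVars (τ ·_) p) ≈α substitute (ρ ∘ (τ ·_)) p
  substitute-input p τ ρ =
    subst₂ _≈α_ (mapVars-id _) (trans (mapVars-id _) (cong (substitute _) (mapVars-id p)))
      (substitute-map p τ idₚ idₚ idₚ ρ (ρ ∘ (τ ·_)) (λ _ → α-refl))

  freeVars-substitute⁻ : ∀ p ρ {u} → u ∈ freeVars (substitute ρ p) →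
    Σ[ v ∈ Var ] v ∈ freeVars p × u ∈ freeVars (ρ v)
  freeVars-substitute⁻ (PVr x) ρ u∈ = x , here refl , u∈
  freeVars-substitute⁻ (PAp p q) ρ u∈ with ∈-++⁻ (freeVars (substitute ρ p)) u∈
  ... | inj₁ u∈p = let v , v∈ , u∈v = freeVars-substitute⁻ p ρ u∈p in v , ∈-++⁺ˡ v∈ , u∈v
  ... | inj₂ u∈q = let v , v∈ , u∈v = freeVars-substitute⁻ q ρ u∈q
                   in v , ∈-++⁺ʳ (freeVars p) v∈ , u∈v
  freeVars-substitute⁻ (PLm x p) ρ {u} u∈
    with ∈-PLm⁻ (freshFor ρ (PLm x p)) (substitute (ρ [ x ↦ PVr (freshFor ρ (PLm x p)) ]) p) u∈
  ... | u∈p , u≢z with freeVars-substitute⁻ p _ u∈p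
  ... | v , v∈ , u∈v with v ≟ x
  ...   | yes refl with here u≡z ← u∈v = contradiction u≡z u≢z
  ...   | no v≢x = v , ∈-PLm⁺ x p v∈ v≢x , u∈v

  freeVars-substitute⁺ : ∀ p ρ {u v} → v ∈ freeVars p → u ∈ freeVars (ρ v) →
    u ∈ freeVars (substitute ρ p)
  freeVars-substitute⁺ (PVr x) ρ (here refl) u∈ = u∈
  freeVars-substitute⁺ (PAp p q) ρ v∈ u∈ with ∈-++⁻ (freeVars p) v∈
  ... | inj₁ v∈p = ∈-++⁺ˡ (freeVars-substitute⁺ p ρ v∈p u∈)
  ... | inj₂ v∈q = ∈-++⁺ʳ (freeVars (substitute ρ p)) (freeVars-substitute⁺ q ρ v∈q u∈)
  freeVars-substitute⁺ (PLm x p) ρ {u} {v} v∈ u∈ =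
    let v∈p , v≢x = ∈-PLm⁻ x p v∈
        z = freshFor ρ (PLm x p)
    in ∈-PLm⁺ z (substitute (ρ [ x ↦ PVr z ]) p) (freeVars-substitute⁺ p (ρ [ x ↦ PVr z ]) v∈p
                 (subst (λ s → u ∈ freeVars s) (sym ([↦]-≢ ρ v≢x)) u∈))
              (freshFor-≢ ρ (PLm x p) v∈ u∈)

  substitute-PLm : ∀ x p ρ w → (∀ {v} → v ∈ freeVars (PLm x p) → w ∉ freeVars (ρ v)) →
    substitute ρ (PLm x p) ≈α PLm w (substitute (ρ [ x ↦ PVr w ]) p)
  substitute-PLm x p ρ w w∉ =
    α-trans (PLm-swap z P w w∉P)
      (PLm-cong (α-trans (substitute-output p (w ↔ₚ z) (ρ [ x ↦ PVr z ]))
        (substitute-agree p agree)))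
    where
    z = freshFor ρ (PLm x p)
    P = substitute (ρ [ x ↦ PVr z ]) p
    w∉P : w ∉ freeVars (PLm z P)
    w∉P w∈ = let v , v∈ , w∈v = freeVars-substitute⁻ (PLm x p) ρ w∈ in w∉ v∈ w∈v
    agree : ∀ {v} → v ∈ freeVars p →
            mapVars (swap w z) ((ρ [ x ↦ PVr z ]) v) ≈α (ρ [ x ↦ PVr w ]) v
    agree {v} v∈ with v ≟ x
    ... | yes refl = α-reflexive (cong PVr (swap-r w z))
    ... | no v≢x = map-fresh₂ (ρ v) w z (w∉ (∈-PLm⁺ x p v∈ v≢x))
                     (freshFor-∉ ρ (PLm x p) (∈-PLm⁺ x p v∈ v≢x))

  substitute-cong : ∀ {p q} → p ≈α q → ∀ ρ → substitute ρ p ≈α substitute ρ q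
  substitute-cong ≈vr ρ = α-refl
  substitute-cong (≈ap p≈ q≈) ρ = ≈ap (substitute-cong p≈ ρ) (substitute-cong q≈ ρ)
  substitute-cong (≈lm {x} {y} {p} {q} L h) ρ =
    α-trans (canonical x p w w∉p (λ v∈ u∈ → w∉ (∈-++⁺ˡ (∈-concat (freeVars ∘ ρ) v∈ u∈))))
      (α-trans (PLm-cong (substitute-cong (h w w∉L) (ρ [ w ↦ PVr w ])))
        (α-sym (canonical y q w w∉q
          (λ v∈ u∈ → w∉ (∈-++⁺ʳ cp (∈-++⁺ˡ (∈-concat (freeVars ∘ ρ) v∈ u∈)))))))
    where
    cp = concatMap (freeVars ∘ ρ) (freeVars (PLm x p))
    cq = concatMap (freeVars ∘ ρ) (freeVars (PLm y q))
    w  = fresh (cp ++ cq ++ freeVars p ++ freeVars q ++ L)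
    w∉ = fresh-∉ (cp ++ cq ++ freeVars p ++ freeVars q ++ L)
    w∉p : w ∉ freeVars p
    w∉p = w∉ ∘ ∈-++⁺ʳ cp ∘ ∈-++⁺ʳ cq ∘ ∈-++⁺ˡ
    w∉q : w ∉ freeVars q
    w∉q = w∉ ∘ ∈-++⁺ʳ cp ∘ ∈-++⁺ʳ cq ∘ ∈-++⁺ʳ (freeVars p) ∘ ∈-++⁺ˡ
    w∉L : w ∉ L
    w∉L = w∉ ∘ ∈-++⁺ʳ cp ∘ ∈-++⁺ʳ cq ∘ ∈-++⁺ʳ (freeVars p) ∘ ∈-++⁺ʳ (freeVars q)

    canonical : ∀ x p w → w ∉ freeVars p →
      (∀ {v} → v ∈ freeVars (PLm x p) → w ∉ freeVars (ρ v)) →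
      substitute ρ (PLm x p) ≈α PLm w (substitute (ρ [ w ↦ PVr w ]) (mapVars (swap w x) p))
    canonical x p w w∉p w∉ρ = α-trans (substitute-PLm x p ρ w w∉ρ)
      (PLm-cong (α-sym (α-trans (substitute-input p (w ↔ₚ x) (ρ [ w ↦ PVr w ]))
        (substitute-agree p agree))))
      where
      agree : ∀ {v} → v ∈ freeVars p → (ρ [ w ↦ PVr w ]) (swap w x v) ≈α (ρ [ x ↦ PVr w ]) v
      agree {v} v∈ = case v ≟ x of λ where
       (yes refl) → α-reflexive (trans ([↦]-≡ ρ (swap-r w v)) (sym ([↦]-≡ ρ refl)))
       (no v≢x) →
        let v≢w : v ≢ w
            v≢w v≡w = w∉p (subst (_∈ freeVars p) v≡w v∈)
        in α-reflexive (trans (cong (ρ [ w ↦ PVr w ]) (swap-o v≢w v≢x))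
             (trans ([↦]-≢ ρ v≢w) (sym ([↦]-≢ ρ v≢x))))

  substitute-PVr : ∀ p (τ τ′ : Perm) ρ → (∀ {v} → v ∈ freeVars p → ρ (τ · v) ≡ PVr (τ′ · v)) →
                   substitute ρ (mapVars (τ ·_) p) ≈α mapVars (τ′ ·_) p
  substitute-PVr (PVr x) τ τ′ ρ h = α-reflexive (h (here refl))
  substitute-PVr (PAp p q) τ τ′ ρ h =
    ≈ap (substitute-PVr p τ τ′ ρ (h ∘ ∈-++⁺ˡ)) (substitute-PVr q τ τ′ ρ (h ∘ ∈-++⁺ʳ (freeVars p)))
  substitute-PVr (PLm x p) τ τ′ ρ h =
    α-trans (PLm-cong (substitute-PVr p τ (z ↔ₚ (τ′ · x) ∘ₚ τ′) _ (λ {v} → agree {v})))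
      (α-trans (α-reflexive (cong (PLm z) (sym (mapVars-∘ (swap z (τ′ · x)) (τ′ ·_) p))))
        (α-sym (PLm-swap (τ′ · x) (mapVars (τ′ ·_) p) z z∉)))
    where
    z = freshFor ρ (mapVars (τ ·_) (PLm x p))
    z≢ : ∀ {v} → v ∈ freeVars (PLm x p) → τ′ · v ≢ z
    z≢ {v} v∈ = freshFor-≢ ρ (mapVars (τ ·_) (PLm x p)) (freeVars-map⁺ τ (PLm x p) v∈)
      (subst (λ s → τ′ · v ∈ freeVars s) (sym (h v∈)) (here refl))
    z∉ : z ∉ freeVars (mapVars (τ′ ·_) (PLm x p))
    z∉ z∈ = let v , v∈ , z≡ = freeVars-map⁻ (τ′ ·_) (PLm x p) z∈ in z≢ v∈ (sym z≡)
    agree : ∀ {v} → v ∈ freeVars p →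
            (ρ [ τ · x ↦ PVr z ]) (τ · v) ≡ PVr (swap z (τ′ · x) (τ′ · v))
    agree {v} v∈ with v ≟ x
    ... | yes refl = trans ([↦]-≡ ρ refl) (cong PVr (sym (swap-r z (τ′ · v))))
    ... | no v≢x = trans ([↦]-≢ ρ (v≢x ∘ ·-injective τ)) (trans (h (∈-PLm⁺ x p v∈ v≢x))
                     (cong PVr (sym (swap-o (z≢ (∈-PLm⁺ x p v∈ v≢x)) (v≢x ∘ ·-injective τ′)))))

  substitute-perm : ∀ p τ ρ → (∀ {v} → v ∈ freeVars p → ρ v ≡ PVr (τ · v)) →
                    substitute ρ p ≈α mapVars (τ ·_) p
  substitute-perm p τ ρ h =
    subst (λ q → substitute ρ q ≈α mapVars (τ ·_) p) (mapVars-id p) (substitute-PVr p idₚ τ ρ h)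

  substitute-id : ∀ p ρ → (∀ {v} → v ∈ freeVars p → ρ v ≡ PVr v) → substitute ρ p ≈α p
  substitute-id p ρ h =
    subst (substitute ρ p ≈α_) (mapVars-id p) (substitute-perm p idₚ ρ h)

  substitute-∘ : ∀ p ρ θ → substitute θ (substitute ρ p) ≈α substitute (substitute θ ∘ ρ) p
  substitute-∘ (PVr x) ρ θ = α-refl
  substitute-∘ (PAp p q) ρ θ = ≈ap (substitute-∘ p ρ θ) (substitute-∘ q ρ θ)
  substitute-∘ (PLm x p) ρ θ =
    α-trans (substitute-PLm z P θ w (λ u∈ w∈ → w∉ (∈-++⁺ˡ (∈-concat (freeVars ∘ θ) u∈ w∈))))
      (α-trans (PLm-cong (α-trans (substitute-∘ p (ρ [ x ↦ PVr z ]) (θ [ z ↦ PVr w ]))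
                                  (substitute-agree p agree)))
        (α-sym (substitute-PLm x p (substitute θ ∘ ρ) w
          (λ v∈ w∈ → w∉ (∈-++⁺ʳ cθ (∈-concat (freeVars ∘ substitute θ ∘ ρ) v∈ w∈))))))
    where
    z  = freshFor ρ (PLm x p)
    P  = substitute (ρ [ x ↦ PVr z ]) p
    cθ = concatMap (freeVars ∘ θ) (freeVars (PLm z P))
    cp = concatMap (freeVars ∘ substitute θ ∘ ρ) (freeVars (PLm x p))
    w  = fresh (cθ ++ cp)
    w∉ = fresh-∉ (cθ ++ cp)
    agree : ∀ {v} → v ∈ freeVars p →
            substitute (θ [ z ↦ PVr w ]) ((ρ [ x ↦ PVr z ]) v) ≈α
            ((substitute θ ∘ ρ) [ x ↦ PVr w ]) v
    agree {v} v∈ with v ≟ x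
    ... | yes refl = α-reflexive ([↦]-≡ θ refl)
    ... | no v≢x = substitute-agree (ρ v) λ u∈ →
      α-reflexive ([↦]-≢ θ (freshFor-≢ ρ (PLm x p) (∈-PLm⁺ x p v∈ v≢x) u∈))

  substitute-congʳ : ∀ {p q s t x} → p ≈α q → s ≈α t → p ⟦ s / x ⟧ ≈α q ⟦ t / x ⟧
  substitute-congʳ {p} {q} {s} {t} {x} p≈q s≈t =
    α-trans (substitute-cong p≈q _) (substitute-agree q agree)
    where
    agree : ∀ {v} → v ∈ freeVars q → (PVr [ x ↦ s ]) v ≈α (PVr [ x ↦ t ]) v
    agree {v} _ with v ≟ x
    ... | yes _ = s≈t
    ... | no _  = ≈vr

  ⟦⟧-PLm : ∀ x p s z → x ≢ z → x ∉ freeVars s → PLm x p ⟦ s / z ⟧ ≈α PLm x (p ⟦ s / z ⟧)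
  ⟦⟧-PLm x p s z x≢z x∉s =
    α-trans (substitute-PLm x p (PVr [ z ↦ s ]) x (λ v∈ → x∉ (proj₂ (∈-PLm⁻ x p v∈))))
      (PLm-cong (substitute-agree p (λ {v} _ → agree v)))
    where
    x∉ : ∀ {v} → v ≢ x → x ∉ freeVars ((PVr [ z ↦ s ]) v)
    x∉ {v} v≢x x∈ with v ≟ z
    ... | yes _ = x∉s x∈
    ... | no _ with here x≡v ← x∈ = v≢x (sym x≡v)
    agree : ∀ v → (PVr [ z ↦ s ] [ x ↦ PVr x ]) v ≈α (PVr [ z ↦ s ]) v
    agree v with v ≟ x
    ... | no _ = α-refl
    ... | yes refl = α-reflexive (sym ([↦]-≢ PVr x≢z))

  ⟦⟧-swap : ∀ p x x′ → x′ ≢ x → x′ ∉ freeVars p → p ⟦ PVr x′ / x ⟧ ≈α mapVars (swap x′ x) p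
  ⟦⟧-swap p x x′ x′≢x x′∉p = substitute-perm p (x′ ↔ₚ x) (PVr [ x ↦ PVr x′ ]) (λ {v} → agree {v})
    where
    agree : ∀ {v} → v ∈ freeVars p → (PVr [ x ↦ PVr x′ ]) v ≡ PVr (swap x′ x v)
    agree {v} v∈ with v ≟ x′
    ... | yes refl = contradiction v∈ x′∉p
    ... | no _ with v ≟ x
    ...   | yes _ = refl
    ...   | no _ = refl

  ⟦⟧-PLm-fresh : ∀ x p x′ → x′ ≢ x → x′ ∉ freeVars p → PLm x p ≈α PLm x′ (p ⟦ PVr x′ / x ⟧)
  ⟦⟧-PLm-fresh x p x′ x′≢x x′∉p =
    α-trans (PLm-swap x p x′ (x′∉p ∘ proj₁ ∘ ∈-PLm⁻ x p))
      (PLm-cong (α-sym (⟦⟧-swap p x x′ x′≢x x′∉p)))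

  ⟦⟧-fresh : ∀ p s x → x ∉ freeVars p → p ⟦ s / x ⟧ ≈α p
  ⟦⟧-fresh p s x x∉p = substitute-id p _ λ v∈ → [↦]-≢ PVr λ { refl → x∉p v∈ }

  ⟦⟧-∉ : ∀ p y x → y ≢ x → x ∉ freeVars (p ⟦ PVr y / x ⟧)
  ⟦⟧-∉ p y x y≢x x∈ with freeVars-substitute⁻ p (PVr [ x ↦ PVr y ]) x∈
  ... | v , _ , x∈v with v ≟ x
  ...   | yes _ with here x≡y ← x∈v = y≢x (sym x≡y)
  ...   | no v≢x with here x≡v ← x∈v = v≢x (sym x≡v)

  renameVar-≡ : ∀ {x y z} → x ≡ z → renameVar x y z ≡ y
  renameVar-≡ {x} {y} {z} x≡z with x ≟ z
  ... | yes _ = refl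
  ... | no x≢z = contradiction x≡z x≢z

  renameVar-≢ : ∀ {x y z} → x ≢ z → renameVar x y z ≡ x
  renameVar-≢ {x} {y} {z} x≢z with x ≟ z
  ... | yes x≡z = contradiction x≡z x≢z
  ... | no _ = refl

  freshInTerm : Var → Preterm → Bool
  freshInTerm x p = not (does (x ∈? freeVars p))

  freshInTerm⁺ : ∀ {x} p → x ∉ freeVars p → T (freshInTerm x p)
  freshInTerm⁺ {x} p x∉ with x ∈? freeVars p
  ... | yes x∈ = contradiction x∈ x∉
  ... | no _ = tt

  freshInTerm⁻ : ∀ {x} p → T (freshInTerm x p) → x ∉ freeVars p
  freshInTerm⁻ {x} p _ x∈ with x ∈? freeVars p
  ... | no x∉ = x∉ x∈

  freshInTerm-cong : ∀ {x p q} → p ≈α q → freshInTerm x p ≡ freshInTerm x q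
  freshInTerm-cong {x} {p} {q} p≈q with x ∈? freeVars p | x ∈? freeVars q
  ... | yes _  | yes _  = refl
  ... | no _   | no _   = refl
  ... | yes x∈ | no x∉  = contradiction (freeVars-≈ p≈q x∈) x∉
  ... | no x∉  | yes x∈ = contradiction (freeVars-≈ (α-sym p≈q) x∈) x∉

  termOp : ∀ s → Op s Terms
  termOp vr  = record { Vr = PVr }
  termOp ap  = record { Ap = PAp ; Ap-cong = ≈ap }
  termOp lm  = record { Lm = PLm ; Lm-cong = PLm-cong }
  termOp pm  = record
    { _[_]ᵖ   = λ p σ → mapVars (σ ·_) p
    ; pm-cong = λ {_} {q} {σ} p≈q σ≈τ →
        α-trans (≈α-map σ p≈q) (α-reflexive (mapVars-≗ σ≈τ q))
    }
  termOp sw  = record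
    { _[_∧_]  = λ p x y → mapVars (swap x y) p
    ; sw-cong = λ {_} {_} {x} {y} → ≈α-map (x ↔ₚ y)
    }
  termOp sb  = record { _[_/_] = _⟦_/_⟧ ; sb-cong = substitute-congʳ }
  termOp ren = record
    { _[_/_]ʳ  = λ p y x → p ⟦ PVr y / x ⟧
    ; ren-cong = λ p≈q → substitute-cong p≈q _
    }
  termOp fv  = record { FV = λ p x → x ∈ freeVars p ; FV-cong = λ p≈q → freeVars-≈ p≈q }
  termOp fr  = record { isFresh = freshInTerm ; fr-cong = freshInTerm-cong }

  Tr : (Σ : Signature) → Model Σ
  Tr Σ = model Terms (λ s → given (Σ s) (termOp s))

  moved-infinite : ∀ p → (λ x → x ∈ freeVars p) ≐
                   (λ x → Infinite (λ y → ¬ (mapVars (swap x y) p ≈α p)))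
  moved-infinite p = to , from
    where
    to : ∀ {x} → x ∈ freeVars p → Infinite (λ y → ¬ (mapVars (swap x y) p ≈α p))
    to {x} x∈ (ys , covers) = fresh-∉ (freeVars p ++ ys)
      (∈-++⁺ʳ (freeVars p) (covers λ fixed → fresh-∉ (freeVars p ++ ys) (∈-++⁺ˡ
        (freeVars-≈ fixed (subst (_∈ freeVars (mapVars (swap x z) p)) (swap-l x z)
          (freeVars-map⁺ (x ↔ₚ z) p x∈))))))
      where z = fresh (freeVars p ++ ys)
    from : ∀ {x} → Infinite (λ y → ¬ (mapVars (swap x y) p ≈α p)) → x ∈ freeVars p
    from {x} infinite = decidable-stable (x ∈? freeVars p) λ x∉ →
      infinite (freeVars p , λ {y} moved → decidable-stable (y ∈? freeVars p) λ y∉ →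
        moved (map-fresh₂ p x y x∉ y∉))

  Tr-holds : ∀ P → Holds P (Tr ⟨ symbols P ⟩)
  Tr-holds SwVr x z₁ z₂ = α-refl
  Tr-holds SwAp m₁ m₂ z₁ z₂ = α-refl
  Tr-holds SwLm x m z₁ z₂ = α-refl
  Tr-holds SwId m z = map-fix m (z ↔ₚ z) (λ {x} _ → swap-id x)
    where
    swap-id : ∀ x → swap z z x ≡ x
    swap-id x with x ≟ z
    ... | yes x≡z = sym x≡z
    ... | no _ = refl
  Tr-holds SwIv m x y = α-reflexive (trans (mapVars-∘ (swap x y) (swap x y) m)
    (trans (mapVars-≗ (swap-invol x y) m) (mapVars-id m)))
  Tr-holds SwCp m x y z₁ z₂ = α-reflexive (sym (mapVars-swap (z₁ ↔ₚ z₂) x y m))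
  Tr-holds SwFv m x y x∉ y∉ = map-fresh₂ m x y x∉ y∉
  Tr-holds SwCg m₁ m₂ x₁ x₂ z _ _ z#m₁ z#m₂ eq =
    PLm-intro z (freshInTerm⁻ m₁ z#m₁ ∘ proj₁ ∘ ∈-PLm⁻ x₁ m₁)
                (freshInTerm⁻ m₂ z#m₂ ∘ proj₁ ∘ ∈-PLm⁻ x₂ m₂) eq
  Tr-holds SwBvr m x x′ _ x′#m = PLm-swap x m x′ (freshInTerm⁻ m x′#m ∘ proj₁ ∘ ∈-PLm⁻ x m)
  Tr-holds PmVr x σ = α-refl
  Tr-holds PmAp m₁ m₂ σ = α-refl
  Tr-holds PmLm x m σ = α-refl
  Tr-holds PmId m = α-reflexive (mapVars-id m)
  Tr-holds PmCp m σ τ = α-reflexive (mapVars-∘ (τ ·_) (σ ·_) m)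
  Tr-holds PmFv m σ disjoint = map-fix m σ λ {x} x∈ →
    decidable-stable (σ · x ≟ x) λ moved → disjoint x (moved , x∈)
  Tr-holds SbVr x n z with x ≟ z
  ... | yes _ = α-refl
  ... | no _  = α-refl
  Tr-holds SbAp m₁ m₂ n z = α-refl
  Tr-holds SbLm x m n z x≢z x#n = ⟦⟧-PLm x m n z x≢z (freshInTerm⁻ n x#n)
  Tr-holds SbBvr m x x′ x′≢x x′#m = ⟦⟧-PLm-fresh x m x′ x′≢x (freshInTerm⁻ m x′#m)
  Tr-holds RnVr x y z with x ≟ z
  ... | yes _ = α-refl
  ... | no _  = α-refl
  Tr-holds RnAp m₁ m₂ y z = α-refl
  Tr-holds RnLm₁ x m y z x≢y x≢z = ⟦⟧-PLm x m (PVr y) z x≢z λ { (here x≡y) → x≢y x≡y }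
  Tr-holds RnLm₂ x m z = ⟦⟧-fresh (PLm x m) (PVr z) x λ x∈ → proj₂ (∈-PLm⁻ x m x∈) refl
  Tr-holds RnBvr m x x′ x′≢x x′#m = ⟦⟧-PLm-fresh x m x′ x′≢x (freshInTerm⁻ m x′#m)
  Tr-holds RnBvr₂ m x x′ y y≢x′ with x′ ≟ x
  ... | no x′≢x = ⟦⟧-PLm-fresh x (m ⟦ PVr y / x′ ⟧) x′ x′≢x (⟦⟧-∉ m y x′ y≢x′)
  ... | yes refl = PLm-cong (α-sym (⟦⟧-fresh (m ⟦ PVr y / x ⟧) (PVr x) x (⟦⟧-∉ m y x y≢x′)))
  Tr-holds RnId m z = substitute-id m (PVr [ z ↦ PVr z ]) (λ {v} _ → same v)
    where
    same : ∀ v → (PVr [ z ↦ PVr z ]) v ≡ PVr v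
    same v with v ≟ z
    ... | yes v≡z = cong PVr (sym v≡z)
    ... | no _ = refl
  Tr-holds RnIm m x₁ x₂ y x₁≢y =
    ⟦⟧-fresh (m ⟦ PVr x₁ / y ⟧) (PVr x₂) y (⟦⟧-∉ m x₁ y x₁≢y)
  Tr-holds RnCh m x₁ x₂ x₃ y y≢x₂ =
    α-trans (substitute-∘ m′ (PVr [ x₁ ↦ PVr x₂ ]) (PVr [ x₂ ↦ PVr x₃ ]))
      (substitute-agree m′ λ {v} v∈ → α-reflexive (same λ { refl → ⟦⟧-∉ m y x₂ y≢x₂ v∈ }))
    where
    m′ = m ⟦ PVr y / x₂ ⟧
    same : ∀ {v} → v ≢ x₂ →
           substitute (PVr [ x₂ ↦ PVr x₃ ]) ((PVr [ x₁ ↦ PVr x₂ ]) v) ≡ (PVr [ x₁ ↦ PVr x₃ ]) v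
    same {v} v≢x₂ with v ≟ x₁
    ... | yes _ = [↦]-≡ PVr refl
    ... | no _ = [↦]-≢ PVr v≢x₂
  Tr-holds RnCm m x₁ x₂ y₁ y₂ x₂≢y₁ y₁≢x₁ x₁≢y₂ =
    α-trans (substitute-∘ m (PVr [ x₁ ↦ PVr x₂ ]) (PVr [ y₁ ↦ PVr y₂ ]))
      (α-trans (substitute-agree m (λ {v} _ → α-reflexive (same v)))
        (α-sym (substitute-∘ m (PVr [ y₁ ↦ PVr y₂ ]) (PVr [ x₁ ↦ PVr x₂ ]))))
    where
    same : ∀ v → substitute (PVr [ y₁ ↦ PVr y₂ ]) ((PVr [ x₁ ↦ PVr x₂ ]) v) ≡
                 substitute (PVr [ x₁ ↦ PVr x₂ ]) ((PVr [ y₁ ↦ PVr y₂ ]) v)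
    same v = case v ≟ x₁ of λ where
      (yes refl) → trans (cong (substitute _) ([↦]-≡ PVr refl))
        (trans ([↦]-≢ PVr x₂≢y₁)
          (sym (trans (cong (substitute _) ([↦]-≢ PVr (y₁≢x₁ ∘ sym))) ([↦]-≡ PVr refl))))
      (no v≢x₁) → trans (cong (substitute _) ([↦]-≢ PVr v≢x₁)) (case v ≟ y₁ of λ where
        (yes refl) → trans ([↦]-≡ PVr refl)
          (sym (trans (cong (substitute _) ([↦]-≡ PVr refl)) ([↦]-≢ PVr (x₁≢y₂ ∘ sym))))
        (no v≢y₁) → trans ([↦]-≢ PVr v≢y₁)
          (sym (trans (cong (substitute _) ([↦]-≢ PVr v≢y₁)) ([↦]-≢ PVr v≢x₁))))
  Tr-holds FrVr x z z≢x = freshInTerm⁺ (PVr x) λ { (here z≡x) → z≢x z≡x }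
  Tr-holds FrAp m₁ m₂ z z#m₁ z#m₂ = freshInTerm⁺ (PAp m₁ m₂) λ z∈ →
    case ∈-++⁻ (freeVars m₁) z∈ of λ where
      (inj₁ z∈₁) → freshInTerm⁻ m₁ z#m₁ z∈₁
      (inj₂ z∈₂) → freshInTerm⁻ m₂ z#m₂ z∈₂
  Tr-holds FrLm x m z (inj₁ z≡x) = freshInTerm⁺ (PLm x m) λ z∈ → proj₂ (∈-PLm⁻ x m z∈) z≡x
  Tr-holds FrLm x m z (inj₂ z#m) =
    freshInTerm⁺ (PLm x m) λ z∈ → freshInTerm⁻ m z#m (proj₁ (∈-PLm⁻ x m z∈))
  Tr-holds FvVr x (here y≡x) = sym y≡x
  Tr-holds FvAp m₁ m₂ = ∈-++⁻ (freeVars m₁)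
  Tr-holds FvLm x m y∈ = let y∈m , y≢x = ∈-PLm⁻ x m y∈ in y∈m , y≢x ∘ sym
  Tr-holds FvDPm m = moved-infinite m
  Tr-holds FvDSw m = moved-infinite m
  Tr-holds FCB = fresh [] , λ m x∈ → proj₂ (∈-PLm⁻ (fresh []) m x∈) refl

  model-≡ : ∀ {Σ A} (o o′ : ∀ s → When (Σ s) (Op s A)) → (∀ s → o s ≡ o′ s) →
            model {Σ} A o ≡ model A o′
  model-≡ {Σ} {A} o o′ eq = go (eq vr) (eq ap) (eq lm) (eq pm) (eq sw) (eq sb) (eq ren) (eq fv) (eq fr)
    where
    go : ∀ {a a′ b b′ c c′ d d′ e e′ f f′ g g′ h h′ i i′} →
         a ≡ a′ → b ≡ b′ → c ≡ c′ → d ≡ d′ → e ≡ e′ → f ≡ f′ → g ≡ g′ → h ≡ h′ → i ≡ i′ →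
         _≡_ {A = Model Σ}
           (record { carrier = A ; vrᵒ = a ; apᵒ = b ; lmᵒ = c ; pmᵒ = d ; swᵒ = e
                   ; sbᵒ = f ; renᵒ = g ; fvᵒ = h ; frᵒ = i })
           (record { carrier = A ; vrᵒ = a′ ; apᵒ = b′ ; lmᵒ = c′ ; pmᵒ = d′ ; swᵒ = e′
                   ; sbᵒ = f′ ; renᵒ = g′ ; fvᵒ = h′ ; frᵒ = i′ })
    go refl refl refl refl refl refl refl refl refl = refl

  reduct-Tr : ∀ {Σ Σ′} (Σ⊑Σ′ : Σ ⊑ Σ′) → reduct Σ⊑Σ′ (Tr Σ′) ≡ Tr Σ
  reduct-Tr {Σ} {Σ′} Σ⊑Σ′ =
    model-≡ (λ s → restrict (Σ s) (Σ′ s) (Σ⊑Σ′ s) (Model.op (Tr Σ′) s)) (λ s → given (Σ s) (termOp s)) λ where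
      vr  → eq vr
      ap  → eq ap
      lm  → eq lm
      pm  → eq pm
      sw  → eq sw
      sb  → eq sb
      ren → eq ren
      fv  → eq fv
      fr  → eq fr
    where
    restrict-given : ∀ {X : Set₁} b b′ (b⇒b′ : T b → T b′) (x : X) →
                     restrict b b′ b⇒b′ (given b′ x) ≡ given b x
    restrict-given true  true  b⇒b′ x = refl
    restrict-given true  false b⇒b′ x = ⊥-elim (b⇒b′ tt)
    restrict-given false b′    b⇒b′ x = refl
    eq : ∀ s → restrict (Σ s) (Σ′ s) (Σ⊑Σ′ s) (given (Σ′ s) (termOp s)) ≡ given (Σ s) (termOp s)
    eq s = restrict-given (Σ s) (Σ′ s) (Σ⊑Σ′ s) (termOp s)

  Tr-model : ∀ Ps → PropsModel Ps
  Tr-model Ps = record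
    { underlying = Tr (signature Ps)
    ; satisfies  = λ {P} P∈Ps →
        subst (Holds P) (sym (reduct-Tr (signature-⊑ Ps P∈Ps))) (Tr-holds P)
    }

  size : Preterm → ℕ
  size (PVr x)   = 0
  size (PAp p q) = suc (size p + size q)
  size (PLm x p) = suc (size p)

  size-map : ∀ f p → size (mapVars f p) ≡ size p
  size-map f (PVr x)   = refl
  size-map f (PAp p q) = cong₂ (λ m n → suc (m + n)) (size-map f p) (size-map f q)
  size-map f (PLm x p) = cong suc (size-map f p)

  size-≈ : ∀ {p q} → p ≈α q → size p ≡ size q
  size-≈ ≈vr = refl
  size-≈ (≈ap p≈ q≈) = cong₂ (λ m n → suc (m + n)) (size-≈ p≈) (size-≈ q≈)
  size-≈ (≈lm {x} {y} {p} {q} L h) = cong suc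
    (trans (sym (size-map (swap z x) p)) (trans (size-≈ (h z (fresh-∉ L))) (size-map (swap z y) q)))
    where z = fresh L

  module Iteration (A : Setoid 0ℓ 0ℓ) (vrOp : VrOp A) (apOp : ApOp A) (lmOp : LmOp A) where
    open Setoid A renaming (Carrier to M; refl to ≈-refl; sym to ≈-sym; trans to ≈-trans)
    open VrOp vrOp
    open ApOp apOp
    open LmOp lmOp
    private module R = SetoidReasoning A

    iter : Preterm → M
    iter (PVr x)   = Vr x
    iter (PAp p q) = Ap (iter p) (iter q)
    iter (PLm x p) = Lm x (iter p)

    iter-unique : (f : Preterm → M) → (∀ x → f (PVr x) ≈ Vr x) →
      (∀ p q → f (PAp p q) ≈ Ap (f p) (f q)) → (∀ x p → f (PLm x p) ≈ Lm x (f p)) →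
      ∀ p → f p ≈ iter p
    iter-unique f f-vr f-ap f-lm (PVr x)   = f-vr x
    iter-unique f f-vr f-ap f-lm (PAp p q) = ≈-trans (f-ap p q)
      (Ap-cong (iter-unique f f-vr f-ap f-lm p) (iter-unique f f-vr f-ap f-lm q))
    iter-unique f f-vr f-ap f-lm (PLm x p) =
      ≈-trans (f-lm x p) (Lm-cong (iter-unique f f-vr f-ap f-lm p))

    iter-≡ : ∀ {p q} → p ≡ q → iter p ≈ iter q
    iter-≡ refl = ≈-refl

    record Freshness : Set₁ where
      infix 4 _#_
      field
        _#_  : Var → M → Set
        #-Vr : ∀ x z → z ≢ x → z # Vr x
        #-Ap : ∀ m₁ m₂ z → z # m₁ → z # m₂ → z # Ap m₁ m₂
        #-Lm : ∀ x m z → z ≡ x ⊎ z # m → z # Lm x m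

      iter-# : ∀ p z → z ∉ freeVars p → z # iter p
      iter-# (PVr x)   z z∉ = #-Vr x z (λ z≡x → z∉ (here z≡x))
      iter-# (PAp p q) z z∉ = #-Ap _ _ z (iter-# p z (z∉ ∘ ∈-++⁺ˡ))
                                         (iter-# q z (z∉ ∘ ∈-++⁺ʳ (freeVars p)))
      iter-# (PLm x p) z z∉ with z ≟ x
      ... | yes z≡x = #-Lm x _ z (inj₁ z≡x)
      ... | no z≢x  = #-Lm x _ z (inj₂ (iter-# p z λ z∈ → z∉ (∈-PLm⁺ x p z∈ z≢x)))

    record SwapFresh : Set₁ where
      infixl 8 _[_∧_]
      field
        freshness : Freshness
        _[_∧_]    : M → Var → Var → M
      open Freshness freshness public
      field
        sw-Vr : ∀ x z₁ z₂ → Vr x [ z₁ ∧ z₂ ] ≈ Vr (swap z₁ z₂ x)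
        sw-Ap : ∀ m₁ m₂ z₁ z₂ → Ap m₁ m₂ [ z₁ ∧ z₂ ] ≈ Ap (m₁ [ z₁ ∧ z₂ ]) (m₂ [ z₁ ∧ z₂ ])
        sw-Lm : ∀ x m z₁ z₂ → Lm x m [ z₁ ∧ z₂ ] ≈ Lm (swap z₁ z₂ x) (m [ z₁ ∧ z₂ ])
        sw-Cg : ∀ m₁ m₂ x₁ x₂ z → z ≢ x₁ → z ≢ x₂ → z # m₁ → z # m₂ →
                m₁ [ z ∧ x₁ ] ≈ m₂ [ z ∧ x₂ ] → Lm x₁ m₁ ≈ Lm x₂ m₂

      iter-sw : ∀ p x y → iter (mapVars (swap x y) p) ≈ iter p [ x ∧ y ]
      iter-sw (PVr z)   x y = ≈-sym (sw-Vr z x y)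
      iter-sw (PAp p q) x y =
        ≈-trans (Ap-cong (iter-sw p x y) (iter-sw q x y)) (≈-sym (sw-Ap _ _ x y))
      iter-sw (PLm z p) x y = ≈-trans (Lm-cong (iter-sw p x y)) (≈-sym (sw-Lm z _ x y))

      iter-cong : ∀ {p q} → p ≈α q → iter p ≈ iter q
      iter-cong ≈vr = ≈-refl
      iter-cong (≈ap p≈ q≈) = Ap-cong (iter-cong p≈) (iter-cong q≈)
      iter-cong (≈lm {x} {y} {p} {q} L h) =
        sw-Cg (iter p) (iter q) x y z (z∉ ∘ here) (z∉ ∘ there ∘ here)
          (iter-# p z (z∉ ∘ there ∘ there ∘ ∈-++⁺ˡ))
          (iter-# q z (z∉ ∘ there ∘ there ∘ ∈-++⁺ʳ (freeVars p) ∘ ∈-++⁺ˡ))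
          (≈-trans (≈-sym (iter-sw p z x))
            (≈-trans (iter-cong (h z (z∉ ∘ there ∘ there ∘ ∈-++⁺ʳ (freeVars p) ∘ ∈-++⁺ʳ (freeVars q))))
              (iter-sw q z y)))
        where
        z  = fresh (x ∷ y ∷ freeVars p ++ freeVars q ++ L)
        z∉ = fresh-∉ (x ∷ y ∷ freeVars p ++ freeVars q ++ L)

    record RenameFresh : Set₁ where
      infixl 8 _[_/_]ʳ
      field
        freshness : Freshness
        _[_/_]ʳ   : M → Var → Var → M
      open Freshness freshness public
      field
        rn-cong : ∀ {m m′ y x} → m ≈ m′ → m [ y / x ]ʳ ≈ m′ [ y / x ]ʳ
        rn-Vr   : ∀ x y z → Vr x [ y / z ]ʳ ≈ Vr (renameVar x y z)
        rn-Ap   : ∀ m₁ m₂ y z → Ap m₁ m₂ [ y / z ]ʳ ≈ Ap (m₁ [ y / z ]ʳ) (m₂ [ y / z ]ʳ)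
        rn-Lm₁  : ∀ x m y z → x ≢ y → x ≢ z → Lm x m [ y / z ]ʳ ≈ Lm x (m [ y / z ]ʳ)
        rn-Bvr  : ∀ m x x′ → x′ ≢ x → x′ # m → Lm x m ≈ Lm x′ (m [ x′ / x ]ʳ)

      private
        Cong Ren : ℕ → Set
        Cong n = ∀ p q → size p ≤ n → p ≈α q → iter p ≈ iter q
        Ren n  = ∀ p y x → size p ≤ n → iter (p ⟦ PVr y / x ⟧) ≈ iter p [ y / x ]ʳ

        ren-vr : ∀ v y x → iter (PVr v ⟦ PVr y / x ⟧) ≈ Vr v [ y / x ]ʳ
        ren-vr v y x = ≈-trans (≈-reflexive v) (≈-sym (rn-Vr v y x))
          where
          ≈-reflexive : ∀ v → iter ((PVr [ x ↦ PVr y ]) v) ≈ Vr (renameVar v y x)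
          ≈-reflexive v with v ≟ x
          ... | yes _ = ≈-refl
          ... | no _  = ≈-refl

        fresh-body : ∀ {n} → Cong n → Ren n → ∀ x p z → size p ≤ n → z ≢ x → z ∉ freeVars p →
                     Lm x (iter p) ≈ Lm z (iter (mapVars (swap z x) p))
        fresh-body cong-n ren-n x p z p≤n z≢x z∉ =
          ≈-trans (rn-Bvr (iter p) x z z≢x (iter-# p z z∉))
            (Lm-cong (≈-trans (≈-sym (ren-n p z x p≤n))
              (≈-sym (cong-n (mapVars (swap z x) p) (p ⟦ PVr z / x ⟧)
                (subst (_≤ _) (sym (size-map _ p)) p≤n) (α-sym (⟦⟧-swap p x z z≢x z∉))))))

        cong-suc : ∀ {n} → Cong n → Ren n → Cong (suc n)
        cong-suc cong-n ren-n _ _ _ ≈vr = ≈-refl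
        cong-suc cong-n ren-n _ _ (s≤s ≤n) (≈ap {p} {_} {q} p≈ q≈) =
          Ap-cong (cong-n _ _ (ℕₚ.≤-trans (ℕₚ.m≤m+n (size p) (size q)) ≤n) p≈)
                  (cong-n _ _ (ℕₚ.≤-trans (ℕₚ.m≤n+m (size q) (size p)) ≤n) q≈)
        cong-suc {n} cong-n ren-n _ _ (s≤s ≤n) (≈lm {x} {y} {p} {q} L h) =
          ≈-trans (fresh-body cong-n ren-n x p z ≤n (z∉ ∘ here)
                    (z∉ ∘ there ∘ there ∘ ∈-++⁺ˡ))
            (≈-trans (Lm-cong (cong-n _ _ (subst (_≤ n) (sym (size-map _ p)) ≤n) hz))
              (≈-sym (fresh-body cong-n ren-n y q z (subst (_≤ n) size≡ ≤n)
                (z∉ ∘ there ∘ here) (z∉ ∘ there ∘ there ∘ ∈-++⁺ʳ (freeVars p) ∘ ∈-++⁺ˡ))))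
          where
          z  = fresh (x ∷ y ∷ freeVars p ++ freeVars q ++ L)
          z∉ = fresh-∉ (x ∷ y ∷ freeVars p ++ freeVars q ++ L)
          hz = h z (z∉ ∘ there ∘ there ∘ ∈-++⁺ʳ (freeVars p) ∘ ∈-++⁺ʳ (freeVars q))
          size≡ : size p ≡ size q
          size≡ = ℕₚ.suc-injective (size-≈ (≈lm {x} {y} {p} {q} L h))

        ren-suc : ∀ {n} → Cong n → Ren n → Ren (suc n)
        ren-suc cong-n ren-n (PVr v) y x _ = ren-vr v y x
        ren-suc cong-n ren-n (PAp p q) y x (s≤s ≤n) = ≈-trans
          (Ap-cong (ren-n p y x (ℕₚ.≤-trans (ℕₚ.m≤m+n (size p) (size q)) ≤n))
                   (ren-n q y x (ℕₚ.≤-trans (ℕₚ.m≤n+m (size q) (size p)) ≤n)))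
          (≈-sym (rn-Ap _ _ y x))
        ren-suc {n} cong-n ren-n (PLm v p) y x (s≤s ≤n) = R.begin
          iter (PLm v p ⟦ PVr y / x ⟧)
            R.≈⟨ cong-suc cong-n ren-n _ _ size≤ renamed ⟩
          Lm w (iter (p′ ⟦ PVr y / x ⟧))
            R.≈⟨ Lm-cong (ren-n p′ y x (subst (_≤ n) (sym (size-map _ p)) ≤n)) ⟩
          Lm w (iter p′ [ y / x ]ʳ)
            R.≈⟨ rn-Lm₁ w (iter p′) y x (w∉ ∘ there ∘ here) (w∉ ∘ there ∘ there ∘ here) ⟨
          Lm w (iter p′) [ y / x ]ʳ
            R.≈⟨ rn-cong (fresh-body cong-n ren-n v p w ≤n (w∉ ∘ here) w∉p) ⟨
          Lm v (iter p) [ y / x ]ʳ R.∎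
          where
          w  = fresh (v ∷ y ∷ x ∷ freeVars p)
          w∉ = fresh-∉ (v ∷ y ∷ x ∷ freeVars p)
          p′ = mapVars (swap w v) p
          w∉p : w ∉ freeVars p
          w∉p = w∉ ∘ there ∘ there ∘ there
          renamed : PLm v p ⟦ PVr y / x ⟧ ≈α PLm w (p′ ⟦ PVr y / x ⟧)
          renamed = α-trans (substitute-cong (PLm-swap v p w (w∉p ∘ proj₁ ∘ ∈-PLm⁻ v p)) _)
            (⟦⟧-PLm w p′ (PVr y) x (w∉ ∘ there ∘ there ∘ here) λ { (here w≡y) → w∉ (there (here w≡y)) })
          size-sub : ∀ p ρ → (∀ v → size (ρ v) ≡ 0) → size (substitute ρ p) ≡ size p
          size-sub (PVr v)   ρ h = h v
          size-sub (PAp p q) ρ h = cong₂ (λ m n → suc (m + n)) (size-sub p ρ h) (size-sub q ρ h)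
          size-sub (PLm x p) ρ h = cong suc (size-sub p _ h′)
            where
            h′ : ∀ v → size ((ρ [ x ↦ PVr (freshFor ρ (PLm x p)) ]) v) ≡ 0
            h′ v with v ≟ x
            ... | yes _ = refl
            ... | no _  = h v
          var-size : ∀ v → size ((PVr [ x ↦ PVr y ]) v) ≡ 0
          var-size v with v ≟ x
          ... | yes _ = refl
          ... | no _  = refl
          size≤ : size (PLm v p ⟦ PVr y / x ⟧) ≤ suc n
          size≤ = subst (_≤ suc n) (sym (size-sub (PLm v p) (PVr [ x ↦ PVr y ]) var-size)) (s≤s ≤n)

        both : ∀ n → Cong n × Ren n
        both zero = (λ { _ _ _ ≈vr → ≈-refl }) , λ { (PVr v) y x _ → ren-vr v y x }
        both (suc n) = let cong-n , ren-n = both n in cong-suc cong-n ren-n , ren-suc cong-n ren-n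

      iter-cong : ∀ {p q} → p ≈α q → iter p ≈ iter q
      iter-cong {p} {q} = proj₁ (both (size p)) p q ℕₚ.≤-refl

      iter-rn : ∀ p y x → iter (p ⟦ PVr y / x ⟧) ≈ iter p [ y / x ]ʳ
      iter-rn p y x = proj₂ (both (size p)) p y x ℕₚ.≤-refl

    record SubstFresh : Set₁ where
      infixl 8 _[_/_]
      field
        freshness : Freshness
        _[_/_]    : M → M → Var → M
      open Freshness freshness public
      field
        sb-cong₂ : ∀ {m m′ n n′ x} → m ≈ m′ → n ≈ n′ → m [ n / x ] ≈ m′ [ n′ / x ]
        sb-Vr    : ∀ x n z → Vr x [ n / z ] ≈ (if does (x ≟ z) then n else Vr x)
        sb-Ap    : ∀ m₁ m₂ n z → Ap m₁ m₂ [ n / z ] ≈ Ap (m₁ [ n / z ]) (m₂ [ n / z ])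
        sb-Lm    : ∀ x m n z → x ≢ z → x # n → Lm x m [ n / z ] ≈ Lm x (m [ n / z ])
        sb-Bvr   : ∀ m x x′ → x′ ≢ x → x′ # m → Lm x m ≈ Lm x′ (m [ Vr x′ / x ])

      renameFresh : RenameFresh
      renameFresh = record
        { freshness = freshness
        ; _[_/_]ʳ   = λ m y x → m [ Vr y / x ]
        ; rn-cong   = λ m≈ → sb-cong₂ m≈ ≈-refl
        ; rn-Vr     = rn-Vr′
        ; rn-Ap     = λ m₁ m₂ y z → sb-Ap m₁ m₂ (Vr y) z
        ; rn-Lm₁    = λ x m y z x≢y x≢z → sb-Lm x m (Vr y) z x≢z (#-Vr y x x≢y)
        ; rn-Bvr    = sb-Bvr
        }
        where
        rn-Vr′ : ∀ x y z → Vr x [ Vr y / z ] ≈ Vr (renameVar x y z)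
        rn-Vr′ x y z with x ≟ z | sb-Vr x (Vr y) z
        ... | yes _ | eq = eq
        ... | no _  | eq = eq

      open RenameFresh renameFresh public using (iter-cong)

      iter-sb′ : ∀ p σ s x → iter (mapVars (σ ·_) p ⟦ s / x ⟧) ≈ iter (mapVars (σ ·_) p) [ iter s / x ]
      iter-sb′ (PVr v) σ s x with σ · v ≟ x | sb-Vr (σ · v) (iter s) x
      ... | yes _ | eq = ≈-sym eq
      ... | no _  | eq = ≈-sym eq
      iter-sb′ (PAp p q) σ s x =
        ≈-trans (Ap-cong (iter-sb′ p σ s x) (iter-sb′ q σ s x)) (≈-sym (sb-Ap _ _ _ x))
      iter-sb′ (PLm v p) σ s x = R.begin
        iter (PLm u q ⟦ s / x ⟧)
          R.≈⟨ iter-cong (α-trans (substitute-cong renamed _) (⟦⟧-PLm w q′ s x (w∉ ∘ here) w∉s)) ⟩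
        Lm w (iter (q′ ⟦ s / x ⟧))
          R.≈⟨ Lm-cong (iter-sb′ p (w ↔ₚ u ∘ₚ σ) s x) ⟩
        Lm w (iter q′ [ iter s / x ])
          R.≈⟨ sb-Lm w (iter q′) (iter s) x (w∉ ∘ here) (iter-# s w w∉s) ⟨
        Lm w (iter q′) [ iter s / x ]
          R.≈⟨ sb-cong₂ (iter-cong renamed) ≈-refl ⟨
        iter (PLm u q) [ iter s / x ] R.∎
        where
        u  = σ · v
        q  = mapVars (σ ·_) p
        w  = fresh (x ∷ freeVars s ++ freeVars q)
        w∉ = fresh-∉ (x ∷ freeVars s ++ freeVars q)
        q′ = mapVars ((w ↔ₚ u ∘ₚ σ) ·_) p
        w∉s : w ∉ freeVars s
        w∉s = w∉ ∘ there ∘ ∈-++⁺ˡ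
        renamed : PLm u q ≈α PLm w q′
        renamed = subst (λ q′ → PLm u q ≈α PLm w q′) (mapVars-∘ (swap w u) (σ ·_) p)
          (PLm-swap u q w (w∉ ∘ there ∘ ∈-++⁺ʳ (freeVars s) ∘ proj₁ ∘ ∈-PLm⁻ u q))

      iter-sb : ∀ p s x → iter (p ⟦ s / x ⟧) ≈ iter p [ iter s / x ]
      iter-sb p s x = subst (λ q → iter (q ⟦ s / x ⟧) ≈ iter q [ iter s / x ]) (mapVars-id p)
        (iter-sb′ p idₚ s x)

    record RenameOnly : Set₁ where
      infixl 8 _[_/_]ʳ
      field
        _[_/_]ʳ : M → Var → Var → M
        rn-cong : ∀ {m m′ y x} → m ≈ m′ → m [ y / x ]ʳ ≈ m′ [ y / x ]ʳ
        rn-Vr   : ∀ x y z → Vr x [ y / z ]ʳ ≈ Vr (renameVar x y z)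
        rn-Ap   : ∀ m₁ m₂ y z → Ap m₁ m₂ [ y / z ]ʳ ≈ Ap (m₁ [ y / z ]ʳ) (m₂ [ y / z ]ʳ)
        rn-Lm₁  : ∀ x m y z → x ≢ y → x ≢ z → Lm x m [ y / z ]ʳ ≈ Lm x (m [ y / z ]ʳ)
        rn-Lm₂  : ∀ x m z → Lm x m [ z / x ]ʳ ≈ Lm x m
        rn-Bvr₂ : ∀ m x x′ y → y ≢ x′ → Lm x (m [ y / x′ ]ʳ) ≈ Lm x′ (m [ y / x′ ]ʳ [ x′ / x ]ʳ)
        rn-Im   : ∀ m x₁ x₂ y → x₁ ≢ y → m [ x₁ / y ]ʳ [ x₂ / y ]ʳ ≈ m [ x₁ / y ]ʳ

      -- Invariance under one nontrivial renaming of x implies invariance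
      -- under all of them.
      unaffected : ∀ {m x} y → y ≢ x → m [ y / x ]ʳ ≈ m → ∀ z → m [ z / x ]ʳ ≈ m
      unaffected {m} {x} y y≢x eq z =
        ≈-trans (rn-cong (≈-sym eq)) (≈-trans (rn-Im m y z x y≢x) eq)

      renameFresh : RenameFresh
      renameFresh = record
        { freshness = record
          { _#_  = λ x m → ∀ y → m [ y / x ]ʳ ≈ m
          ; #-Vr = λ x z z≢x y → ≈-trans (rn-Vr x y z)
                     (subst (λ v → Vr v ≈ Vr x) (sym (renameVar-≢ (z≢x ∘ sym))) ≈-refl)
          ; #-Ap = λ m₁ m₂ z z#m₁ z#m₂ y → ≈-trans (rn-Ap m₁ m₂ y z) (Ap-cong (z#m₁ y) (z#m₂ y))
          ; #-Lm = #-Lm′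
          }
        ; _[_/_]ʳ = _[_/_]ʳ
        ; rn-cong = rn-cong
        ; rn-Vr   = rn-Vr
        ; rn-Ap   = rn-Ap
        ; rn-Lm₁  = rn-Lm₁
        ; rn-Bvr  = λ m x x′ x′≢x x′#m → ≈-trans (Lm-cong (≈-sym (x′#m x)))
            (≈-trans (rn-Bvr₂ m x x′ x (x′≢x ∘ sym)) (Lm-cong (rn-cong (x′#m x))))
        }
        where
        #-Lm′ : ∀ x m z → z ≡ x ⊎ (∀ y → m [ y / z ]ʳ ≈ m) → ∀ y → Lm x m [ y / z ]ʳ ≈ Lm x m
        #-Lm′ x m z (inj₁ refl) y = rn-Lm₂ x m y
        #-Lm′ x m z (inj₂ z#m) = case z ≟ x of λ where
          (yes refl) → rn-Lm₂ x m
          (no z≢x) →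
            let w  = fresh (x ∷ z ∷ [])
                w∉ = fresh-∉ (x ∷ z ∷ [])
            in unaffected w (w∉ ∘ there ∘ here)
                 (≈-trans (rn-Lm₁ x m w z (λ x≡w → w∉ (here (sym x≡w))) (z≢x ∘ sym))
                   (Lm-cong (z#m w)))

      open RenameFresh renameFresh public using (iter-cong; iter-rn)

    record SwapFree : Set₁ where
      infixl 8 _[_∧_]
      field
        _[_∧_] : M → Var → Var → M
        FV     : M → Pred Var 0ℓ
        sw-Vr  : ∀ x z₁ z₂ → Vr x [ z₁ ∧ z₂ ] ≈ Vr (swap z₁ z₂ x)
        sw-Ap  : ∀ m₁ m₂ z₁ z₂ → Ap m₁ m₂ [ z₁ ∧ z₂ ] ≈ Ap (m₁ [ z₁ ∧ z₂ ]) (m₂ [ z₁ ∧ z₂ ])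
        sw-Lm  : ∀ x m z₁ z₂ → Lm x m [ z₁ ∧ z₂ ] ≈ Lm (swap z₁ z₂ x) (m [ z₁ ∧ z₂ ])
        sw-Fv  : ∀ m x y → ¬ FV m x → ¬ FV m y → m [ x ∧ y ] ≈ m
        fv-Vr  : ∀ x → FV (Vr x) Pred.⊆ ｛ x ｝
        fv-Ap  : ∀ m₁ m₂ → FV (Ap m₁ m₂) Pred.⊆ FV m₁ Pred.∪ FV m₂
        fv-Lm  : ∀ x m → FV (Lm x m) Pred.⊆ FV m Pred.∖ ｛ x ｝

      private
        sw-Bvr′ : ∀ m x x′ → ¬ FV m x′ → Lm x m ≈ Lm x′ (m [ x′ ∧ x ])
        sw-Bvr′ m x x′ x′∉ =
          ≈-trans (≈-sym (sw-Fv (Lm x m) x′ x (x′∉ ∘ proj₁ ∘ fv-Lm x m)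
                                              (λ x∈ → proj₂ (fv-Lm x m x∈) refl)))
            (≈-trans (sw-Lm x m x′ x) (subst (λ v → Lm v m′ ≈ Lm x′ m′) (sym (swap-r x′ x)) ≈-refl))
          where m′ = m [ x′ ∧ x ]

      swapFresh : SwapFresh
      swapFresh = record
        { freshness = record
          { _#_  = λ x m → ¬ FV m x
          ; #-Vr = λ x z z≢x z∈ → z≢x (sym (fv-Vr x z∈))
          ; #-Ap = λ m₁ m₂ z z∉m₁ z∉m₂ z∈ → case fv-Ap m₁ m₂ z∈ of λ where
              (inj₁ z∈m₁) → z∉m₁ z∈m₁
              (inj₂ z∈m₂) → z∉m₂ z∈m₂
          ; #-Lm = λ where
              x m z (inj₁ z≡x) z∈ → proj₂ (fv-Lm x m z∈) (sym z≡x)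
              x m z (inj₂ z∉m) z∈ → z∉m (proj₁ (fv-Lm x m z∈))
          }
        ; _[_∧_]    = _[_∧_]
        ; sw-Vr     = sw-Vr
        ; sw-Ap     = sw-Ap
        ; sw-Lm     = sw-Lm
        ; sw-Cg     = λ m₁ m₂ x₁ x₂ z _ _ z∉m₁ z∉m₂ eq →
            ≈-trans (sw-Bvr′ m₁ x₁ z z∉m₁) (≈-trans (Lm-cong eq) (≈-sym (sw-Bvr′ m₂ x₂ z z∉m₂)))
        }

      open SwapFresh swapFresh public using (iter-cong; iter-sw; iter-#)

      iter-fv : ∀ p → FV (iter p) Pred.⊆ (_∈ freeVars p)
      iter-fv p {x} x∈ = decidable-stable (x ∈? freeVars p) λ x∉ → iter-# p x x∉ x∈

    record SwapDefinedFree : Set₁ where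
      infixl 8 _[_∧_]
      field
        _[_∧_]  : M → Var → Var → M
        FV      : M → Pred Var 0ℓ
        sw-cong : ∀ {m m′ x y} → m ≈ m′ → m [ x ∧ y ] ≈ m′ [ x ∧ y ]
        sw-Vr   : ∀ x z₁ z₂ → Vr x [ z₁ ∧ z₂ ] ≈ Vr (swap z₁ z₂ x)
        sw-Ap   : ∀ m₁ m₂ z₁ z₂ → Ap m₁ m₂ [ z₁ ∧ z₂ ] ≈ Ap (m₁ [ z₁ ∧ z₂ ]) (m₂ [ z₁ ∧ z₂ ])
        sw-Lm   : ∀ x m z₁ z₂ → Lm x m [ z₁ ∧ z₂ ] ≈ Lm (swap z₁ z₂ x) (m [ z₁ ∧ z₂ ])
        sw-Id   : ∀ m z → m [ z ∧ z ] ≈ m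
        sw-Iv   : ∀ m x y → m [ x ∧ y ] [ x ∧ y ] ≈ m
        sw-Cp   : ∀ m x y z₁ z₂ →
                  m [ x ∧ y ] [ z₁ ∧ z₂ ] ≈ m [ z₁ ∧ z₂ ] [ swap z₁ z₂ x ∧ swap z₁ z₂ y ]
        fv-D    : ∀ m → FV m ≐ (λ x → Infinite (λ y → ¬ (m [ x ∧ y ] ≈ m)))
        fcb     : ∃[ x ] (∀ m → ¬ FV (Lm x m) x)

      module _ (em : ExcludedMiddle 0ℓ) where

        private
          Fixing : M → Var → List Var → Set
          Fixing m x ys = ∀ y → y ∉ ys → m [ x ∧ y ] ≈ m

          fixing : ∀ m x → ¬ FV m x → Σ[ ys ∈ List Var ] Fixing m x ys
          fixing m x x∉ =
            let ys , covers = decidable-stable em (λ infinite → x∉ (proj₂ (fv-D m) infinite))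
            in ys , λ y y∉ → decidable-stable em (λ moved → y∉ (covers moved))

          unfree : ∀ m x ys → Fixing m x ys → ¬ FV m x
          unfree m x ys fix x∈ = proj₁ (fv-D m) x∈
            (ys , λ {y} moved → decidable-stable (y ∈? ys) (λ y∉ → moved (fix y y∉)))

          ≈-swap : ∀ m {x x′ y y′} → x ≡ x′ → y ≡ y′ → m [ x ∧ y ] ≈ m [ x′ ∧ y′ ]
          ≈-swap m refl refl = ≈-refl

          sw-Fv : ∀ m x y → ¬ FV m x → ¬ FV m y → m [ x ∧ y ] ≈ m
          sw-Fv m x y x∉ y∉ = case x ≟ y of λ where
            (yes refl) → sw-Id m x
            (no x≢y) →
              let xs , fix-x = fixing m x x∉
                  ys , fix-y = fixing m y y∉
                  z  = fresh (x ∷ y ∷ xs ++ ys)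
                  z∉ = fresh-∉ (x ∷ y ∷ xs ++ ys)
                  mx = fix-x z (z∉ ∘ there ∘ there ∘ ∈-++⁺ˡ)
                  my = fix-y z (z∉ ∘ there ∘ there ∘ ∈-++⁺ʳ xs)
              in R.begin
                m [ x ∧ y ]                                  R.≈⟨ sw-cong my ⟨
                m [ y ∧ z ] [ x ∧ y ]
                  R.≈⟨ ≈-swap _ (swap-o x≢y (λ x≡z → z∉ (here (sym x≡z)))) (swap-r y z) ⟨
                m [ y ∧ z ] [ swap y z x ∧ swap y z z ]      R.≈⟨ sw-Cp m x z y z ⟨
                m [ x ∧ z ] [ y ∧ z ]                        R.≈⟨ sw-cong mx ⟩
                m [ y ∧ z ]                                  R.≈⟨ my ⟩
                m                                            R.∎

          bound-unfree : ∀ x m → ¬ FV (Lm x m) x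
          bound-unfree x m = unfree (Lm x m) x (x ∷ x₀ ∷ zs) λ z z∉ → R.begin
              Lm x m [ x ∧ z ]                     R.≈⟨ sw-cong eq ⟩
              n [ x ∧ x₀ ] [ x ∧ z ]
                R.≈⟨ ≈-swap _ (swap-r x x₀) (swap-o (z∉ ∘ here) (z∉ ∘ there ∘ here)) ⟨
              n [ x ∧ x₀ ] [ swap x x₀ x₀ ∧ swap x x₀ z ]
                R.≈⟨ sw-Cp n x₀ z x x₀ ⟨
              n [ x₀ ∧ z ] [ x ∧ x₀ ]              R.≈⟨ sw-cong (fix z (z∉ ∘ there ∘ there)) ⟩
              n [ x ∧ x₀ ]                         R.≈⟨ eq ⟨
              Lm x m                               R.∎
            where
            x₀ = proj₁ fcb
            n  = Lm x₀ (m [ x ∧ x₀ ])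
            zs = proj₁ (fixing n x₀ (proj₂ fcb (m [ x ∧ x₀ ])))
            fix = proj₂ (fixing n x₀ (proj₂ fcb (m [ x ∧ x₀ ])))
            ≈-Lm : ∀ {y y′ k} → y ≡ y′ → Lm y k ≈ Lm y′ k
            ≈-Lm refl = ≈-refl
            eq : Lm x m ≈ n [ x ∧ x₀ ]
            eq = ≈-sym (≈-trans (sw-Lm x₀ _ x x₀) (≈-trans (≈-Lm (swap-r x x₀)) (Lm-cong (sw-Iv m x x₀))))

          fv-Vr : ∀ x → FV (Vr x) Pred.⊆ ｛ x ｝
          fv-Vr x {y} y∈ = decidable-stable (x ≟ y) λ x≢y → unfree (Vr x) y (x ∷ []) (λ z z∉ →
            ≈-trans (sw-Vr x y z) (≈-Vr (swap-o x≢y (λ x≡z → z∉ (here (sym x≡z)))))) y∈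
            where
            ≈-Vr : ∀ {u v} → u ≡ v → Vr u ≈ Vr v
            ≈-Vr refl = ≈-refl

          fv-Ap : ∀ m₁ m₂ → FV (Ap m₁ m₂) Pred.⊆ FV m₁ Pred.∪ FV m₂
          fv-Ap m₁ m₂ {x} x∈ = decidable-stable em λ x∉ →
            let xs , fix₁ = fixing m₁ x (x∉ ∘ inj₁)
                ys , fix₂ = fixing m₂ x (x∉ ∘ inj₂)
            in unfree (Ap m₁ m₂) x (xs ++ ys) (λ z z∉ → ≈-trans (sw-Ap m₁ m₂ x z)
                 (Ap-cong (fix₁ z (z∉ ∘ ∈-++⁺ˡ)) (fix₂ z (z∉ ∘ ∈-++⁺ʳ xs)))) x∈

          fv-Lm : ∀ x m → FV (Lm x m) Pred.⊆ FV m Pred.∖ ｛ x ｝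
          fv-Lm x m {y} y∈ = y∈m , y≢x ∘ sym
            where
            y≢x : y ≢ x
            y≢x refl = bound-unfree x m y∈
            y∈m : FV m y
            y∈m = decidable-stable em λ y∉ →
              let ys , fix = fixing m y y∉
              in unfree (Lm x m) y (x ∷ ys) (λ z z∉ → ≈-trans (sw-Lm x m y z)
                   (≈-trans (≈-Lm (swap-o (y≢x ∘ sym) (λ x≡z → z∉ (here (sym x≡z)))))
                     (Lm-cong (fix z (z∉ ∘ there))))) y∈
              where
              ≈-Lm : ∀ {y y′ k} → y ≡ y′ → Lm y k ≈ Lm y′ k
              ≈-Lm refl = ≈-refl

        swapFree : SwapFree
        swapFree = record
          { _[_∧_] = _[_∧_] ; FV = FV
          ; sw-Vr = sw-Vr ; sw-Ap = sw-Ap ; sw-Lm = sw-Lm ; sw-Fv = sw-Fv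
          ; fv-Vr = fv-Vr ; fv-Ap = fv-Ap ; fv-Lm = fv-Lm
          }

    module _ (pmOp : PmOp A) where
      open PmOp pmOp

      iter-pm : (∀ x σ → Vr x [ σ ]ᵖ ≈ Vr (σ · x)) →
                (∀ m₁ m₂ σ → Ap m₁ m₂ [ σ ]ᵖ ≈ Ap (m₁ [ σ ]ᵖ) (m₂ [ σ ]ᵖ)) →
                (∀ x m σ → Lm x m [ σ ]ᵖ ≈ Lm (σ · x) (m [ σ ]ᵖ)) →
                ∀ p σ → iter (mapVars (σ ·_) p) ≈ iter p [ σ ]ᵖ
      iter-pm pm-Vr pm-Ap pm-Lm = go
        where
        go : ∀ p σ → iter (mapVars (σ ·_) p) ≈ iter p [ σ ]ᵖ
        go (PVr x)   σ = ≈-sym (pm-Vr x σ)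
        go (PAp p q) σ = ≈-trans (Ap-cong (go p σ) (go q σ)) (≈-sym (pm-Ap _ _ σ))
        go (PLm x p) σ = ≈-trans (Lm-cong (go p σ)) (≈-sym (pm-Lm x _ σ))

  private
    ∈₀ : ∀ {P : Property} {Ps} → P ∈ P ∷ Ps
    ∈₀ = here refl
    ∈₁ : ∀ {P Q : Property} {Ps} → P ∈ Q ∷ P ∷ Ps
    ∈₁ = there ∈₀
    ∈₂ : ∀ {P Q₀ Q₁ : Property} {Ps} → P ∈ Q₀ ∷ Q₁ ∷ P ∷ Ps
    ∈₂ = there ∈₁
    ∈₃ : ∀ {P Q₀ Q₁ Q₂ : Property} {Ps} → P ∈ Q₀ ∷ Q₁ ∷ Q₂ ∷ P ∷ Ps
    ∈₃ = there ∈₂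
    ∈₄ : ∀ {P Q₀ Q₁ Q₂ Q₃ : Property} {Ps} → P ∈ Q₀ ∷ Q₁ ∷ Q₂ ∷ Q₃ ∷ P ∷ Ps
    ∈₄ = there ∈₃
    ∈₅ : ∀ {P Q₀ Q₁ Q₂ Q₃ Q₄ : Property} {Ps} → P ∈ Q₀ ∷ Q₁ ∷ Q₂ ∷ Q₃ ∷ Q₄ ∷ P ∷ Ps
    ∈₅ = there ∈₄
    ∈₆ : ∀ {P Q₀ Q₁ Q₂ Q₃ Q₄ Q₅ : Property} {Ps} → P ∈ Q₀ ∷ Q₁ ∷ Q₂ ∷ Q₃ ∷ Q₄ ∷ Q₅ ∷ P ∷ Ps
    ∈₆ = there ∈₅
    ∈₇ : ∀ {P Q₀ Q₁ Q₂ Q₃ Q₄ Q₅ Q₆ : Property} {Ps} →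
         P ∈ Q₀ ∷ Q₁ ∷ Q₂ ∷ Q₃ ∷ Q₄ ∷ Q₅ ∷ Q₆ ∷ P ∷ Ps
    ∈₇ = there ∈₆
    ∈₈ : ∀ {P Q₀ Q₁ Q₂ Q₃ Q₄ Q₅ Q₆ Q₇ : Property} {Ps} →
         P ∈ Q₀ ∷ Q₁ ∷ Q₂ ∷ Q₃ ∷ Q₄ ∷ Q₅ ∷ Q₆ ∷ Q₇ ∷ P ∷ Ps
    ∈₈ = there ∈₇

  module Initial₁ (em : ExcludedMiddle 0ℓ) (M : PropsModel Props₁) where
    open PropsModel M using (satisfies)
    open Model (underlying M) using (carrier; vrᵒ; apᵒ; lmᵒ; pmᵒ; fvᵒ)
    open Setoid carrier using () renaming (refl to ≈-refl; sym to ≈-sym; trans to ≈-trans)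
    open Iteration carrier vrᵒ apᵒ lmᵒ
    open PmOp pmᵒ

    core : SwapDefinedFree
    core = record
      { _[_∧_]  = λ m x y → m [ x ↔ₚ y ]ᵖ
      ; FV      = FvOp.FV fvᵒ
      ; sw-cong = λ m≈ → pm-cong m≈ (λ _ → refl)
      ; sw-Vr   = λ x z₁ z₂ → satisfies ∈₀ x (z₁ ↔ₚ z₂)
      ; sw-Ap   = λ m₁ m₂ z₁ z₂ → satisfies ∈₁ m₁ m₂ (z₁ ↔ₚ z₂)
      ; sw-Lm   = λ x m z₁ z₂ → satisfies ∈₂ x m (z₁ ↔ₚ z₂)
      ; sw-Id   = λ m z → ≈-trans (pm-cong ≈-refl (swap-id z)) (satisfies ∈₃ m)
      ; sw-Iv   = λ m x y → ≈-trans (satisfies ∈₄ m _ _)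
                    (≈-trans (pm-cong ≈-refl (swap-invol x y)) (satisfies ∈₃ m))
      ; sw-Cp   = λ m x y z₁ z₂ → ≈-trans (satisfies ∈₄ m _ _)
                    (≈-trans (pm-cong ≈-refl λ v → sym (swap-equivariant (z₁ ↔ₚ z₂) x y v))
                      (≈-sym (satisfies ∈₄ m _ _)))
      ; fv-D    = satisfies ∈₅
      ; fcb     = satisfies ∈₆
      }
      where
      swap-id : ∀ z x → swap z z x ≡ x
      swap-id z x with x ≟ z
      ... | yes x≡z = sym x≡z
      ... | no _ = refl
    open SwapFree (SwapDefinedFree.swapFree core em)

    hom : ModelHom (Tr (signature Props₁)) (underlying M)
    hom = record
      { func      = record { to = iter ; cong = iter-cong }
      ; preserves = λ where
          vr  → λ x → ≈-refl
          ap  → λ p q → ≈-refl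
          lm  → λ x p → ≈-refl
          pm  → iter-pm pmᵒ (satisfies ∈₀) (satisfies ∈₁) (satisfies ∈₂)
          sw  → _
          sb  → _
          ren → _
          fv  → iter-fv
          fr  → _
      }

    unique : (f : ModelHom (Tr (signature Props₁)) (underlying M)) → f ≈ₕ hom
    unique f = iter-unique (ModelHom.fun f)
      (ModelHom.preserves f vr) (ModelHom.preserves f ap) (ModelHom.preserves f lm)

  module Initial₂ (M : PropsModel Props₂) where
    open PropsModel M using (satisfies)
    open Model (underlying M) using (carrier; vrᵒ; apᵒ; lmᵒ; pmᵒ; fvᵒ)
    open Setoid carrier using () renaming (refl to ≈-refl)
    open Iteration carrier vrᵒ apᵒ lmᵒ
    open PmOp pmᵒ

    core : SwapFree
    core = record
      { _[_∧_] = λ m x y → m [ x ↔ₚ y ]ᵖ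
      ; FV     = FvOp.FV fvᵒ
      ; sw-Vr  = λ x z₁ z₂ → satisfies ∈₀ x (z₁ ↔ₚ z₂)
      ; sw-Ap  = λ m₁ m₂ z₁ z₂ → satisfies ∈₁ m₁ m₂ (z₁ ↔ₚ z₂)
      ; sw-Lm  = λ x m z₁ z₂ → satisfies ∈₂ x m (z₁ ↔ₚ z₂)
      ; sw-Fv  = λ m x y x∉ y∉ → satisfies ∈₅ m (x ↔ₚ y) λ v v∈both →
          proj₁ v∈both (swap-o (λ { refl → x∉ (proj₂ v∈both) }) (λ { refl → y∉ (proj₂ v∈both) }))
      ; fv-Vr  = satisfies ∈₆
      ; fv-Ap  = satisfies ∈₇
      ; fv-Lm  = satisfies ∈₈
      }
    open SwapFree core

    hom : ModelHom (Tr (signature Props₂)) (underlying M)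
    hom = record
      { func      = record { to = iter ; cong = iter-cong }
      ; preserves = λ where
          vr  → λ x → ≈-refl
          ap  → λ p q → ≈-refl
          lm  → λ x p → ≈-refl
          pm  → iter-pm pmᵒ (satisfies ∈₀) (satisfies ∈₁) (satisfies ∈₂)
          sw  → _
          sb  → _
          ren → _
          fv  → iter-fv
          fr  → _
      }

    unique : (f : ModelHom (Tr (signature Props₂)) (underlying M)) → f ≈ₕ hom
    unique f = iter-unique (ModelHom.fun f)
      (ModelHom.preserves f vr) (ModelHom.preserves f ap) (ModelHom.preserves f lm)

  module Initial₃ (em : ExcludedMiddle 0ℓ) (M : PropsModel Props₃) where
    open PropsModel M using (satisfies)
    open Model (underlying M) using (carrier; vrᵒ; apᵒ; lmᵒ; swᵒ; fvᵒ)
    open Setoid carrier using () renaming (refl to ≈-refl)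
    open Iteration carrier vrᵒ apᵒ lmᵒ

    core : SwapDefinedFree
    core = record
      { _[_∧_]  = SwOp._[_∧_] swᵒ
      ; FV      = FvOp.FV fvᵒ
      ; sw-cong = SwOp.sw-cong swᵒ
      ; sw-Vr   = satisfies ∈₀
      ; sw-Ap   = satisfies ∈₁
      ; sw-Lm   = satisfies ∈₂
      ; sw-Id   = satisfies ∈₃
      ; sw-Iv   = satisfies ∈₄
      ; sw-Cp   = satisfies ∈₅
      ; fv-D    = satisfies ∈₆
      ; fcb     = satisfies ∈₇
      }
    open SwapFree (SwapDefinedFree.swapFree core em)

    hom : ModelHom (Tr (signature Props₃)) (underlying M)
    hom = record
      { func      = record { to = iter ; cong = iter-cong }
      ; preserves = λ where
          vr  → λ x → ≈-refl
          ap  → λ p q → ≈-refl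
          lm  → λ x p → ≈-refl
          pm  → _
          sw  → iter-sw
          sb  → _
          ren → _
          fv  → iter-fv
          fr  → _
      }

    unique : (f : ModelHom (Tr (signature Props₃)) (underlying M)) → f ≈ₕ hom
    unique f = iter-unique (ModelHom.fun f)
      (ModelHom.preserves f vr) (ModelHom.preserves f ap) (ModelHom.preserves f lm)

  module Initial₄ (M : PropsModel Props₄) where
    open PropsModel M using (satisfies)
    open Model (underlying M) using (carrier; vrᵒ; apᵒ; lmᵒ; swᵒ; fvᵒ)
    open Setoid carrier using () renaming (refl to ≈-refl)
    open Iteration carrier vrᵒ apᵒ lmᵒ

    core : SwapFree
    core = record
      { _[_∧_] = SwOp._[_∧_] swᵒ
      ; FV     = FvOp.FV fvᵒ
      ; sw-Vr  = satisfies ∈₀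
      ; sw-Ap  = satisfies ∈₁
      ; sw-Lm  = satisfies ∈₂
      ; sw-Fv  = satisfies ∈₃
      ; fv-Vr  = satisfies ∈₄
      ; fv-Ap  = satisfies ∈₅
      ; fv-Lm  = satisfies ∈₆
      }
    open SwapFree core

    hom : ModelHom (Tr (signature Props₄)) (underlying M)
    hom = record
      { func      = record { to = iter ; cong = iter-cong }
      ; preserves = λ where
          vr  → λ x → ≈-refl
          ap  → λ p q → ≈-refl
          lm  → λ x p → ≈-refl
          pm  → _
          sw  → iter-sw
          sb  → _
          ren → _
          fv  → iter-fv
          fr  → _
      }

    unique : (f : ModelHom (Tr (signature Props₄)) (underlying M)) → f ≈ₕ hom
    unique f = iter-unique (ModelHom.fun f)
      (ModelHom.preserves f vr) (ModelHom.preserves f ap) (ModelHom.preserves f lm)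

  module Initial₅ (M : PropsModel Props₅) where
    open PropsModel M using (satisfies)
    open Model (underlying M) using (carrier; vrᵒ; apᵒ; lmᵒ; swᵒ; frᵒ)
    open Setoid carrier using () renaming (refl to ≈-refl; sym to ≈-sym; trans to ≈-trans)
    open Iteration carrier vrᵒ apᵒ lmᵒ

    core : SwapFresh
    core = record
      { freshness = record
          { _#_ = FrOp._#_ frᵒ ; #-Vr = satisfies ∈₄ ; #-Ap = satisfies ∈₅ ; #-Lm = satisfies ∈₆ }
      ; _[_∧_]    = SwOp._[_∧_] swᵒ
      ; sw-Vr     = satisfies ∈₀
      ; sw-Ap     = satisfies ∈₁
      ; sw-Lm     = satisfies ∈₂
      ; sw-Cg     = λ m₁ m₂ x₁ x₂ z z≢x₁ z≢x₂ z#m₁ z#m₂ eq →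
          ≈-trans (satisfies ∈₃ m₁ x₁ z z≢x₁ z#m₁)
            (≈-trans (LmOp.Lm-cong lmᵒ eq) (≈-sym (satisfies ∈₃ m₂ x₂ z z≢x₂ z#m₂)))
      }
    open SwapFresh core

    hom : ModelHom (Tr (signature Props₅)) (underlying M)
    hom = record
      { func      = record { to = iter ; cong = iter-cong }
      ; preserves = λ where
          vr  → λ x → ≈-refl
          ap  → λ p q → ≈-refl
          lm  → λ x p → ≈-refl
          pm  → _
          sw  → iter-sw
          sb  → _
          ren → _
          fv  → _
          fr  → λ x p → iter-# p x ∘ freshInTerm⁻ p
      }

    unique : (f : ModelHom (Tr (signature Props₅)) (underlying M)) → f ≈ₕ hom
    unique f = iter-unique (ModelHom.fun f)
      (ModelHom.preserves f vr) (ModelHom.preserves f ap) (ModelHom.preserves f lm)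

  module Initial₆ (M : PropsModel Props₆) where
    open PropsModel M using (satisfies)
    open Model (underlying M) using (carrier; vrᵒ; apᵒ; lmᵒ; swᵒ; frᵒ)
    open Setoid carrier using () renaming (refl to ≈-refl)
    open Iteration carrier vrᵒ apᵒ lmᵒ

    core : SwapFresh
    core = record
      { freshness = record
          { _#_ = FrOp._#_ frᵒ ; #-Vr = satisfies ∈₄ ; #-Ap = satisfies ∈₅ ; #-Lm = satisfies ∈₆ }
      ; _[_∧_]    = SwOp._[_∧_] swᵒ
      ; sw-Vr     = satisfies ∈₀
      ; sw-Ap     = satisfies ∈₁
      ; sw-Lm     = satisfies ∈₂
      ; sw-Cg     = satisfies ∈₃
      }
    open SwapFresh core

    hom : ModelHom (Tr (signature Props₆)) (underlying M)
    hom = record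
      { func      = record { to = iter ; cong = iter-cong }
      ; preserves = λ where
          vr  → λ x → ≈-refl
          ap  → λ p q → ≈-refl
          lm  → λ x p → ≈-refl
          pm  → _
          sw  → iter-sw
          sb  → _
          ren → _
          fv  → _
          fr  → λ x p → iter-# p x ∘ freshInTerm⁻ p
      }

    unique : (f : ModelHom (Tr (signature Props₆)) (underlying M)) → f ≈ₕ hom
    unique f = iter-unique (ModelHom.fun f)
      (ModelHom.preserves f vr) (ModelHom.preserves f ap) (ModelHom.preserves f lm)

  module Initial₇ (M : PropsModel Props₇) where
    open PropsModel M using (satisfies)
    open Model (underlying M) using (carrier; vrᵒ; apᵒ; lmᵒ; sbᵒ; frᵒ)
    open Setoid carrier using () renaming (refl to ≈-refl)
    open Iteration carrier vrᵒ apᵒ lmᵒ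

    core : SubstFresh
    core = record
      { freshness = record
          { _#_ = FrOp._#_ frᵒ ; #-Vr = satisfies ∈₄ ; #-Ap = satisfies ∈₅ ; #-Lm = satisfies ∈₆ }
      ; _[_/_]    = SbOp._[_/_] sbᵒ
      ; sb-cong₂  = SbOp.sb-cong sbᵒ
      ; sb-Vr     = satisfies ∈₀
      ; sb-Ap     = satisfies ∈₁
      ; sb-Lm     = satisfies ∈₂
      ; sb-Bvr    = satisfies ∈₃
      }
    open SubstFresh core

    hom : ModelHom (Tr (signature Props₇)) (underlying M)
    hom = record
      { func      = record { to = iter ; cong = iter-cong }
      ; preserves = λ where
          vr  → λ x → ≈-refl
          ap  → λ p q → ≈-refl
          lm  → λ x p → ≈-refl
          pm  → _
          sw  → _
          sb  → iter-sb
          ren → _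
          fv  → _
          fr  → λ x p → iter-# p x ∘ freshInTerm⁻ p
      }

    unique : (f : ModelHom (Tr (signature Props₇)) (underlying M)) → f ≈ₕ hom
    unique f = iter-unique (ModelHom.fun f)
      (ModelHom.preserves f vr) (ModelHom.preserves f ap) (ModelHom.preserves f lm)

  module Initial₈ (M : PropsModel Props₈) where
    open PropsModel M using (satisfies)
    open Model (underlying M) using (carrier; vrᵒ; apᵒ; lmᵒ; renᵒ)
    open Setoid carrier using () renaming (refl to ≈-refl)
    open Iteration carrier vrᵒ apᵒ lmᵒ

    core : RenameOnly
    core = record
      { _[_/_]ʳ = RenOp._[_/_]ʳ renᵒ
      ; rn-cong = RenOp.ren-cong renᵒ
      ; rn-Vr   = satisfies ∈₀
      ; rn-Ap   = satisfies ∈₁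
      ; rn-Lm₁  = satisfies ∈₂
      ; rn-Lm₂  = satisfies ∈₃
      ; rn-Bvr₂ = satisfies ∈₄
      ; rn-Im   = satisfies ∈₆
      }
    open RenameOnly core

    hom : ModelHom (Tr (signature Props₈)) (underlying M)
    hom = record
      { func      = record { to = iter ; cong = iter-cong }
      ; preserves = λ where
          vr  → λ x → ≈-refl
          ap  → λ p q → ≈-refl
          lm  → λ x p → ≈-refl
          pm  → _
          sw  → _
          sb  → _
          ren → iter-rn
          fv  → _
          fr  → _
      }

    unique : (f : ModelHom (Tr (signature Props₈)) (underlying M)) → f ≈ₕ hom
    unique f = iter-unique (ModelHom.fun f)
      (ModelHom.preserves f vr) (ModelHom.preserves f ap) (ModelHom.preserves f lm)

  module Initial₉ (M : PropsModel Props₉) where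
    open PropsModel M using (satisfies)
    open Model (underlying M) using (carrier; vrᵒ; apᵒ; lmᵒ; renᵒ; frᵒ)
    open Setoid carrier using () renaming (refl to ≈-refl)
    open Iteration carrier vrᵒ apᵒ lmᵒ

    core : RenameFresh
    core = record
      { freshness = record
          { _#_ = FrOp._#_ frᵒ ; #-Vr = satisfies ∈₄ ; #-Ap = satisfies ∈₅ ; #-Lm = satisfies ∈₆ }
      ; _[_/_]ʳ   = RenOp._[_/_]ʳ renᵒ
      ; rn-cong   = RenOp.ren-cong renᵒ
      ; rn-Vr     = satisfies ∈₀
      ; rn-Ap     = satisfies ∈₁
      ; rn-Lm₁    = satisfies ∈₂
      ; rn-Bvr    = satisfies ∈₃
      }
    open RenameFresh core

    hom : ModelHom (Tr (signature Props₉)) (underlying M)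
    hom = record
      { func      = record { to = iter ; cong = iter-cong }
      ; preserves = λ where
          vr  → λ x → ≈-refl
          ap  → λ p q → ≈-refl
          lm  → λ x p → ≈-refl
          pm  → _
          sw  → _
          sb  → _
          ren → iter-rn
          fv  → _
          fr  → λ x p → iter-# p x ∘ freshInTerm⁻ p
      }

    unique : (f : ModelHom (Tr (signature Props₉)) (underlying M)) → f ≈ₕ hom
    unique f = iter-unique (ModelHom.fun f)
      (ModelHom.preserves f vr) (ModelHom.preserves f ap) (ModelHom.preserves f lm)

  Base : Category (lsuc 0ℓ) 0ℓ 0ℓ
  Base = Models Σctor

  Σctor-⊑ : ∀ {Σ} → T (Σ vr) → T (Σ ap) → T (Σ lm) → Σctor ⊑ Σ
  Σctor-⊑ v a l vr _ = v
  Σctor-⊑ v a l ap _ = a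
  Σctor-⊑ v a l lm _ = l

  recursor : ∀ Ps → Σctor ⊑ signature Ps → IsInitial (PropsModels Ps) (Tr-model Ps) →
             EpiRecursor Base (Tr Σctor) (lsuc 0ℓ) 0ℓ 0ℓ
  recursor Ps Σctor⊑ initial = record
    { C         = PropsModels Ps
    ; I         = Tr-model Ps
    ; I-initial = initial
    ; R         = forget Ps Σctor⊑
    ; R-I       = reduct-Tr Σctor⊑
    }

  -- Excluded middle renders the classical metatheory.  Initiality of the
  -- term models needs it for Props₁ and Props₃, where FV is defined through
  -- infinite sets.
  module Recursors (em : ExcludedMiddle 0ℓ) where

    r₁ r₂ r₃ r₄ r₅ r₆ r₇ r₈ r₉ : EpiRecursor Base (Tr Σctor) (lsuc 0ℓ) 0ℓ 0ℓ
    r₁ = recursor Props₁ (Σctor-⊑ tt tt tt) (record { ! = Initial₁.hom em ; !-unique = λ {M} → Initial₁.unique em M })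
    r₂ = recursor Props₂ (Σctor-⊑ tt tt tt) (record { ! = Initial₂.hom ; !-unique = λ {M} → Initial₂.unique M })
    r₃ = recursor Props₃ (Σctor-⊑ tt tt tt) (record { ! = Initial₃.hom em ; !-unique = λ {M} → Initial₃.unique em M })
    r₄ = recursor Props₄ (Σctor-⊑ tt tt tt) (record { ! = Initial₄.hom ; !-unique = λ {M} → Initial₄.unique M })
    r₅ = recursor Props₅ (Σctor-⊑ tt tt tt) (record { ! = Initial₅.hom ; !-unique = λ {M} → Initial₅.unique M })
    r₆ = recursor Props₆ (Σctor-⊑ tt tt tt) (record { ! = Initial₆.hom ; !-unique = λ {M} → Initial₆.unique M })
    r₇ = recursor Props₇ (Σctor-⊑ tt tt tt) (record { ! = Initial₇.hom ; !-unique = λ {M} → Initial₇.unique M })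
    r₈ = recursor Props₈ (Σctor-⊑ tt tt tt) (record { ! = Initial₈.hom ; !-unique = λ {M} → Initial₈.unique M })
    r₉ = recursor Props₉ (Σctor-⊑ tt tt tt) (record { ! = Initial₉.hom ; !-unique = λ {M} → Initial₉.unique M })

module Submission where

-- The constructor model of λ-terms has at most one morphism into any model X
-- of the constructors, namely iteration.  Definability by a recursor is
-- therefore a property of X alone: X has to be the constructor part of some
-- model of the recursor.  Hence r′ ≥ r as soon as every model of r can be
-- turned into a model of r′ without changing its carrier and constructors
-- (≥-from-models), and each comparison is a construction of models.
--
-- Most conversions only redefine operations.  SwCg follows from SwBvr by
-- applying it on both sides (r₆ ≥ r₅).  Freshness is non-freeness (r₅ ≥ r₄), or
-- invariance under all renamings (r₉ ≥ r₈), made Boolean by excluded middle;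
-- renaming is substitution of variables (r₉ ≥ r₇); swapping is permutation by
-- transpositions (r₄ ≥ r₂ and r₃ ≥ r₁).  For r₂ ≥ r₁, the definition of FV and
-- FCB give the inclusions for FV of the constructors and the invariance under
-- transpositions of non-free variables; a permutation whose support avoids the
-- free variables then acts trivially (pm-Fv), as one sees by splitting off a
-- transposition for one moved variable at a time.
--
-- The substantial case is r₁ ≥ r₃: a swapping operation that satisfies SwId,
-- SwIv and SwCp must be extended to all finitely supported permutations.  A
-- permutation is written as a product of transpositions, and the action must
-- not depend on the product chosen.  This is the completeness theorem for
-- words of transpositions (complete): two words that act equally on variables
-- act equally in every swapping structure.  By the three laws, every word w
-- equals one that first applies a word v not mentioning x and then a single
-- transposition of x with some y.  The image of x under w is then y, so y is
-- determined by the action of w on variables, and so is the action of v;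
-- induction on the finite set of variables involved finishes the proof.

open import Axiom.ExcludedMiddle using (ExcludedMiddle)
open import Data.List using (List; []; _∷_; _++_)
open import Data.List.Membership.Propositional using (_∈_)
open import Data.List.Relation.Unary.All as All using (All; []; _∷_)
import Data.List.Relation.Unary.All.Properties as Allₚ
open import Data.List.Relation.Unary.Any using (here; there)
open import Data.Nat using (ℕ)
open import Data.Product using (Σ-syntax; _×_; _,_; proj₁; proj₂)
open import Data.Sum using (inj₁; inj₂)
open import Function using (_↔_; _∘_; _$_; mk⇔)
open import Level using (0ℓ)
open import Relation.Binary using (Setoid)
open import Relation.Binary.PropositionalEquality
  using (_≡_; _≢_; refl; sym; trans; cong; subst; subst₂; setoid)
import Relation.Binary.Reasoning.Setoid as SetoidReasoning
open import Relation.Nullary using (¬_; yes; no; contradiction)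
open import Relation.Nullary.Decidable using (isYes; isYes≗does; does-⇔; toWitness; fromWitness)
import Relation.Unary as Pred
open import Relation.Unary using (Pred)
open import Defs

module _ (Var : Set) (enum : Var ↔ ℕ) where

  open Nominal Var enum
  open PropsModel using (underlying; satisfies)

  -- Definability depends on constructor models only

  ctor-hom-unique : ∀ {X : Model Σctor} (f g : ModelHom (Tr Σctor) X) → f ≈ₕ g
  ctor-hom-unique {X} f g p = Setoid.trans carrier (iterates f p) (Setoid.sym carrier (iterates g p))
    where
    open Model X using (carrier; vrᵒ; apᵒ; lmᵒ)
    open Iteration carrier vrᵒ apᵒ lmᵒ
    iterates : ∀ (h : ModelHom (Tr Σctor) X) p → Setoid._≈_ carrier (ModelHom.fun h p) (iter p)
    iterates h = iter-unique (ModelHom.fun h)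
      (ModelHom.preserves h vr) (ModelHom.preserves h ap) (ModelHom.preserves h lm)

  -- The conversion has to keep the constructor model up to propositional
  -- equality, because definability compares codomains in that way.
  ≥-from-models : ∀ {o ℓ e o′ ℓ′ e′} (r′ : EpiRecursor Base (Tr Σctor) o′ ℓ′ e′)
    (r : EpiRecursor Base (Tr Σctor) o ℓ e) →
    (∀ C → Σ[ C′ ∈ EpiRecursor.Extended r′ ] EpiRecursor.F₀ r′ C′ ≡ EpiRecursor.F₀ r C) → r′ ≥ r
  ≥-from-models r′ r convert g (C , RC≡X , _) =
    -- All morphisms from terms to X coincide, so any model over X defines g.
    let C′ , RC′≡RC = convert C
        RC′≡X = trans RC′≡RC RC≡X
    in C′ , RC′≡X ,
       ctor-hom-unique g (subst₂ ModelHom (EpiRecursor.R-I r′) RC′≡X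
         (EpiRecursor.F₁ r′ (EpiRecursor.! r′ C′)))

  -- Freshness and freeness

  -- A freshness predicate on a model, as a Boolean-valued operation.
  freshOp : ExcludedMiddle 0ℓ → ∀ {A} (_#_ : Var → Setoid.Carrier A → Set) →
            (∀ {x m m′} → Setoid._≈_ A m m′ → x # m → x # m′) → FrOp A
  freshOp em {A} _#_ #-cong = record
    { isFresh = λ x m → isYes (em {x # m})
    ; fr-cong = λ m≈m′ → trans (isYes≗does em)
        (trans (does-⇔ (mk⇔ (#-cong m≈m′) (#-cong (Setoid.sym A m≈m′))) em em) (sym (isYes≗does em)))
    }

  module _ {A vrOp apOp lmOp} (S : Iteration.SwapFree A vrOp apOp lmOp) where
    open Setoid A using (_≈_) renaming (refl to ≈-refl; sym to ≈-sym; trans to ≈-trans)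
    open LmOp lmOp
    open Iteration.SwapFree S

    -- Neither variable is free in the abstraction, so swapping them fixes it.
    sw-Bvr : ∀ m x x′ → ¬ FV m x′ → Lm x m ≈ Lm x′ (m [ x′ ∧ x ])
    sw-Bvr m x x′ x′∉ = ≈-trans
      (≈-sym (sw-Fv (Lm x m) x′ x (x′∉ ∘ proj₁ ∘ fv-Lm x m) (λ x∈ → proj₂ (fv-Lm x m x∈) refl)))
      (≈-trans (sw-Lm x m x′ x)
        (subst (λ v → Lm v (m [ x′ ∧ x ]) ≈ Lm x′ (m [ x′ ∧ x ])) (sym (swap-r x′ x)) ≈-refl))

  -- Splitting a transposition off a permutation

  -- The part of σ that remains when σ is written as a permutation fixing x
  -- followed by the transposition of x and σ · x.
  strip : Var → Perm → Perm
  strip x σ = (x ↔ₚ (σ · x)) ∘ₚ σ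

  strip-fixed : ∀ x σ {z} → σ · z ≡ z → strip x σ · z ≡ z
  strip-fixed x σ {z} σz≡z with z ≟ x
  ... | yes refl = swap-r z (σ · z)
  ... | no z≢x = trans (cong (swap x (σ · x)) σz≡z) (swap-o z≢x z≢σx)
    where
    z≢σx : z ≢ σ · x
    z≢σx z≡σx = z≢x (·-injective σ (trans σz≡z z≡σx))

  strip-supp : ∀ {x xs} σ → (∀ {z} → σ · z ≢ z → z ∈ x ∷ xs) → ∀ {z} → strip x σ · z ≢ z → z ∈ xs
  strip-supp {x} σ supp⊆ moved with supp⊆ (moved ∘ strip-fixed x σ)
  ... | here refl = contradiction (swap-r x (σ · x)) moved
  ... | there z∈ = z∈

  module _ {A vrOp apOp lmOp} (S : Iteration.SwapFree A vrOp apOp lmOp) (pmOp : PmOp A) where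
    open Setoid A using (_≈_) renaming (refl to ≈-refl; sym to ≈-sym; trans to ≈-trans)
    open Iteration.SwapFree S
    open PmOp pmOp

    -- Induction on a list of variables that includes the moved ones; at a moved x,
    -- σ is stripped of the transposition of x and σ · x.  Both are moved, so
    -- neither is free.
    pm-Fv : (∀ m → m [ idₚ ]ᵖ ≈ m) → (∀ m σ τ → m [ σ ]ᵖ [ τ ]ᵖ ≈ m [ τ ∘ₚ σ ]ᵖ) →
            (∀ m x y → m [ x ↔ₚ y ]ᵖ ≈ m [ x ∧ y ]) →
            ∀ m σ → Pred.Empty (supp σ Pred.∩ FV m) → m [ σ ]ᵖ ≈ m
    pm-Fv pm-Id pm-Cp pm-sw m σ = go (proj₁ (Perm.finite σ)) σ (proj₂ (Perm.finite σ))
      where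
      go : ∀ xs σ → (∀ {z} → σ · z ≢ z → z ∈ xs) → Pred.Empty (supp σ Pred.∩ FV m) → m [ σ ]ᵖ ≈ m
      go [] σ supp⊆ _ = ≈-trans (pm-cong ≈-refl fixed) (pm-Id m)
        where
        fixed : ∀ z → σ · z ≡ z
        fixed z with σ · z ≟ z
        ... | yes eq = eq
        ... | no moved with () ← supp⊆ moved
      go (x ∷ xs) σ supp⊆ disjoint with σ · x ≟ x
      ... | yes σx≡x = go xs σ (λ moved → drop moved (supp⊆ moved)) disjoint
        where
        drop : ∀ {z} → σ · z ≢ z → z ∈ x ∷ xs → z ∈ xs
        drop moved (here refl) = contradiction σx≡x moved
        drop moved (there z∈)  = z∈
      ... | no σx≢x =
        ≈-trans (pm-cong ≈-refl (λ z → sym (swap-invol x (σ · x) (σ · z))))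
          (≈-trans (≈-sym (pm-Cp m (strip x σ) (x ↔ₚ (σ · x))))
            (≈-trans (pm-cong (go xs (strip x σ) (strip-supp σ supp⊆)
                       (λ z (moved , z∈) → disjoint z (moved ∘ strip-fixed x σ , z∈))) (λ _ → refl))
              (≈-trans (pm-sw m x (σ · x))
                (sw-Fv m x (σ · x) (λ x∈ → disjoint x (σx≢x , x∈))
                  (λ σx∈ → disjoint (σ · x) (σx≢x ∘ ·-injective σ , σx∈))))))

  -- Words of transpositions

  -- A set with an action of transpositions, subject to SwId, SwIv and SwCp.
  record SwapAction (A : Setoid 0ℓ 0ℓ) : Set where
    open Setoid A using (_≈_) renaming (Carrier to M; refl to ≈-refl; sym to ≈-sym; trans to ≈-trans)
    infixl 8 _[_∧_]
    field
      _[_∧_]  : M → Var → Var → M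
      sw-cong : ∀ {m m′ x y} → m ≈ m′ → m [ x ∧ y ] ≈ m′ [ x ∧ y ]
      sw-Id   : ∀ m z → m [ z ∧ z ] ≈ m
      sw-Iv   : ∀ m x y → m [ x ∧ y ] [ x ∧ y ] ≈ m
      sw-Cp   : ∀ m x y z₁ z₂ →
                m [ x ∧ y ] [ z₁ ∧ z₂ ] ≈ m [ z₁ ∧ z₂ ] [ swap z₁ z₂ x ∧ swap z₁ z₂ y ]

    ≈-sw : ∀ m {x x′ y y′} → x ≡ x′ → y ≡ y′ → m [ x ∧ y ] ≈ m [ x′ ∧ y′ ]
    ≈-sw m refl refl = ≈-refl

    sw-sym : ∀ m x y → m [ x ∧ y ] ≈ m [ y ∧ x ]
    sw-sym m x y = ≈-trans (≈-sym (sw-Iv _ x y))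
      (≈-trans (sw-Cp (m [ x ∧ y ]) x y x y)
        (≈-trans (sw-cong (sw-Iv m x y)) (≈-sw m (swap-l x y) (swap-r x y))))

  -- The last letter of the list is the transposition applied first.
  Word : Set
  Word = List (Var × Var)

  module _ {A : Setoid 0ℓ 0ℓ} (S : SwapAction A) where
    open Setoid A using (_≈_) renaming (Carrier to M; refl to ≈-refl)
    open SwapAction S

    act : Word → M → M
    act []            m = m
    act ((a , b) ∷ w) m = act w m [ a ∧ b ]

    act-cong : ∀ w {m m′} → m ≈ m′ → act w m ≈ act w m′
    act-cong []      m≈m′ = m≈m′
    act-cong (_ ∷ w) m≈m′ = sw-cong (act-cong w m≈m′)

    act-++ : ∀ w w′ m → act (w ++ w′) m ≡ act w (act w′ m)
    act-++ []            w′ m = refl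
    act-++ ((a , b) ∷ w) w′ m = cong (_[ a ∧ b ]) (act-++ w w′ m)

  varAction : SwapAction (setoid Var)
  varAction = record
    { _[_∧_]  = λ z x y → swap x y z
    ; sw-cong = λ {_} {_} {x} {y} → cong (swap x y)
    ; sw-Id   = swap-id
    ; sw-Iv   = λ z x y → swap-invol x y z
    ; sw-Cp   = λ z x y z₁ z₂ → sym (swap-equivariant (z₁ ↔ₚ z₂) x y z)
    }
    where
    swap-id : ∀ x z → swap z z x ≡ x
    swap-id x z with x ≟ z
    ... | yes x≡z = sym x≡z
    ... | no _ = refl

  -- The permutation of variables that a word denotes.
  actᵛ : Word → Var → Var
  actᵛ = act varAction

  -- Words that act equally in every swapping structure.
  infix 4 _≋_
  record _≋_ (w w′ : Word) : Set₁ where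
    constructor equally
    field
      acts : ∀ {A} (S : SwapAction A) m → Setoid._≈_ A (act S w m) (act S w′ m)
  open _≋_

  ≋-sym : ∀ {w w′} → w ≋ w′ → w′ ≋ w
  ≋-sym w≋w′ = equally λ {A} S m → Setoid.sym A (acts w≋w′ S m)

  ≋-trans : ∀ {w w′ w″} → w ≋ w′ → w′ ≋ w″ → w ≋ w″
  ≋-trans w≋w′ w′≋w″ = equally λ {A} S m → Setoid.trans A (acts w≋w′ S m) (acts w′≋w″ S m)

  ≋-∷ : ∀ {w w′} l → w ≋ w′ → l ∷ w ≋ l ∷ w′
  ≋-∷ l w≋w′ = equally λ S m → SwapAction.sw-cong S (acts w≋w′ S m)

  -- All variables of the word satisfy P.
  Over : Pred Var 0ℓ → Word → Set
  Over P = All (λ (a , b) → P a × P b)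

  _without_ : Pred Var 0ℓ → Var → Pred Var 0ℓ
  (P without x) z = P z × z ≢ x

  act-avoids : ∀ {P} x w → Over (P without x) w → actᵛ w x ≡ x
  act-avoids x []            _ = refl
  act-avoids x ((a , b) ∷ w) (((_ , a≢x) , (_ , b≢x)) ∷ over) =
    trans (cong (swap a b) (act-avoids x w over)) (swap-o (a≢x ∘ sym) (b≢x ∘ sym))

  -- A normal form of w, for w over P: x occurs in the letter applied last only.
  -- That letter is trivial when its other variable is x too.
  record Normal (P : Pred Var 0ℓ) (x : Var) (w : Word) : Set₁ where
    constructor normal
    field
      {target} : Var
      {rest}   : Word
      target∈  : P target
      over     : Over (P without x) rest
      equal    : w ≋ (x , target) ∷ rest

  module _ {P : Pred Var 0ℓ} {x : Var} (x∈ : P x) where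

    -- Two transpositions of x in a row: unless they share their other variable
    -- or one is trivial, they equal [b ∧ y] followed by [x ∧ y].
    turn : ∀ {y b v} → P y → P b → Over (P without x) v → b ≢ x →
           Normal P x ((x , b) ∷ (x , y) ∷ v)
    turn {y} {b} {v} y∈ b∈ over b≢x with y ≟ x | y ≟ b
    ... | yes refl | _ = normal b∈ over $ equally λ S m → SwapAction.sw-cong S (SwapAction.sw-Id S (act S v m) x)
    ... | no _ | yes refl = normal x∈ over $ equally λ {A} S m → Setoid.trans A
      (SwapAction.sw-Iv S (act S v m) x y) (Setoid.sym A (SwapAction.sw-Id S (act S v m) x))
    ... | no y≢x | no y≢b = normal y∈ (((b∈ , b≢x) , (y∈ , y≢x)) ∷ over) $ equally λ {A} S m →
      let open SwapAction S
          open SetoidReasoning A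
          n = act S v m
      in begin
        n [ x ∧ y ] [ x ∧ b ]                    ≈⟨ sw-sym _ x b ⟩
        n [ x ∧ y ] [ b ∧ x ]                    ≈⟨ ≈-sw _ (swap-o b≢x (y≢b ∘ sym)) (swap-r x y) ⟨
        n [ x ∧ y ] [ swap x y b ∧ swap x y y ]  ≈⟨ sw-Cp n b y x y ⟨
        n [ b ∧ y ] [ x ∧ y ]                    ∎

    swap-∈ : ∀ {a b y} → P a → P b → P y → P (swap a b y)
    swap-∈ {a} {b} {y} a∈ b∈ y∈ with y ≟ a
    ... | yes _ = b∈
    ... | no _ with y ≟ b
    ...   | yes _ = a∈
    ...   | no _  = y∈

    -- A letter applied after a transposition of x moves inside it, by SwCp when
    -- the letter does not mention x and by turn when it does.
    absorb : ∀ {a b y v} → P a → P b → P y → Over (P without x) v →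
             Normal P x ((a , b) ∷ (x , y) ∷ v)
    absorb {a} {b} {y} {v} a∈ b∈ y∈ over with a ≟ x | b ≟ x
    ... | yes refl | yes refl = normal y∈ over $ equally λ S m → SwapAction.sw-Id S _ x
    ... | yes refl | no b≢x = turn y∈ b∈ over b≢x
    ... | no a≢x | yes refl =
      let normal y′∈ over′ eq = turn y∈ a∈ over a≢x
      in normal y′∈ over′ (≋-trans (equally λ S m → SwapAction.sw-sym S _ a x) eq)
    ... | no a≢x | no b≢x =
      normal (swap-∈ a∈ b∈ y∈) (((a∈ , a≢x) , (b∈ , b≢x)) ∷ over) $ equally λ {A} S m →
        let open SwapAction S in
        Setoid.trans A (sw-Cp (act S v m) x y a b) (≈-sw _ (swap-o (a≢x ∘ sym) (b≢x ∘ sym)) refl)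

    normalise : ∀ w → Over P w → Normal P x w
    normalise [] [] = normal x∈ [] $ equally λ {A} S m → Setoid.sym A (SwapAction.sw-Id S m x)
    normalise ((a , b) ∷ w) ((a∈ , b∈) ∷ over) =
      let normal y∈ over′ eq = normalise w over
          normal y′∈ over″ eq′ = absorb a∈ b∈ y∈ over′
      in normal y′∈ over″ (≋-trans (≋-∷ (a , b) eq) eq′)

  -- The target, and the action of the rest on variables, are determined by the
  -- permutation that w denotes.
  target-image : ∀ {P x w} (N : Normal P x w) → Normal.target N ≡ actᵛ w x
  target-image {x = x} {w} (normal {y} {v} _ over eq) = sym (trans (acts eq varAction x)
    (trans (cong (swap x y) (act-avoids x v over)) (swap-l x y)))

  rest-image : ∀ {P x w} (N : Normal P x w) → ∀ z →
               actᵛ (Normal.rest N) z ≡ swap x (Normal.target N) (actᵛ w z)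
  rest-image {x = x} (normal {y} {v} _ _ eq) z =
    trans (sym (swap-invol x y (actᵛ v z))) (cong (swap x y) (sym (acts eq varAction z)))

  complete-over : ∀ xs w w′ → Over (_∈ xs) w → Over (_∈ xs) w′ →
                  (∀ z → actᵛ w z ≡ actᵛ w′ z) → w ≋ w′
  complete-over [] [] [] [] [] _ = equally λ {A} S m → Setoid.refl A
  complete-over (x ∷ xs) w w′ over over′ same =
    ≋-trans (equal N) (≋-trans (≋-∷ _ rest≋) (≋-trans target≋ (≋-sym (equal N′))))
    where
    open Normal using (target; rest; equal)
    N : Normal (_∈ x ∷ xs) x w
    N = normalise (here refl) w over
    N′ : Normal (_∈ x ∷ xs) x w′
    N′ = normalise (here refl) w′ over′
    targets : target N ≡ target N′
    targets = trans (target-image N) (trans (same x) (sym (target-image N′)))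
    shrink : ∀ {v} → Over ((_∈ x ∷ xs) without x) v → Over (_∈ xs) v
    shrink = All.map λ (a∈ , b∈) → tail a∈ , tail b∈
      where
      tail : ∀ {z} → ((_∈ x ∷ xs) without x) z → z ∈ xs
      tail (here z≡x , z≢x) = contradiction z≡x z≢x
      tail (there z∈ , _)   = z∈
    rest≋ : rest N ≋ rest N′
    rest≋ = complete-over xs (rest N) (rest N′) (shrink (Normal.over N)) (shrink (Normal.over N′)) λ z →
      trans (rest-image N z) (trans (cong (swap x (target N)) (same z))
        (trans (cong (λ y → swap x y (actᵛ w′ z)) targets) (sym (rest-image N′ z))))
    target≋ : (x , target N) ∷ rest N′ ≋ (x , target N′) ∷ rest N′
    target≋ = equally λ S m → SwapAction.≈-sw S _ refl targets

  letters : Word → List Var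
  letters []            = []
  letters ((a , b) ∷ w) = a ∷ b ∷ letters w

  over-letters : ∀ w → Over (_∈ letters w) w
  over-letters []      = []
  over-letters (_ ∷ w) = (here refl , there (here refl)) ∷
    All.map (λ (a∈ , b∈) → there (there a∈) , there (there b∈)) (over-letters w)

  complete : ∀ w w′ → (∀ z → actᵛ w z ≡ actᵛ w′ z) → w ≋ w′
  complete w w′ =
    let over = over-letters (w ++ w′)
    in complete-over (letters (w ++ w′)) w w′ (Allₚ.++⁻ˡ w over) (Allₚ.++⁻ʳ w over)

  -- Permutations as words

  -- A word for σ, when xs lists all variables that σ moves.
  decompose : List Var → Perm → Word
  decompose []       σ = []
  decompose (x ∷ xs) σ = (x , σ · x) ∷ decompose xs (strip x σ)

  decompose-correct : ∀ xs σ → (∀ {z} → σ · z ≢ z → z ∈ xs) → ∀ z → actᵛ (decompose xs σ) z ≡ σ · z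
  decompose-correct [] σ supp⊆ z with σ · z ≟ z
  ... | yes eq = sym eq
  ... | no moved with () ← supp⊆ moved
  decompose-correct (x ∷ xs) σ supp⊆ z = trans
    (cong (swap x (σ · x)) (decompose-correct xs (strip x σ) (strip-supp σ supp⊆) z))
    (swap-invol x (σ · x) (σ · z))

  word : Perm → Word
  word σ = decompose (proj₁ (Perm.finite σ)) σ

  word-correct : ∀ σ z → actᵛ (word σ) z ≡ σ · z
  word-correct σ = decompose-correct (proj₁ (Perm.finite σ)) σ (proj₂ (Perm.finite σ))

  -- Permutations act through their words; the words that they come with are
  -- immaterial by completeness.
  module PermAction {A : Setoid 0ℓ 0ℓ} (S : SwapAction A) where
    open Setoid A using (_≈_) renaming (refl to ≈-refl; trans to ≈-trans)
    open SwapAction S using (_[_∧_])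

    permOp : PmOp A
    permOp = record
      { _[_]ᵖ   = λ m σ → act S (word σ) m
      ; pm-cong = λ {_} {m′} {σ} {τ} m≈m′ σ≈τ → ≈-trans (act-cong S (word σ) m≈m′)
          (acts (complete (word σ) (word τ)
            (λ z → trans (word-correct σ z) (trans (σ≈τ z) (sym (word-correct τ z))))) S m′)
      }
    open PmOp permOp

    pm-Id : ∀ m → m [ idₚ ]ᵖ ≈ m
    pm-Id m = ≈-refl

    pm-Cp : ∀ m σ τ → m [ σ ]ᵖ [ τ ]ᵖ ≈ m [ τ ∘ₚ σ ]ᵖ
    pm-Cp m σ τ = subst (_≈ m [ τ ∘ₚ σ ]ᵖ) (act-++ S (word τ) (word σ) m)
      (acts (complete (word τ ++ word σ) (word (τ ∘ₚ σ)) same) S m)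
      where
      same : ∀ z → actᵛ (word τ ++ word σ) z ≡ actᵛ (word (τ ∘ₚ σ)) z
      same z = trans (act-++ varAction (word τ) (word σ) z)
        (trans (word-correct τ _) (trans (cong (τ ·_) (word-correct σ z))
          (sym (word-correct (τ ∘ₚ σ) z))))

    pm-sw : ∀ m x y → m [ x ↔ₚ y ]ᵖ ≈ m [ x ∧ y ]
    pm-sw m x y = acts (complete (word (x ↔ₚ y)) ((x , y) ∷ []) (word-correct (x ↔ₚ y))) S m

  module PermModel {A vrOp apOp lmOp} (D : Iteration.SwapDefinedFree A vrOp apOp lmOp) where
    open Setoid A using (_≈_) renaming (refl to ≈-refl; sym to ≈-sym; trans to ≈-trans)
    open VrOp vrOp
    open ApOp apOp
    open LmOp lmOp
    open Iteration.SwapDefinedFree D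

    swapAction : SwapAction A
    swapAction = record
      { _[_∧_] = _[_∧_] ; sw-cong = sw-cong ; sw-Id = sw-Id ; sw-Iv = sw-Iv ; sw-Cp = sw-Cp }

    act-Vr : ∀ w x → act swapAction w (Vr x) ≈ Vr (actᵛ w x)
    act-Vr []            x = ≈-refl
    act-Vr ((a , b) ∷ w) x = ≈-trans (sw-cong (act-Vr w x)) (sw-Vr _ a b)

    act-Ap : ∀ w m n → act swapAction w (Ap m n) ≈ Ap (act swapAction w m) (act swapAction w n)
    act-Ap []            m n = ≈-refl
    act-Ap ((a , b) ∷ w) m n = ≈-trans (sw-cong (act-Ap w m n)) (sw-Ap _ _ a b)

    act-Lm : ∀ w x m → act swapAction w (Lm x m) ≈ Lm (actᵛ w x) (act swapAction w m)
    act-Lm []            x m = ≈-refl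
    act-Lm ((a , b) ∷ w) x m = ≈-trans (sw-cong (act-Lm w x m)) (sw-Lm _ _ a b)

    open PermAction swapAction public
    open PmOp permOp

    pm-Vr : ∀ x σ → Vr x [ σ ]ᵖ ≈ Vr (σ · x)
    pm-Vr x σ = subst (λ v → Vr x [ σ ]ᵖ ≈ Vr v) (word-correct σ x) (act-Vr (word σ) x)

    pm-Lm : ∀ x m σ → Lm x m [ σ ]ᵖ ≈ Lm (σ · x) (m [ σ ]ᵖ)
    pm-Lm x m σ = subst (λ v → Lm x m [ σ ]ᵖ ≈ Lm v (m [ σ ]ᵖ)) (word-correct σ x) (act-Lm (word σ) x m)

    -- Transpositions act as the given swapping, so FV need not be changed.
    fv-DPm : ∀ m → FV m Pred.≐ (λ x → Infinite (λ y → ¬ (m [ x ↔ₚ y ]ᵖ ≈ m)))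
    fv-DPm m =
        (λ {x} x∈ (ys , covers) → proj₁ (fv-D m) x∈
          (ys , λ {y} moved → covers (moved ∘ ≈-trans (≈-sym (pm-sw m x y)))))
      , (λ {x} infinite → proj₂ (fv-D m) λ (ys , covers) →
          infinite (ys , λ {y} moved → covers (moved ∘ ≈-trans (pm-sw m x y))))

  -- Conversions between models

  5→6 : PropsModel Props₅ → PropsModel Props₆
  5→6 M = record
    { underlying = record
        { carrier = carrier ; vrᵒ = vrᵒ ; apᵒ = apᵒ ; lmᵒ = lmᵒ ; swᵒ = swᵒ ; frᵒ = frᵒ }
    ; satisfies  = λ where
        (here refl) → sw-Vr
        (there (here refl)) → sw-Ap
        (there (there (here refl))) → sw-Lm
        (there (there (there (here refl)))) → sw-Cg
        (there (there (there (there (here refl))))) → #-Vr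
        (there (there (there (there (there (here refl)))))) → #-Ap
        (there (there (there (there (there (there (here refl))))))) → #-Lm
    }
    where
    open Model (underlying M)
    open Iteration.SwapFresh (Initial₅.core M)

  2→4 : PropsModel Props₂ → PropsModel Props₄
  2→4 M = record
    { underlying = record
        { carrier = carrier ; vrᵒ = vrᵒ ; apᵒ = apᵒ ; lmᵒ = lmᵒ ; fvᵒ = fvᵒ
        ; swᵒ = record { _[_∧_] = _[_∧_] ; sw-cong = λ m≈m′ → PmOp.pm-cong pmᵒ m≈m′ (λ _ → refl) } }
    ; satisfies  = λ where
        (here refl) → sw-Vr
        (there (here refl)) → sw-Ap
        (there (there (here refl))) → sw-Lm
        (there (there (there (here refl)))) → sw-Fv
        (there (there (there (there (here refl))))) → fv-Vr
        (there (there (there (there (there (here refl)))))) → fv-Ap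
        (there (there (there (there (there (there (here refl))))))) → fv-Lm
    }
    where
    open Model (underlying M)
    open Iteration.SwapFree (Initial₂.core M)

  7→9 : PropsModel Props₇ → PropsModel Props₉
  7→9 M = record
    { underlying = record
        { carrier = carrier ; vrᵒ = vrᵒ ; apᵒ = apᵒ ; lmᵒ = lmᵒ ; frᵒ = frᵒ
        ; renᵒ = record { _[_/_]ʳ = _[_/_]ʳ ; ren-cong = rn-cong } }
    ; satisfies  = λ where
        (here refl) → rn-Vr
        (there (here refl)) → rn-Ap
        (there (there (here refl))) → rn-Lm₁
        (there (there (there (here refl)))) → rn-Bvr
        (there (there (there (there (here refl))))) → #-Vr
        (there (there (there (there (there (here refl)))))) → #-Ap
        (there (there (there (there (there (there (here refl))))))) → #-Lm
    }
    where
    open Model (underlying M)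
    open Iteration.RenameFresh (Iteration.SubstFresh.renameFresh (Initial₇.core M))

  module _ (em : ExcludedMiddle 0ℓ) where

    4→5 : PropsModel Props₄ → PropsModel Props₅
    4→5 M = record
      { underlying = record
          { carrier = carrier ; vrᵒ = vrᵒ ; apᵒ = apᵒ ; lmᵒ = lmᵒ ; swᵒ = swᵒ
          ; frᵒ = freshOp em _#_ λ m≈m′ x∉ → x∉ ∘ FvOp.FV-cong fvᵒ (Setoid.sym carrier m≈m′) }
      ; satisfies  = λ where
          (here refl) → sw-Vr
          (there (here refl)) → sw-Ap
          (there (there (here refl))) → sw-Lm
          (there (there (there (here refl)))) →
            λ m x x′ _ x′#m → sw-Bvr (Initial₄.core M) m x x′ (toWitness x′#m)
          (there (there (there (there (here refl))))) →
            λ x z z≢x → fromWitness (#-Vr x z z≢x)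
          (there (there (there (there (there (here refl)))))) →
            λ m n z z#m z#n → fromWitness (#-Ap m n z (toWitness z#m) (toWitness z#n))
          (there (there (there (there (there (there (here refl))))))) → λ where
            x m z (inj₁ z≡x) → fromWitness (#-Lm x m z (inj₁ z≡x))
            x m z (inj₂ z#m) → fromWitness (#-Lm x m z (inj₂ (toWitness z#m)))
      }
      where
      open Model (underlying M)
      open Iteration.SwapFree (Initial₄.core M)
      open Iteration.SwapFresh swapFresh using (_#_; #-Vr; #-Ap; #-Lm)

    1→2 : PropsModel Props₁ → PropsModel Props₂
    1→2 M = record
      { underlying = record
          { carrier = carrier ; vrᵒ = vrᵒ ; apᵒ = apᵒ ; lmᵒ = lmᵒ ; pmᵒ = pmᵒ ; fvᵒ = fvᵒ }
      ; satisfies  = λ where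
          (here refl) → satisfies M (here refl)
          (there (here refl)) → satisfies M (there (here refl))
          (there (there (here refl))) → satisfies M (there (there (here refl)))
          (there (there (there (here refl)))) → pm-Id
          (there (there (there (there (here refl))))) → pm-Cp
          (there (there (there (there (there (here refl)))))) →
            pm-Fv core pmᵒ pm-Id pm-Cp (λ m x y → Setoid.refl carrier)
          (there (there (there (there (there (there (here refl))))))) → fv-Vr
          (there (there (there (there (there (there (there (here refl)))))))) → fv-Ap
          (there (there (there (there (there (there (there (there (here refl))))))))) → fv-Lm
      }
      where
      open Model (underlying M)
      open Setoid carrier using (_≈_)
      open PmOp pmᵒ using (_[_]ᵖ)
      core : Iteration.SwapFree carrier vrᵒ apᵒ lmᵒ
      core = Iteration.SwapDefinedFree.swapFree (Initial₁.core em M) em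
      open Iteration.SwapFree core
      pm-Id : ∀ m → m [ idₚ ]ᵖ ≈ m
      pm-Id = satisfies M (there (there (there (here refl))))
      pm-Cp : ∀ m σ τ → m [ σ ]ᵖ [ τ ]ᵖ ≈ m [ τ ∘ₚ σ ]ᵖ
      pm-Cp = satisfies M (there (there (there (there (here refl)))))

    1→3 : PropsModel Props₁ → PropsModel Props₃
    1→3 M = record
      { underlying = record
          { carrier = carrier ; vrᵒ = vrᵒ ; apᵒ = apᵒ ; lmᵒ = lmᵒ ; fvᵒ = fvᵒ
          ; swᵒ = record { _[_∧_] = _[_∧_] ; sw-cong = sw-cong } }
      ; satisfies  = λ where
          (here refl) → sw-Vr
          (there (here refl)) → sw-Ap
          (there (there (here refl))) → sw-Lm
          (there (there (there (here refl)))) → sw-Id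
          (there (there (there (there (here refl))))) → sw-Iv
          (there (there (there (there (there (here refl)))))) → sw-Cp
          (there (there (there (there (there (there (here refl))))))) → fv-D
          (there (there (there (there (there (there (there (here refl)))))))) → fcb
      }
      where
      open Model (underlying M)
      open Iteration.SwapDefinedFree (Initial₁.core em M)

    3→1 : PropsModel Props₃ → PropsModel Props₁
    3→1 M = record
      { underlying = record
          { carrier = carrier ; vrᵒ = vrᵒ ; apᵒ = apᵒ ; lmᵒ = lmᵒ ; fvᵒ = fvᵒ ; pmᵒ = permOp }
      ; satisfies  = λ where
          (here refl) → pm-Vr
          (there (here refl)) → λ m n σ → act-Ap (word σ) m n
          (there (there (here refl))) → pm-Lm
          (there (there (there (here refl)))) → pm-Id
          (there (there (there (there (here refl))))) → pm-Cp
          (there (there (there (there (there (here refl)))))) → fv-DPm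
          (there (there (there (there (there (there (here refl))))))) → fcb
      }
      where
      open Model (underlying M)
      core : Iteration.SwapDefinedFree carrier vrᵒ apᵒ lmᵒ
      core = Initial₃.core em M
      open Iteration.SwapDefinedFree core using (fcb)
      open PermModel core

    8→9 : PropsModel Props₈ → PropsModel Props₉
    8→9 M = record
      { underlying = record
          { carrier = carrier ; vrᵒ = vrᵒ ; apᵒ = apᵒ ; lmᵒ = lmᵒ ; renᵒ = renᵒ
          ; frᵒ = freshOp em _#_ λ m≈m′ x#m y →
              ≈-trans (ren-cong (≈-sym m≈m′)) (≈-trans (x#m y) m≈m′) }
      ; satisfies  = λ where
          (here refl) → rn-Vr
          (there (here refl)) → rn-Ap
          (there (there (here refl))) → rn-Lm₁
          (there (there (there (here refl)))) →
            λ m x x′ x′≢x x′#m → rn-Bvr m x x′ x′≢x (toWitness x′#m)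
          (there (there (there (there (here refl))))) →
            λ x z z≢x → fromWitness (#-Vr x z z≢x)
          (there (there (there (there (there (here refl)))))) →
            λ m n z z#m z#n → fromWitness (#-Ap m n z (toWitness z#m) (toWitness z#n))
          (there (there (there (there (there (there (here refl))))))) → λ where
            x m z (inj₁ z≡x) → fromWitness (#-Lm x m z (inj₁ z≡x))
            x m z (inj₂ z#m) → fromWitness (#-Lm x m z (inj₂ (toWitness z#m)))
      }
      where
      open Model (underlying M)
      open Setoid carrier using () renaming (sym to ≈-sym; trans to ≈-trans)
      open RenOp renᵒ using (ren-cong)
      open Iteration.RenameFresh (Iteration.RenameOnly.renameFresh (Initial₈.core M))
        using (_#_; #-Vr; #-Ap; #-Lm; rn-Vr; rn-Ap; rn-Lm₁; rn-Bvr)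

mainTheorem3 : (Var : Set) (enum : Var ↔ ℕ) (em : ExcludedMiddle 0ℓ) →
    let open Nominal.Recursors Var enum em in
    (r₆ ≥ r₅) × (r₅ ≥ r₄) × (r₄ ≥ r₂) × (r₂ ≥ r₁) × (r₁ ≡ᵣ r₃) × (r₉ ≥ r₈) × (r₉ ≥ r₇)
mainTheorem3 Var enum em =
    ≥-from r₆ r₅ (λ M → 5→6 Var enum M , refl)
  , ≥-from r₅ r₄ (λ M → 4→5 Var enum em M , refl)
  , ≥-from r₄ r₂ (λ M → 2→4 Var enum M , refl)
  , ≥-from r₂ r₁ (λ M → 1→2 Var enum em M , refl)
  , (≥-from r₁ r₃ (λ M → 3→1 Var enum em M , refl) , ≥-from r₃ r₁ (λ M → 1→3 Var enum em M , refl))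
  , ≥-from r₉ r₈ (λ M → 8→9 Var enum em M , refl)
  , ≥-from r₉ r₇ (λ M → 7→9 Var enum M , refl)
  where
  open Nominal.Recursors Var enum em
  ≥-from = ≥-from-models Var enum
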